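{- For every sufficiently small $\Delta>0$ there exists $\epsilon>0$ such that the following holds for all sufficiently large $N$ divisible by $3$. Let $G=(V_1,V_2,V_3;E)$ be a balanced tripartite graph on $3N$ vertices such that each vertex is adjacent to at least $(2/3-\epsilon)N$ vertices in each of the other two vertex classes. Then either $G$ contains $N$ vertex-disjoint triangles (covering all vertices), or $G$ has three sets $X_1\subseteq V_1$, $X_2\subseteq V_2$, $X_3\subseteq V_3$, each of size $N/3$, with $d(X_i,X_j)\leq\Delta$ for all $i\neq j$.
   Context: For disjoint nonempty vertex sets $A,B$, $e(A,B)$ is the number of edges with one endpoint in $A$ and the other in $B$, and $d(A,B)=e(A,B)/(|A||B|)$ is the density. -}

module Defs where

open import Data.Nat as ℕ using (ℕ; zero; suc)
open import Data.Integer using (+_)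
open import Data.Rational using (ℚ; 0ℚ; _/_; _*_; _-_; _≤_)
open import Data.Bool using (Bool; true; false; if_then_else_; _∧_)
open import Data.Fin using (Fin; zero; suc)
open import Data.Fin.Subset using (Subset; ∣_∣)
open import Data.Vec using (lookup)
open import Data.Product using (_×_; Σ-syntax)
open import Function.Definitions using (Injective)
open import Relation.Binary.PropositionalEquality using (_≡_; _≢_)

sumFin : ∀ n → (Fin n → ℕ) → ℕ
sumFin zero    f = 0
sumFin (suc n) f = f zero ℕ.+ sumFin n (λ i → f (suc i))

b2n : Bool → ℕ
b2n true  = 1
b2n false = 0

ℕ→ℚ : ℕ → ℚ
ℕ→ℚ n = + n / 1

-- a / b as a rational (only used with b ≠ 0; value 0 if b = 0)
frac : ℕ → ℕ → ℚ
frac a zero    = 0ℚ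
frac a (suc b) = + a / suc b

-- A balanced tripartite graph with classes V₁,V₂,V₃, each a copy of Fin N.
-- Vertex (i , v) is vertex v of class V_i.  adj i j u v : is u ∈ V_i adjacent to v ∈ V_j.
record TriGraph (N : ℕ) : Set where
  field
    adj     : Fin 3 → Fin 3 → Fin N → Fin N → Bool
    sym     : ∀ i j u v → adj i j u v ≡ adj j i v u
    noIntra : ∀ i u v → adj i i u v ≡ false
open TriGraph public

deg : ∀ {N} → TriGraph N → Fin 3 → Fin 3 → Fin N → ℕ
deg {N} G i j v = sumFin N (λ u → b2n (adj G i j v u))

MinDeg : ∀ {N} → TriGraph N → ℚ → Set
MinDeg {N} G ε = ∀ i j → i ≢ j → ∀ v → (+ 2 / 3 - ε) * ℕ→ℚ N ≤ ℕ→ℚ (deg G i j v)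

edges : ∀ {N} → TriGraph N → Fin 3 → Fin 3 → Subset N → Subset N → ℕ
edges {N} G i j X Y =
  sumFin N (λ u → sumFin N (λ v → b2n (lookup X u ∧ lookup Y v ∧ adj G i j u v)))

density : ∀ {N} → TriGraph N → Fin 3 → Fin 3 → Subset N → Subset N → ℚ
density G i j X Y = frac (edges G i j X Y) (∣ X ∣ ℕ.* ∣ Y ∣)

-- N vertex-disjoint triangles covering all 3N vertices.  Since G has no edges inside
-- a class, every triangle has exactly one vertex in each class; triangle k is
-- (k ∈ V₁, σ₂ k ∈ V₂, σ₃ k ∈ V₃), disjointness/covering = σ₂, σ₃ injective (hence bijective).
TriangleFactor : ∀ {N} → TriGraph N → Set
TriangleFactor {N} G =
  Σ[ σ₂ ∈ (Fin N → Fin N) ] Σ[ σ₃ ∈ (Fin N → Fin N) ]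
    (Injective _≡_ _≡_ σ₂ × Injective _≡_ _≡_ σ₃ ×
     (∀ k → adj G zero (suc zero) k (σ₂ k) ≡ true
          × adj G zero (suc (suc zero)) k (σ₃ k) ≡ true
          × adj G (suc zero) (suc (suc zero)) (σ₂ k) (σ₃ k) ≡ true))

SparseTriple : ∀ {N} → TriGraph N → ℚ → Set
SparseTriple {N} G Δ =
  Σ[ X ∈ (Fin 3 → Subset N) ]
    ((∀ i → ∣ X i ∣ ≡ N ℕ./ 3) ×
     (∀ i j → i ≢ j → density G i j (X i) (X j) ≤ Δ))

{-# OPTIONS --safe #-}
module Submission where

-- Suppose that G has neither a triangle factor nor a sparse triple. Write N = 3m and measure all
-- errors in multiples of a unit u, a small fraction of Δm.
--
-- Absorption. If many edges join the common neighbourhoods of x and z (vertices of one class) in the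
-- other two classes, then many triangles (z , b , c) allow x to be exchanged for z. If this fails for
-- x and y, and few z are exchangeable with both, then the common neighbourhoods of x and y extend to
-- a sparse triple. So any vertex can be exchanged for any other in at most two steps, and for every
-- triple of vertices a positive proportion of the units, consisting of six disjoint triangles,
-- absorbs the triple: the unit together with the triple has a triangle factor. Choosing by averaging
-- one unit after the other, each absorbing a constant fraction of the triples not yet served, a
-- linear number of disjoint units serves all triples. After 23 rounds the reserved triangles can
-- absorb any 23 left-over triples.
--
-- Almost tiling. Arrange the vertices in triples, keeping the reserved triangles, with as few
-- non-triangles as possible, and suppose that 24 of them remain. Call their vertices holes. A hole v
-- can be exchanged for a vertex of a triangle whose other two vertices are adjacent to v, and an edge
-- of two holes for two vertices of a triangle whose third vertex is adjacent to both; by optimality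
-- three holes never form a triangle. If no edge of holes can be created between some two classes, the
-- sets of possible holes lead to a sparse triple. Otherwise create two edges between any two classes;
-- now about 2m vertices of each class can be turned into holes independently, so they span hardly any
-- triangle, and again this forces a sparse triple.

open import Defs hiding (sym)
open import Data.Nat
open import Data.Nat.DivMod using (_/_; _%_; m≡m%n+[m/n]*n; m%n<n; m*n/n≡m)
open import Data.Nat.Divisibility using (_∣_; divides)
open import Data.Nat.Properties
open import Data.Nat.Tactic.RingSolver using (solve-∀)
import Data.Integer as ℤ
import Data.Integer.Properties as ℤ
import Data.Integer.Tactic.RingSolver as ℤ
open import Data.Rational using (ℚ; mkℚ; 0ℚ; 1ℚ; toℚᵘ; *<*) renaming (_≤_ to _≤ℚ_; _<_ to _<ℚ_; _/_ to _/ℚ_; _*_ to _*ℚ_; _-_ to _-ℚ_; -_ to -ℚ_)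
import Data.Rational.Properties as ℚ
open import Data.Rational.Unnormalised using (mkℚᵘ; *≤*)
import Data.Rational.Unnormalised as ℚᵘ
import Data.Rational.Unnormalised.Properties as ℚᵘ
open import Data.Bool using (Bool; true; false; if_then_else_; T; not; _∧_; _∨_)
import Data.Bool.Properties as Bool
open import Data.Empty using (⊥; ⊥-elim)
open import Data.Fin using (Fin; zero; suc)
import Data.Fin as Fin
open import Data.Fin.Patterns
open import Data.Fin.Permutation using (Permutation′; _⟨$⟩ʳ_; _⟨$⟩ˡ_; _∘ₚ_; transpose; inverseˡ; inverseʳ) renaming (id to idₚ)
import Data.Fin.Permutation.Components as PC
import Data.Fin.Properties as Fin
open import Data.Fin.Subset using (Subset; ∣_∣)
open import Data.Fin.Subset.Properties using (anySubset?)
open import Data.List using (List; []; _∷_; _++_; length; map; zipWith; concatMap; cartesianProduct; allFin)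
import Data.List as List
open import Data.List.Membership.Propositional using (_∈_)
open import Data.List.Membership.Propositional.Properties using (∈-lookup; ∈-map⁺; ∈-++⁺ˡ; ∈-++⁺ʳ; ∈-++⁻; ∈-allFin; ∈-cartesianProduct⁺)
open import Data.List.Properties using (map-cong-local; map-++; length-++; length-map; length-tabulate)
import Data.List.Properties as List
open import Data.List.Relation.Binary.Permutation.Propositional using (_↭_)
import Data.List.Relation.Binary.Permutation.Propositional as ↭
open import Data.List.Relation.Binary.Permutation.Propositional.Properties using (++⁺ʳ; ∈-resp-↭; shift)
open import Data.List.Relation.Binary.Pointwise using (Pointwise; []; _∷_)
open import Data.List.Relation.Unary.All using (All; []; _∷_)
import Data.List.Relation.Unary.All as All
open import Data.List.Relation.Unary.AllPairs using (AllPairs; []; _∷_)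
open import Data.List.Relation.Unary.Any using (here; there)
open import Data.Product using (_×_; _,_; proj₁; proj₂; ∃-syntax)
import Data.Product.Properties as Product
open import Data.Sum using (_⊎_; inj₁; inj₂; [_,_]′)
open import Data.Vec using (tabulate)
open import Data.Vec.Properties using (lookup∘tabulate)
open import Function using (_∘_; flip; Equivalence)
open import Function.Definitions using (Injective)
open import Relation.Binary.PropositionalEquality hiding (J)
open import Relation.Nullary using (Dec; yes; no; ¬_; ¬?; ⌊_⌋; _×-dec_; _→-dec_)
open import Relation.Nullary.Decidable using (map′; dec-true; dec-false)
import Algebra.Properties.CommutativeMonoid.Sum as CommutativeMonoidSum
open CommutativeMonoidSum +-0-commutativeMonoid using (sum; sum-permute; ∑-distrib-+; ∑-comm)

-- Candidate sets consist of positions, not of vertices. Whether a position can take part in an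
-- exchange depends on its vertices in some classes, while the exchange frees its vertices in the
-- others; so a set defined by adjacency in class `k` is afterwards read as a set of vertices of
-- class `i` or `j`. The price is that each position serves only one exchange: all sets avoid a list
-- of used positions, and "no edges" means none except between vertices at equal positions. One
-- exchange has only about `m` candidates. The `2 m` possible holes per class come from two disjoint
-- candidate sets, hence two edges for each pair of classes and six blocks. A block has four slots
-- because four holes of class `k` stay in play while an edge between the other two classes is being
-- forced. Both alternatives of the theorem are decidable, so the argument is a refutation, and
-- existence claims about states become continuations into `⊥`. The slack 200 has to exceed 2 · 67
-- in `many-reach-both`, and 67 = 6 · 11 + 1 comes from `few-neighbours-small`.

module LinearArithmetic where
  open import Data.Integer as ℤ using (ℤ) renaming (+_ to pos; -[1+_] to negsuc)
  open import Data.Maybe using (Maybe; just; nothing)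
  open import Data.Vec using (Vec; []; _∷_; lookup) renaming (map to mapᵥ; allFin to allFinᵥ)

  -- Linear inequalities over the natural numbers, proved by certificates

  data Expr (n : ℕ) : Set where
    var : Fin n → Expr n
    con : ℕ → Expr n
    _:+_ _:*_ : Expr n → Expr n → Expr n

  data Ineq (n : ℕ) : Set where
    _:≤_ : Expr n → Expr n → Ineq n

  data Problem (n : ℕ) : Set where
    ⊢_ : Ineq n → Problem n
    _⇒_ : Ineq n → Problem n → Problem n

  infixl 6 _:+_
  infixl 7 _:*_ _·_
  infix 4 _:≤_ _:<_
  infixr 3 _⇒_
  infix 3 ⊢_

  _·_ : ∀ {n} → ℕ → Expr n → Expr n
  k · e = con k :* e

  _:<_ : ∀ {n} → Expr n → Expr n → Ineq n
  a :< b = con 1 :+ a :≤ b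

  ⟦_⟧ : ∀ {n} → Expr n → Vec ℕ n → ℕ
  ⟦ var x ⟧ ρ = lookup ρ x
  ⟦ con k ⟧ ρ = k
  ⟦ a :+ b ⟧ ρ = ⟦ a ⟧ ρ + ⟦ b ⟧ ρ
  ⟦ a :* b ⟧ ρ = ⟦ a ⟧ ρ * ⟦ b ⟧ ρ

  ⟦_⟧≤ : ∀ {n} → Ineq n → Vec ℕ n → Set
  ⟦ a :≤ b ⟧≤ ρ = ⟦ a ⟧ ρ ≤ ⟦ b ⟧ ρ

  ⟦_⟧ₚ : ∀ {n} → Problem n → Vec ℕ n → Set
  ⟦ ⊢ g ⟧ₚ ρ = ⟦ g ⟧≤ ρ
  ⟦ h ⇒ p ⟧ₚ ρ = ⟦ h ⟧≤ ρ → ⟦ p ⟧ₚ ρ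

  Mono Poly : ℕ → Set
  Mono n = List (Fin n)
  Poly n = List (ℕ × Mono n)

  module _ {n : ℕ} (ρ : Vec ℕ n) where
    evM : Mono n → ℕ
    evM [] = 1
    evM (x ∷ m) = lookup ρ x * evM m

    evP : Poly n → ℕ
    evP [] = 0
    evP ((c , m) ∷ p) = c * evM m + evP p

  insM : ∀ {n} → Fin n → Mono n → Mono n
  insM x [] = x ∷ []
  insM x (y ∷ m) = if Fin.toℕ x ≤ᵇ Fin.toℕ y then x ∷ y ∷ m else y ∷ insM x m

  mulM : ∀ {n} → Mono n → Mono n → Mono n
  mulM [] m = m
  mulM (x ∷ l) m = insM x (mulM l m)

  addT : ∀ {n} → ℕ → Mono n → Poly n → Poly n
  addT c m [] = (c , m) ∷ []
  addT c m ((d , l) ∷ p) with List.≡-dec Fin._≟_ m l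
  ... | yes _ = (c + d , l) ∷ p
  ... | no _ = (d , l) ∷ addT c m p

  addP : ∀ {n} → Poly n → Poly n → Poly n
  addP [] q = q
  addP ((c , m) ∷ p) q = addT c m (addP p q)

  mulT : ∀ {n} → ℕ → Mono n → Poly n → Poly n
  mulT c m [] = []
  mulT c m ((d , l) ∷ p) = addT (c * d) (mulM m l) (mulT c m p)

  mulP : ∀ {n} → Poly n → Poly n → Poly n
  mulP [] q = []
  mulP ((c , m) ∷ p) q = addP (mulT c m q) (mulP p q)

  norm : ∀ {n} → Expr n → Poly n
  norm (var x) = (1 , x ∷ []) ∷ []
  norm (con k) = (k , []) ∷ []
  norm (a :+ b) = addP (norm a) (norm b)
  norm (a :* b) = mulP (norm a) (norm b)

  subT : ∀ {n} → ℕ → Mono n → Poly n → Maybe (Poly n)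
  subT zero m p = just p
  subT (suc c) m [] = nothing
  subT (suc c) m ((d , l) ∷ p) with List.≡-dec Fin._≟_ m l | suc c ≤? d
  ... | yes _ | yes _ = just ((d ∸ suc c , l) ∷ p)
  ... | yes _ | no _ = nothing
  ... | no _ | _ with subT (suc c) m p
  ...   | just q = just ((d , l) ∷ q)
  ...   | nothing = nothing

  -- Coefficientwise domination; it suffices because monomials take nonnegative values on natural
  -- numbers.
  leP : ∀ {n} → Poly n → Poly n → Bool
  leP [] q = true
  leP ((c , m) ∷ p) q with subT c m q
  ... | just q′ = leP p q′
  ... | nothing = false

  module _ {n : ℕ} (ρ : Vec ℕ n) where
    insM-sound : ∀ x (m : Mono n) → evM ρ (insM x m) ≡ lookup ρ x * evM ρ m
    insM-sound x [] = refl
    insM-sound x (y ∷ m) with Fin.toℕ x ≤ᵇ Fin.toℕ y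
    ... | true = refl
    ... | false = trans (cong (lookup ρ y *_) (insM-sound x m)) (lem (lookup ρ y) (lookup ρ x) (evM ρ m))
      where
      lem : ∀ a b c → a * (b * c) ≡ b * (a * c)
      lem = solve-∀

    mulM-sound : ∀ (l m : Mono n) → evM ρ (mulM l m) ≡ evM ρ l * evM ρ m
    mulM-sound [] m = sym (+-identityʳ _)
    mulM-sound (x ∷ l) m =
      trans (insM-sound x (mulM l m)) (trans (cong (lookup ρ x *_) (mulM-sound l m)) (sym (*-assoc (lookup ρ x) _ _)))

    addT-sound : ∀ c m (p : Poly n) → evP ρ (addT c m p) ≡ c * evM ρ m + evP ρ p
    addT-sound c m [] = refl
    addT-sound c m ((d , l) ∷ p) with List.≡-dec Fin._≟_ m l
    ... | yes refl = trans (cong (_+ evP ρ p) (*-distribʳ-+ (evM ρ m) c d)) (+-assoc (c * evM ρ m) _ _)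
    ... | no _ = trans (cong (d * evM ρ l +_) (addT-sound c m p)) (lem (d * evM ρ l) (c * evM ρ m) (evP ρ p))
      where
      lem : ∀ a b c → a + (b + c) ≡ b + (a + c)
      lem = solve-∀

    addP-sound : ∀ (p q : Poly n) → evP ρ (addP p q) ≡ evP ρ p + evP ρ q
    addP-sound [] q = refl
    addP-sound ((c , m) ∷ p) q =
      trans (addT-sound c m (addP p q)) (trans (cong (c * evM ρ m +_) (addP-sound p q)) (sym (+-assoc (c * evM ρ m) _ _)))

    mulT-sound : ∀ c m (p : Poly n) → evP ρ (mulT c m p) ≡ c * evM ρ m * evP ρ p
    mulT-sound c m [] = sym (*-zeroʳ (c * evM ρ m))
    mulT-sound c m ((d , l) ∷ p) =
      trans (addT-sound (c * d) (mulM m l) (mulT c m p))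
        (trans (cong₂ (λ a b → c * d * a + b) (mulM-sound m l) (mulT-sound c m p))
          (lem c d (evM ρ m) (evM ρ l) (evP ρ p)))
      where
      lem : ∀ c d m l p → c * d * (m * l) + c * m * p ≡ c * m * (d * l + p)
      lem = solve-∀

    mulP-sound : ∀ (p q : Poly n) → evP ρ (mulP p q) ≡ evP ρ p * evP ρ q
    mulP-sound [] q = refl
    mulP-sound ((c , m) ∷ p) q =
      trans (addP-sound (mulT c m q) (mulP p q))
        (trans (cong₂ _+_ (mulT-sound c m q) (mulP-sound p q)) (sym (*-distribʳ-+ (evP ρ q) (c * evM ρ m) (evP ρ p))))

    norm-sound : ∀ e → evP ρ (norm e) ≡ ⟦ e ⟧ ρ
    norm-sound (var x) = lem (lookup ρ x)
      where
      lem : ∀ a → 1 * (a * 1) + 0 ≡ a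
      lem = solve-∀
    norm-sound (con k) = lem k
      where
      lem : ∀ a → a * 1 + 0 ≡ a
      lem = solve-∀
    norm-sound (a :+ b) = trans (addP-sound (norm a) (norm b)) (cong₂ _+_ (norm-sound a) (norm-sound b))
    norm-sound (a :* b) = trans (mulP-sound (norm a) (norm b)) (cong₂ _*_ (norm-sound a) (norm-sound b))

    subT-sound : ∀ c m (p : Poly n) {q} → subT c m p ≡ just q → evP ρ p ≡ c * evM ρ m + evP ρ q
    subT-sound zero m p refl = refl
    subT-sound (suc c) m ((d , l) ∷ p) eq with List.≡-dec Fin._≟_ m l | suc c ≤? d
    subT-sound (suc c) m ((d , l) ∷ p) refl | yes refl | yes c≤d =
      trans (cong (λ z → z * evM ρ m + evP ρ p) (sym (m+[n∸m]≡n c≤d)))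
        (trans (cong (_+ evP ρ p) (*-distribʳ-+ (evM ρ m) (suc c) (d ∸ suc c))) (+-assoc (suc c * evM ρ m) _ _))
    subT-sound (suc c) m ((d , l) ∷ p) eq | no _ | _ with subT (suc c) m p in eq′
    subT-sound (suc c) m ((d , l) ∷ p) refl | no _ | _ | just q =
      trans (cong (d * evM ρ l +_) (subT-sound (suc c) m p eq′)) (lem (d * evM ρ l) (suc c * evM ρ m) (evP ρ q))
      where
      lem : ∀ a b c → a + (b + c) ≡ b + (a + c)
      lem = solve-∀

    leP-sound : ∀ (p q : Poly n) → T (leP p q) → evP ρ p ≤ evP ρ q
    leP-sound [] q _ = z≤n
    leP-sound ((c , m) ∷ p) q h with subT c m q in eq
    ... | just q′ = subst (c * evM ρ m + evP ρ p ≤_) (sym (subT-sound c m q eq)) (+-monoʳ-≤ (c * evM ρ m) (leP-sound p q′ h))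

  -- Rows are vectors over the monomials, tagged by the multiplier of the goal and of each hypothesis.
  -- Eliminating a coordinate keeps the generators of the cone of those combinations that are
  -- nonnegative there.
  Row : Set
  Row = List ℤ × List ℕ

  nonneg : ℤ → Bool
  nonneg (pos _) = true
  nonneg (negsuc _) = false

  positive : ℤ → Bool
  positive (pos (suc _)) = true
  positive _ = false

  nth : ℕ → List ℤ → ℤ
  nth _ [] = pos 0
  nth zero (x ∷ _) = x
  nth (suc k) (_ ∷ xs) = nth k xs

  dropAt : ℕ → List ℤ → List ℤ
  dropAt _ [] = []
  dropAt zero (_ ∷ xs) = xs
  dropAt (suc k) (x ∷ xs) = x ∷ dropAt k xs

  keep : (Row → Bool) → List Row → List Row
  keep f [] = []
  keep f (r ∷ rs) = if f r then r ∷ keep f rs else keep f rs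

  combine : ℕ → Row → Row → Row
  combine k (x , s) (y , t) =
    let a = ℤ.∣ nth k y ∣ ; b = ℤ.∣ nth k x ∣ in
    dropAt k (zipWith (λ p q → pos a ℤ.* p ℤ.+ pos b ℤ.* q) x y) , zipWith (λ p q → a * p + b * q) s t

  eliminate : ℕ → List Row → List Row
  eliminate k rs =
    let ups = keep (λ r → positive (nth k (proj₁ r))) rs
        downs = keep (λ r → not (nonneg (nth k (proj₁ r)))) rs
    in map (λ r → dropAt k (proj₁ r) , proj₂ r) (keep (λ r → nonneg (nth k (proj₁ r))) rs)
       ++ concatMap (λ p → map (combine k p) downs) ups

  cost : ℕ → List Row → ℕ
  cost k rs = length (keep (λ r → positive (nth k (proj₁ r))) rs) * length (keep (λ r → not (nonneg (nth k (proj₁ r)))) rs)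

  cheapest : ℕ → ℕ → ℕ → List Row → ℕ
  cheapest zero best c rs = best
  cheapest (suc k) best c rs = let c′ = cost k rs in if c′ <ᵇ c then cheapest k k c′ rs else cheapest k best c rs

  search : ℕ → List Row → List Row
  search zero rs = rs
  search (suc k) rs = search k (eliminate (cheapest k k (cost k rs) rs) rs)

  -- The first tag is the multiplier of the goal; a combination in which it vanishes says nothing
  -- about the goal.
  pick : List Row → List ℕ
  pick [] = []
  pick ((_ , zero ∷ _) ∷ rs) = pick rs
  pick ((_ , t) ∷ rs) = t

  monos : ∀ {n} → Problem n → Poly n
  monos (⊢ (a :≤ b)) = addP (norm a) (norm b)
  monos ((a :≤ b) ⇒ p) = addP (addP (norm a) (norm b)) (monos p)

  coeff : ∀ {n} → Mono n → Poly n → ℤ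
  coeff m [] = pos 0
  coeff m ((c , l) ∷ p) with List.≡-dec Fin._≟_ m l
  ... | yes _ = pos c
  ... | no _ = coeff m p

  vec : ∀ {n} → Poly n → Expr n → Expr n → List ℤ
  vec ms a b = let p = norm a ; q = norm b in map (λ cm → coeff (proj₂ cm) q ℤ.- coeff (proj₂ cm) p) ms

  size : ∀ {n} → Problem n → ℕ
  size (⊢ _) = 0
  size (_ ⇒ p) = suc (size p)

  unit : ℕ → ℕ → List ℕ
  unit zero _ = []
  unit (suc n) zero = 1 ∷ unit n n
  unit (suc n) (suc k) = 0 ∷ unit n k

  rows : ∀ {n} → Poly n → ℕ → ℕ → Problem n → List Row
  rows ms s k (⊢ (a :≤ b)) = (vec ms a b , unit (suc s) 0) ∷ []
  rows ms s k ((a :≤ b) ⇒ p) = (vec ms b a , unit (suc s) (suc k)) ∷ rows ms s (suc k) p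

  certificate : ∀ {n} → Problem n → List ℕ
  certificate p = let ms = monos p in pick (search (length ms) (rows ms (size p) 0 p))

  -- Each hypothesis enters with its two sides exchanged, so that the certified inequality needs no
  -- subtraction.
  lhs rhs : ∀ {n} → Problem n → ℕ → List ℕ → Poly n
  lhs (⊢ (a :≤ b)) K ks = mulT K [] (norm a)
  lhs ((a :≤ b) ⇒ p) K [] = lhs p K []
  lhs ((a :≤ b) ⇒ p) K (k ∷ ks) = addP (mulT k [] (norm b)) (lhs p K ks)
  rhs (⊢ (a :≤ b)) K ks = mulT K [] (norm b)
  rhs ((a :≤ b) ⇒ p) K [] = rhs p K []
  rhs ((a :≤ b) ⇒ p) K (k ∷ ks) = addP (mulT k [] (norm a)) (rhs p K ks)

  accept : ∀ {n} → Problem n → List ℕ → Bool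
  accept p (suc K ∷ ks) = leP (lhs p (suc K) ks) (rhs p (suc K) ks)
  accept p _ = false

  module _ {n : ℕ} (ρ : Vec ℕ n) where
    scale-sound : ∀ k e → evP ρ (mulT k [] (norm e)) ≡ k * ⟦ e ⟧ ρ
    scale-sound k e = trans (mulT-sound ρ k [] (norm e)) (cong₂ _*_ (*-identityʳ k) (norm-sound ρ e))

    -- The accumulators `x` and `y` collect the scaled right and left sides of the hypotheses
    -- already read, and `y ≤ x` is their sum. At the goal they cancel.
    combination : ∀ p K ks x y → evP ρ (lhs p (suc K) ks) + x ≤ evP ρ (rhs p (suc K) ks) + y → y ≤ x → ⟦ p ⟧ₚ ρ
    combination (⊢ (a :≤ b)) K ks x y h y≤x = *-cancelˡ-≤ (suc K)
      (+-cancelʳ-≤ x _ _ (≤-trans (subst₂ (λ s t → s + x ≤ t + y) (scale-sound (suc K) a) (scale-sound (suc K) b) h)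
        (+-monoʳ-≤ (suc K * ⟦ b ⟧ ρ) y≤x)))
    combination ((a :≤ b) ⇒ p) K [] x y h y≤x _ = combination p K [] x y h y≤x
    combination ((a :≤ b) ⇒ p) K (k ∷ ks) x y h y≤x a≤b =
      combination p K ks (k * ⟦ b ⟧ ρ + x) (k * ⟦ a ⟧ ρ + y)
        (subst₂ _≤_ (shuffle b (lhs p (suc K) ks) x) (shuffle a (rhs p (suc K) ks) y) h)
        (+-mono-≤ (*-monoʳ-≤ k a≤b) y≤x)
      where
      lem : ∀ a b c → a + b + c ≡ b + (a + c)
      lem = solve-∀
      shuffle : ∀ e q z → evP ρ (addP (mulT k [] (norm e)) q) + z ≡ evP ρ q + (k * ⟦ e ⟧ ρ + z)
      shuffle e q z = trans (cong (_+ z) (trans (addP-sound ρ (mulT k [] (norm e)) q) (cong (_+ evP ρ q) (scale-sound k e))))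
        (lem (k * ⟦ e ⟧ ρ) (evP ρ q) z)

    accept-sound : ∀ p ks → T (accept p ks) → ⟦ p ⟧ₚ ρ
    accept-sound p (suc K ∷ ks) h =
      combination p K ks 0 0 (+-monoˡ-≤ 0 (leP-sound ρ (lhs p (suc K) ks) (rhs p (suc K) ks) h)) z≤n

  Π : ∀ n → (Vec ℕ n → Set) → Set
  Π zero P = P []
  Π (suc n) P = ∀ x → Π n (λ ρ → P (x ∷ ρ))

  Π-intro : ∀ n {P : Vec ℕ n → Set} → (∀ ρ → P ρ) → Π n P
  Π-intro zero h = h []
  Π-intro (suc n) h x = Π-intro n (λ ρ → h (x ∷ ρ))

  Fun : ℕ → Set → Set → Set
  Fun zero A B = B
  Fun (suc n) A B = A → Fun n A B

  app : ∀ {A B} n → Fun n A B → Vec A n → B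
  app zero f [] = f
  app (suc n) f (x ∷ xs) = app n (f x) xs

  close : ∀ n → Fun n (Expr n) (Problem n) → Problem n
  close n f = app n f (mapᵥ var (allFinᵥ n))

  -- Fourier-Motzkin elimination proposes the multipliers, and soundness rests on `accept` alone.
  -- Monomials count as atoms, so wherever an inequality has to be multiplied by a variable the
  -- product is supplied as a hypothesis.
  lin : ∀ n (f : Fun n (Expr n) (Problem n)) {_ : T (accept (close n f) (certificate (close n f)))} → Π n ⟦ close n f ⟧ₚ
  lin n f {h} = Π-intro n λ ρ → accept-sound ρ (close n f) (certificate (close n f)) h

open LinearArithmetic using (lin; con; _:≤_; _:<_; _⇒_; ⊢_; _·_; _:+_; _:*_)

-- Counting

∧-elim : ∀ {a b} → a ∧ b ≡ true → a ≡ true × b ≡ true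
∧-elim {true} {true} _ = refl , refl

∧-intro : ∀ {a b} → a ≡ true → b ≡ true → a ∧ b ≡ true
∧-intro refl refl = refl

∨-elim : ∀ {a b} → a ∨ b ≡ true → a ≡ true ⊎ b ≡ true
∨-elim {true} _ = inj₁ refl
∨-elim {false} h = inj₂ h

∨-introˡ : ∀ {a b} → a ≡ true → a ∨ b ≡ true
∨-introˡ refl = refl

∨-introʳ : ∀ {a b} → b ≡ true → a ∨ b ≡ true
∨-introʳ {true} _ = refl
∨-introʳ {false} h = h

not-elim : ∀ {a} → not a ≡ true → a ≡ true → ⊥
not-elim {false} _ ()

not-intro : ∀ {a} → (a ≡ true → ⊥) → not a ≡ true
not-intro {true} h = ⊥-elim (h refl)
not-intro {false} h = refl

bool? : ∀ a → a ≡ true ⊎ (a ≡ true → ⊥)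
bool? true = inj₁ refl
bool? false = inj₂ λ ()

<ᵇ-elim : ∀ {m n} → (m <ᵇ n) ≡ true → m < n
<ᵇ-elim {m} {n} h = <ᵇ⇒< m n (Equivalence.from Bool.T-≡ h)

<ᵇ-intro : ∀ {m n} → m < n → (m <ᵇ n) ≡ true
<ᵇ-intro {m} {n} h = Equivalence.to Bool.T-≡ (<⇒<ᵇ h)

true≢false : true ≢ false
true≢false ()

1≰0 : ¬ (1 ≤ 0)
1≰0 ()

sumFin≡sum : ∀ {n} (f : Fin n → ℕ) → sumFin n f ≡ sum f
sumFin≡sum {zero} f = refl
sumFin≡sum {suc n} f = cong (f zero +_) (sumFin≡sum (f ∘ suc))

sum-mono : ∀ {n} {f g : Fin n → ℕ} → (∀ x → f x ≤ g x) → sumFin n f ≤ sumFin n g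
sum-mono {zero} h = z≤n
sum-mono {suc n} h = +-mono-≤ (h zero) (sum-mono (h ∘ suc))

sum-cong : ∀ {n} {f g : Fin n → ℕ} → (∀ x → f x ≡ g x) → sumFin n f ≡ sumFin n g
sum-cong {zero} h = refl
sum-cong {suc n} h = cong₂ _+_ (h zero) (sum-cong (h ∘ suc))

sum-+ : ∀ {n} (f g : Fin n → ℕ) → sumFin n (λ x → f x + g x) ≡ sumFin n f + sumFin n g
sum-+ f g = trans (sumFin≡sum (λ x → f x + g x)) (trans (∑-distrib-+ f g) (sym (cong₂ _+_ (sumFin≡sum f) (sumFin≡sum g))))

sum-* : ∀ {n} c (f : Fin n → ℕ) → sumFin n (λ x → c * f x) ≡ c * sumFin n f
sum-* {zero} c f = sym (*-zeroʳ c)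
sum-* {suc n} c f = trans (cong (c * f zero +_) (sum-* c (f ∘ suc))) (sym (*-distribˡ-+ c (f zero) _))

sum-const : ∀ n c → sumFin n (λ _ → c) ≡ n * c
sum-const zero c = refl
sum-const (suc n) c = cong (c +_) (sum-const n c)

sum-swap : ∀ {n k} (f : Fin n → Fin k → ℕ) →
  sumFin n (λ x → sumFin k (f x)) ≡ sumFin k (λ y → sumFin n (λ x → f x y))
sum-swap {n} {k} f = begin
  sumFin n (λ x → sumFin k (f x))  ≡⟨ sum-cong (λ x → sumFin≡sum (f x)) ⟩
  sumFin n (λ x → sum (f x))       ≡⟨ sumFin≡sum (λ x → sum (f x)) ⟩
  sum (λ x → sum (f x))            ≡⟨ ∑-comm f ⟩
  sum (λ y → sum (λ x → f x y))    ≡⟨ sumFin≡sum (λ y → sum (λ x → f x y)) ⟨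
  sumFin k (λ y → sum (λ x → f x y)) ≡⟨ sum-cong (λ y → sumFin≡sum (λ x → f x y)) ⟨
  sumFin k (λ y → sumFin n (λ x → f x y)) ∎
  where open ≡-Reasoning

sum-perm : ∀ {n} (π : Permutation′ n) (f : Fin n → ℕ) → sumFin n (λ x → f (π ⟨$⟩ʳ x)) ≡ sumFin n f
sum-perm π f = trans (sumFin≡sum (λ x → f (π ⟨$⟩ʳ x))) (trans (sym (sum-permute f π)) (sym (sumFin≡sum f)))

some-above-average : ∀ n (f : Fin (suc n) → ℕ) → ∃[ x ] sumFin (suc n) f ≤ suc n * f x
some-above-average zero f = zero , ≤-refl
some-above-average (suc n) f with some-above-average n (f ∘ suc)
... | x , h with f zero ≤? f (suc x)
...   | yes p = suc x , +-mono-≤ p h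
...   | no p = zero , +-monoʳ-≤ (f zero) (≤-trans h (*-monoʳ-≤ (suc n) (<⇒≤ (≰⇒> p))))

b2n-mono : ∀ {a b} → (a ≡ true → b ≡ true) → b2n a ≤ b2n b
b2n-mono {true} h rewrite h refl = ≤-refl
b2n-mono {false} h = z≤n

opaque
  cnt : ∀ {n} → (Fin n → Bool) → ℕ
  cnt {n} f = sumFin n (λ x → b2n (f x))

opaque
  _∩_ _∪_ _∖_ : ∀ {n} → (Fin n → Bool) → (Fin n → Bool) → Fin n → Bool
  (f ∩ g) x = f x ∧ g x
  (f ∪ g) x = f x ∨ g x
  (f ∖ g) x = f x ∧ not (g x)

  ∩-elim : ∀ {n} {f g : Fin n → Bool} {x} → (f ∩ g) x ≡ true → f x ≡ true × g x ≡ true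
  ∩-elim = ∧-elim

  ∩-intro : ∀ {n} {f g : Fin n → Bool} {x} → f x ≡ true → g x ≡ true → (f ∩ g) x ≡ true
  ∩-intro = ∧-intro

  ∪-elim : ∀ {n} {f g : Fin n → Bool} {x} → (f ∪ g) x ≡ true → f x ≡ true ⊎ g x ≡ true
  ∪-elim = ∨-elim

  ∪-introˡ : ∀ {n} {f g : Fin n → Bool} {x} → f x ≡ true → (f ∪ g) x ≡ true
  ∪-introˡ = ∨-introˡ

  ∪-introʳ : ∀ {n} {f g : Fin n → Bool} {x} → g x ≡ true → (f ∪ g) x ≡ true
  ∪-introʳ = ∨-introʳ

  ∖-elim : ∀ {n} {f g : Fin n → Bool} {x} → (f ∖ g) x ≡ true → f x ≡ true × (g x ≡ true → ⊥)
  ∖-elim {f = f} {g} {x} h = let p , q = ∧-elim {f x} h in p , not-elim q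

  ∖-intro : ∀ {n} {f g : Fin n → Bool} {x} → f x ≡ true → (g x ≡ true → ⊥) → (f ∖ g) x ≡ true
  ∖-intro p q = ∧-intro p (not-intro q)

  above : ∀ {n} → ℕ → (Fin n → ℕ) → Fin n → Bool
  above q g x = q <ᵇ g x

  above-elim : ∀ {n q} {g : Fin n → ℕ} {x} → above q g x ≡ true → q < g x
  above-elim = <ᵇ-elim

  above-intro : ∀ {n q} {g : Fin n → ℕ} {x} → q < g x → above q g x ≡ true
  above-intro = <ᵇ-intro

infixr 7 _∩_
infixr 6 _∪_
infixl 7 _∖_

full : ∀ {n} → Fin n → Bool
full _ = true

opaque
  unfolding cnt _∩_

  cnt-mono : ∀ {n} {f g : Fin n → Bool} → (∀ x → f x ≡ true → g x ≡ true) → cnt f ≤ cnt g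
  cnt-mono {n} h = sum-mono (λ x → b2n-mono (h x))

  cnt-∪∩ : ∀ {n} (f g : Fin n → Bool) → cnt f + cnt g ≡ cnt (f ∪ g) + cnt (f ∩ g)
  cnt-∪∩ {n} f g = trans (sym (sum-+ {n} _ _)) (trans (sum-cong λ x → lem (f x) (g x)) (sum-+ {n} _ _))
    where
    lem : ∀ a b → b2n a + b2n b ≡ b2n (a ∨ b) + b2n (a ∧ b)
    lem true true = refl
    lem true false = refl
    lem false true = refl
    lem false false = refl

  cnt-split : ∀ {n} (f g : Fin n → Bool) → cnt f ≡ cnt (f ∩ g) + cnt (f ∖ g)
  cnt-split {n} f g = trans (sum-cong λ x → lem (f x) (g x)) (sum-+ {n} _ _)
    where
    lem : ∀ a b → b2n a ≡ b2n (a ∧ b) + b2n (a ∧ not b)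
    lem true true = refl
    lem true false = refl
    lem false true = refl
    lem false false = refl

  cnt-cover : ∀ {n} {f g h : Fin n → Bool} → (∀ x → f x ≡ true → g x ≡ true ⊎ h x ≡ true) → cnt f ≤ cnt g + cnt h
  cnt-cover {n} {f} {g} {h} c = subst (cnt f ≤_) (sum-+ {n} _ _) (sum-mono λ x → lem (c x))
    where
    lem : ∀ {a b c} → (a ≡ true → b ≡ true ⊎ c ≡ true) → b2n a ≤ b2n b + b2n c
    lem {false} h = z≤n
    lem {true} {b} h with h refl
    ... | inj₁ refl = s≤s z≤n
    ... | inj₂ refl = m≤n+m 1 (b2n b)

  cnt-disjoint : ∀ {n} {f g h : Fin n → Bool} → (∀ x → g x ≡ true → f x ≡ true) → (∀ x → h x ≡ true → f x ≡ true) →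
    (∀ x → g x ≡ true → h x ≡ true → ⊥) → cnt g + cnt h ≤ cnt f
  cnt-disjoint {n} {f} {g} {h} gf hf gh = subst (_≤ cnt f) (sum-+ {n} _ _) (sum-mono λ x → lem (gf x) (hf x) (gh x))
    where
    lem : ∀ {a b c} → (b ≡ true → a ≡ true) → (c ≡ true → a ≡ true) → (b ≡ true → c ≡ true → ⊥) → b2n b + b2n c ≤ b2n a
    lem {b = true} {true} p q r = ⊥-elim (r refl refl)
    lem {b = true} {false} p q r rewrite p refl = ≤-refl
    lem {b = false} {true} p q r rewrite q refl = ≤-refl
    lem {b = false} {false} p q r = z≤n

  cnt-all : ∀ n → cnt {n} full ≡ n
  cnt-all n = trans (sum-const n 1) (*-identityʳ n)

  cnt≤n : ∀ {n} (f : Fin n → Bool) → cnt f ≤ n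
  cnt≤n {n} f = subst (cnt f ≤_) (cnt-all n) (cnt-mono {f = f} {full} λ _ _ → refl)

  cnt-∃ : ∀ {n} (f : Fin n → Bool) → 0 < cnt f → ∃[ x ] f x ≡ true
  cnt-∃ {suc n} f h with f zero in eq
  ... | true = zero , eq
  ... | false with cnt-∃ (f ∘ suc) h
  ...   | x , p = suc x , p

  cnt-none : ∀ {n} (f : Fin n → Bool) → (∀ x → f x ≡ true → ⊥) → cnt f ≡ 0
  cnt-none f h = n<1⇒n≡0 (≰⇒> λ p → let x , q = cnt-∃ f p in h x q)

  cnt-< : ∀ {n} {f g : Fin n → Bool} → (∀ x → f x ≡ true → g x ≡ true) → ∀ d → f d ≡ false → g d ≡ true → cnt f < cnt g
  cnt-< {suc n} h zero p q rewrite p | q = s≤s (cnt-mono (h ∘ suc))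
  cnt-< {suc n} {f} {g} h (suc d) p q = subst (_≤ cnt g) (+-suc (b2n (f zero)) _) (+-mono-≤ (b2n-mono (h zero)) (cnt-< (h ∘ suc) d p q))

  cnt-perm : ∀ {n} (π : Permutation′ n) (f : Fin n → Bool) → cnt (λ x → f (π ⟨$⟩ʳ x)) ≡ cnt f
  cnt-perm π f = sum-perm π (λ x → b2n (f x))

infix 4 _==_
_==_ : ∀ {n} → Fin n → Fin n → Bool
x == y = ⌊ x Fin.≟ y ⌋

==-refl : ∀ {n} (x : Fin n) → (x == x) ≡ true
==-refl x with x Fin.≟ x
... | yes _ = refl
... | no p = ⊥-elim (p refl)

==-elim : ∀ {n} {x y : Fin n} → (x == y) ≡ true → x ≡ y
==-elim {x = x} {y} h with x Fin.≟ y
... | yes p = p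

==-≢ : ∀ {n} {x y : Fin n} → x ≢ y → (x == y) ≡ true → ⊥
==-≢ p h = p (==-elim h)

opaque
  unfolding cnt

  cnt-== : ∀ {n} (y : Fin n) → cnt (_== y) ≤ 1
  cnt-== {n} y = go n y
    where
    go : ∀ n (y : Fin n) → cnt (_== y) ≤ 1
    go (suc n) zero = s≤s (≤-reflexive (cnt-none {n} _ λ { x h → ==-≢ {x = suc x} {zero} (λ ()) h }))
    go (suc n) (suc y) = ≤-trans (cnt-mono {n} {λ x → suc x == suc y} {_== y} λ x h → subst (λ z → (x == z) ≡ true) (Fin.suc-injective (==-elim h)) (==-refl x)) (go n y)

opaque
  unfolding _∩_

  fresh : ∀ {n} → List (Fin n) → Fin n → Bool
  fresh [] x = true
  fresh (y ∷ ys) x = not (x == y) ∧ fresh ys x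

  fresh-[] : ∀ {n} {x : Fin n} → fresh [] x ≡ true
  fresh-[] = refl

  fresh-∷ : ∀ {n} {y x : Fin n} {ys} → x ≢ y → fresh ys x ≡ true → fresh (y ∷ ys) x ≡ true
  fresh-∷ p h = ∧-intro (not-intro (==-≢ p)) h

  fresh-head : ∀ {n} {y x : Fin n} {ys} → fresh (y ∷ ys) x ≡ true → x ≢ y
  fresh-head {y = y} h refl = not-elim (proj₁ (∧-elim {not (y == y)} h)) (==-refl y)

  fresh-∈ : ∀ {n} {x y : Fin n} {ys} → fresh ys x ≡ true → y ∈ ys → x ≢ y
  fresh-∈ {x = x} {ys = z ∷ zs} h (here refl) refl = not-elim (proj₁ (∧-elim {not (x == z)} h)) (==-refl z)
  fresh-∈ {x = x} {ys = z ∷ zs} h (there p) = fresh-∈ {ys = zs} (proj₂ (∧-elim {not (x == z)} h)) p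

  fresh-weaken : ∀ {n} {x : Fin n} {ys zs} → (∀ {y} → y ∈ zs → y ∈ ys) → fresh ys x ≡ true → fresh zs x ≡ true
  fresh-weaken {zs = zs} sub h = build zs λ p → fresh-∈ h (sub p)
    where
    build : ∀ {n} {x : Fin n} zs → (∀ {y} → y ∈ zs → x ≢ y) → fresh zs x ≡ true
    build [] f = refl
    build (z ∷ zs) f = fresh-∷ {ys = zs} (f (here refl)) (build zs (f ∘ there))

  fresh-tail : ∀ {n} {y x : Fin n} {ys} → fresh (y ∷ ys) x ≡ true → fresh ys x ≡ true
  fresh-tail {y = y} {x} h = proj₂ (∧-elim {not (x == y)} h)

  cnt-stale : ∀ {n} (ys : List (Fin n)) → cnt (λ x → not (fresh ys x)) ≤ length ys
  cnt-stale {n} [] = ≤-reflexive (cnt-none {n} _ λ _ ())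
  cnt-stale {n} (y ∷ ys) = ≤-trans (cnt-cover {g = _== y} {λ x → not (fresh ys x)} λ x → lem (x == y) (fresh ys x)) (+-mono-≤ (cnt-== y) (cnt-stale ys))
    where
    lem : ∀ a b → not (not a ∧ b) ≡ true → a ≡ true ⊎ not b ≡ true
    lem true b h = inj₁ refl
    lem false b h = inj₂ h

  cnt-stale′ : ∀ {n} (ys : List (Fin n)) → cnt (full ∖ fresh ys) ≤ length ys
  cnt-stale′ ys = ≤-trans (cnt-mono {f = full ∖ fresh ys} {λ x → not (fresh ys x)} λ x h → h) (cnt-stale ys)

  cnt-fresh : ∀ {n} (f : Fin n → Bool) ys → cnt f ≤ cnt (f ∩ fresh ys) + length ys
  cnt-fresh {n} f ys = ≤-trans (cnt-cover {g = f ∩ fresh ys} {λ x → not (fresh ys x)} λ x → lem (f x) (fresh ys x)) (+-monoʳ-≤ (cnt (f ∩ fresh ys)) (cnt-stale ys))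
    where
    lem : ∀ a b → a ≡ true → a ∧ b ≡ true ⊎ not b ≡ true
    lem true true h = inj₁ refl
    lem true false h = inj₂ refl

nb : ∀ {n k} (r : Fin n → Fin k → Bool) → (Fin k → Bool) → Fin n → ℕ
nb r Y x = cnt (Y ∩ r x)

opaque
  E : ∀ {n k} (r : Fin n → Fin k → Bool) → (Fin n → Bool) → (Fin k → Bool) → ℕ
  E {n} {k} r X Y = sumFin n λ x → sumFin k λ y → b2n (X x ∧ Y y ∧ r x y)

opaque
  unfolding cnt E _∩_

  E-row : ∀ {n k} (r : Fin n → Fin k → Bool) (X : Fin n → Bool) Y x → sumFin k (λ y → b2n (X x ∧ Y y ∧ r x y)) ≡ b2n (X x) * nb r Y x
  E-row {k = k} r X Y x with X x
  ... | true = sym (+-identityʳ _)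
  ... | false = trans (sum-const k 0) (*-zeroʳ k)

  E-≤ : ∀ {n k} (r : Fin n → Fin k → Bool) {X Y} q → (∀ x → X x ≡ true → nb r Y x ≤ q) → E r X Y ≤ q * cnt X
  E-≤ r {X} {Y} q h = subst (E r X Y ≤_) (sum-* q (λ x → b2n (X x))) (sum-mono λ x → subst (_≤ q * b2n (X x)) (sym (E-row r X Y x)) (lem x))
    where
    lem : ∀ x → b2n (X x) * nb r Y x ≤ q * b2n (X x)
    lem x with X x in eq
    ... | true = subst₂ _≤_ (sym (+-identityʳ _)) (sym (*-identityʳ q)) (h x eq)
    ... | false = z≤n

  E-≥ : ∀ {n k} (r : Fin n → Fin k → Bool) {X Y} q → (∀ x → X x ≡ true → q ≤ nb r Y x) → q * cnt X ≤ E r X Y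
  E-≥ r {X} {Y} q h = subst (_≤ E r X Y) (sum-* q (λ x → b2n (X x))) (sum-mono λ x → subst (q * b2n (X x) ≤_) (sym (E-row r X Y x)) (lem x))
    where
    lem : ∀ x → q * b2n (X x) ≤ b2n (X x) * nb r Y x
    lem x with X x in eq
    ... | true = subst₂ _≤_ (sym (*-identityʳ q)) (sym (+-identityʳ _)) (h x eq)
    ... | false = ≤-reflexive (*-zeroʳ q)

  E-mono : ∀ {n k} (r : Fin n → Fin k → Bool) {X X′ Y Y′} → (∀ x → X x ≡ true → X′ x ≡ true) → (∀ y → Y y ≡ true → Y′ y ≡ true) → E r X Y ≤ E r X′ Y′
  E-mono r f g = sum-mono λ x → sum-mono λ y → b2n-mono λ h →
    let p , q = ∧-elim h ; s , t = ∧-elim q in ∧-intro (f x p) (∧-intro (g y s) t)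

  E-cover : ∀ {n k} (r : Fin n → Fin k → Bool) {X X₁ X₂ Y} → (∀ x → X x ≡ true → X₁ x ≡ true ⊎ X₂ x ≡ true) → E r X Y ≤ E r X₁ Y + E r X₂ Y
  E-cover {n} r {X} {X₁} {X₂} {Y} h = subst (E r X Y ≤_) (sum-+ {n} _ _) (sum-mono λ x →
    subst₂ _≤_ (sym (E-row r X Y x)) (cong₂ _+_ (sym (E-row r X₁ Y x)) (sym (E-row r X₂ Y x))) (lem x (h x)))
    where
    lem : ∀ x → (X x ≡ true → X₁ x ≡ true ⊎ X₂ x ≡ true) → b2n (X x) * nb r Y x ≤ b2n (X₁ x) * nb r Y x + b2n (X₂ x) * nb r Y x
    lem x h with X x
    ... | false = z≤n
    ... | true with h refl
    ...   | inj₁ e rewrite e = m≤m+n _ _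
    ...   | inj₂ e rewrite e = m≤n+m _ (b2n (X₁ x) * nb r Y x)

  markov : ∀ {n k} (r : Fin n → Fin k → Bool) X Y q → suc q * cnt (X ∩ above q (nb r Y)) ≤ E r X Y
  markov r X Y q = ≤-trans (E-≥ r {X ∩ above q (nb r Y)} {Y} (suc q) λ x h → above-elim {q = q} {nb r Y} (proj₂ (∩-elim {f = X} {above q (nb r Y)} h)))
    (E-mono r {X ∩ above q (nb r Y)} {X} {Y} (λ x h → proj₁ (∩-elim {f = X} {above q (nb r Y)} h)) (λ y h → h))

  E-flip : ∀ {n k} (r : Fin n → Fin k → Bool) X Y → E r X Y ≡ E (flip r) Y X
  E-flip r X Y = trans (sum-swap λ x y → b2n (X x ∧ Y y ∧ r x y))
    (sum-cong λ y → sum-cong λ x → cong b2n (lem (X x) (Y y) (r x y)))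
    where
    lem : ∀ a b c → a ∧ b ∧ c ≡ b ∧ a ∧ c
    lem true true c = refl
    lem true false c = refl
    lem false true c = refl
    lem false false c = refl

  E-cong : ∀ {n k} {r s : Fin n → Fin k → Bool} → (∀ x y → r x y ≡ s x y) → ∀ X Y → E r X Y ≡ E s X Y
  E-cong h X Y = sum-cong λ x → sum-cong λ y → cong (λ z → b2n (X x ∧ Y y ∧ z)) (h x y)

  E-perm : ∀ {n k} (π : Permutation′ n) (ρ : Permutation′ k) (r : Fin n → Fin k → Bool) X Y →
    E (λ s t → r (π ⟨$⟩ʳ s) (ρ ⟨$⟩ʳ t)) (λ s → X (π ⟨$⟩ʳ s)) (λ t → Y (ρ ⟨$⟩ʳ t)) ≡ E r X Y
  E-perm {n} {k} π ρ r X Y = trans (sum-cong λ s → sum-perm ρ (λ y → b2n (X (π ⟨$⟩ʳ s) ∧ Y y ∧ r (π ⟨$⟩ʳ s) y)))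
    (sum-perm π (λ x → sumFin k λ y → b2n (X x ∧ Y y ∧ r x y)))

  E-cong₂ : ∀ {n k} (r : Fin n → Fin k → Bool) {X X′ Y Y′} → (∀ x → X x ≡ X′ x) → (∀ y → Y y ≡ Y′ y) → E r X Y ≡ E r X′ Y′
  E-cong₂ r f g = sum-cong λ x → sum-cong λ y → cong₂ (λ p q → b2n (p ∧ q ∧ r x y)) (f x) (g y)

  cnt-cong : ∀ {n} {f g : Fin n → Bool} → (∀ x → f x ≡ g x) → cnt f ≡ cnt g
  cnt-cong h = sum-cong λ x → cong b2n (h x)

pattern c₁ = zero
pattern c₂ = suc zero
pattern c₃ = suc (suc zero)

-- The orderings of the three classes: an argument is carried out once for arbitrary `i`, `j`, `k`
-- and transferred by `swapˡ` and `swapʳ`.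
data Tri : Fin 3 → Fin 3 → Fin 3 → Set where
  t₁₂₃ : Tri c₁ c₂ c₃
  t₁₃₂ : Tri c₁ c₃ c₂
  t₂₁₃ : Tri c₂ c₁ c₃
  t₂₃₁ : Tri c₂ c₃ c₁
  t₃₁₂ : Tri c₃ c₁ c₂
  t₃₂₁ : Tri c₃ c₂ c₁

swapˡ : ∀ {i j k} → Tri i j k → Tri j i k
swapˡ t₁₂₃ = t₂₁₃
swapˡ t₁₃₂ = t₃₁₂
swapˡ t₂₁₃ = t₁₂₃
swapˡ t₂₃₁ = t₃₂₁
swapˡ t₃₁₂ = t₁₃₂
swapˡ t₃₂₁ = t₂₃₁

swapʳ : ∀ {i j k} → Tri i j k → Tri i k j
swapʳ t₁₂₃ = t₁₃₂
swapʳ t₁₃₂ = t₁₂₃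
swapʳ t₂₁₃ = t₂₃₁
swapʳ t₂₃₁ = t₂₁₃
swapʳ t₃₁₂ = t₃₂₁
swapʳ t₃₂₁ = t₃₁₂

≢₁₂ : ∀ {i j k} → Tri i j k → i ≢ j
≢₁₂ t₁₂₃ ()
≢₁₂ t₁₃₂ ()
≢₁₂ t₂₁₃ ()
≢₁₂ t₂₃₁ ()
≢₁₂ t₃₁₂ ()
≢₁₂ t₃₂₁ ()

≢₁₃ : ∀ {i j k} → Tri i j k → i ≢ k
≢₁₃ t = ≢₁₂ (swapʳ t)

≢₂₃ : ∀ {i j k} → Tri i j k → j ≢ k
≢₂₃ t = ≢₁₃ (swapˡ t)

-- Neighbourhoods in a non-extremal graph

-- The vertex classes have size N = 3m, and u is the unit in which all errors are measured.
record Nonextremal {N : ℕ} (m u : ℕ) (a : Fin 3 → Fin 3 → Fin N → Fin N → Bool) : Set where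
  field
    N≡3m : N ≡ 3 * m
    u-pos : 1 ≤ u
    u-small : 1000 * u ≤ m
    a-sym : ∀ i j x y → a i j x y ≡ a j i y x
    degree : ∀ {i j} → i ≢ j → ∀ x → 2 * m ≤ cnt (a i j x) + u
    no-sparse : ∀ {i j k} → Tri i j k → ∀ X Y Z →
      m ≤ cnt X + 200 * u → m ≤ cnt Y + 200 * u → m ≤ cnt Z + 200 * u →
      E (a i j) X Y ≤ 200 * (u * N) → E (a i k) X Z ≤ 200 * (u * N) → E (a j k) Y Z ≤ 200 * (u * N) → ⊥

module Neighbourhoods {N m u : ℕ} {a : Fin 3 → Fin 3 → Fin N → Fin N → Bool} (nonextremal : Nonextremal m u a) where
  open Nonextremal nonextremal

  inter : (X Y : Fin N → Bool) → cnt X + cnt Y ≤ N + cnt (X ∩ Y)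
  inter X Y = subst (_≤ N + cnt (X ∩ Y)) (sym (cnt-∪∩ X Y)) (+-monoˡ-≤ _ (cnt≤n (X ∪ Y)))

  nb-large : ∀ {i j} → i ≢ j → ∀ X v → cnt X ≤ nb (a i j) X v + (m + u)
  nb-large {i} {j} i≢j X v =
    lin 6 (λ x d n m u N → (x :+ d :≤ N :+ n) ⇒ (2 · m :≤ d :+ u) ⇒ (N :≤ 3 · m) ⇒ ⊢ x :≤ n :+ (m :+ u))
      (cnt X) (cnt (a i j v)) _ m u N (inter X (a i j v)) (degree i≢j v) (≤-reflexive N≡3m)

  E-sym : ∀ i j X Y → E (a i j) X Y ≡ E (a j i) Y X
  E-sym i j X Y = trans (E-flip (a i j) X Y) (E-cong (λ y x → a-sym i j x y) Y X)

  E-≤N : ∀ {i j} X Y q → (∀ x → X x ≡ true → nb (a i j) Y x ≤ q) → E (a i j) X Y ≤ q * N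
  E-≤N {i} {j} X Y q h = ≤-trans (E-≤ (a i j) q h) (*-monoʳ-≤ q (cnt≤n X))

  -- Count the edges between `L` and `Y` twice. If `L` were larger, every vertex of `Y` would have
  -- more than `6 q u` neighbours in `L`, giving more than `3 q u m` edges since `Y` has at least
  -- `m / 2` vertices; but `L` sends out at most `q u · 3 m`.
  few-neighbours-small : ∀ {i j} → i ≢ j → ∀ L Y q → (∀ x → L x ≡ true → nb (a i j) Y x ≤ q * u) →
    m ≤ 2 * cnt Y → cnt L ≤ m + (6 * q + 1) * u
  few-neighbours-small {i} {j} i≢j L Y q few Y-large with cnt L ≤? m + (6 * q + 1) * u
  ... | yes p = p
  ... | no p = ⊥-elim (1≰0 (lin 6 (λ m u q e l y →
          ((con 6 :* q :* u :+ con 1) :* y :≤ e) ⇒ (e :≤ q :* u :* l) ⇒ (q :* u :* l :≤ q :* u :* (con 3 :* m)) ⇒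
          ((con 6 :* q :* u :+ con 1) :* m :≤ (con 6 :* q :* u :+ con 1) :* (2 · y)) ⇒ (con 1000 :* u :≤ m) ⇒ (con 1 :≤ u) ⇒ ⊢ con 1 :≤ con 0)
          m u q (E (a i j) L Y) (cnt L) (cnt Y)
          (subst ((6 * q * u + 1) * cnt Y ≤_) (E-sym j i Y L) (E-≥ (a j i) _ lower))
          (E-≤ (a i j) (q * u) few)
          (*-monoʳ-≤ (q * u) (subst (cnt L ≤_) N≡3m (cnt≤n L)))
          (*-monoʳ-≤ (6 * q * u + 1) Y-large) u-small u-pos))
    where
    lower : ∀ y → Y y ≡ true → 6 * q * u + 1 ≤ nb (a j i) L y
    lower y _ = lin 5 (λ m u q l n → (con 1 :+ (m :+ (6 · q :+ con 1) :* u) :≤ l) ⇒ (l :≤ n :+ (m :+ u)) ⇒ ⊢ (6 · q :* u :+ con 1 :≤ n))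
      m u q (cnt L) _ (≰⇒> p) (nb-large (λ e → i≢j (sym e)) L y)

  -- By Markov at most `u` vertices of `B` have more than `u` neighbours in `C`, and likewise for
  -- `B′` and `C′`. So some vertex of `B ∩ B′` has at most `2 u` neighbours in `C ∪ C′`, while it
  -- misses at most `m + u` vertices altogether.
  union-bound : ∀ {j k} → j ≢ k → ∀ B C B′ C′ → E (a j k) B C ≤ u * u → E (a j k) B′ C′ ≤ u * u →
    2 * u < cnt (B ∩ B′) → cnt (C ∪ C′) ≤ m + 3 * u
  union-bound {j} {k} j≢k B C B′ C′ e e′ big = conclude
    where
    heavy heavy′ : Fin N → Bool
    heavy = B ∩ above u (nb (a j k) C)
    heavy′ = B′ ∩ above u (nb (a j k) C′)

    few-heavy : ∀ X Y → E (a j k) X Y ≤ u * u → cnt (X ∩ above u (nb (a j k) Y)) ≤ u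
    few-heavy X Y h with cnt (X ∩ above u (nb (a j k) Y)) ≤? u
    ... | yes p = p
    ... | no p = ⊥-elim (1≰0 (lin 3 (λ u e t → ((con 1 :+ u) :* t :≤ e) ⇒ (e :≤ u :* u) ⇒ ((con 1 :+ u) :* (con 1 :+ u) :≤ (con 1 :+ u) :* t) ⇒ ⊢ con 1 :≤ con 0)
        u (E (a j k) X Y) _ (markov (a j k) X Y u) h (*-monoʳ-≤ (suc u) (≰⇒> p))))

    light : Fin N → Bool
    light = (B ∩ B′) ∖ (heavy ∪ heavy′)

    cover : ∀ b → (B ∩ B′) b ≡ true → light b ≡ true ⊎ (heavy ∪ heavy′) b ≡ true
    cover b h with bool? ((heavy ∪ heavy′) b)
    ... | inj₁ p = inj₂ p
    ... | inj₂ p = inj₁ (∖-intro h p)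

    split : ∀ {c r} → (C ∪ C′) c ≡ true → r c ≡ true → (C ∩ r) c ≡ true ⊎ (C′ ∩ r) c ≡ true
    split p q with ∪-elim p
    ... | inj₁ s = inj₁ (∩-intro s q)
    ... | inj₂ s = inj₂ (∩-intro s q)

    light-∃ : ∃[ b ] light b ≡ true
    light-∃ = cnt-∃ light (lin 6 (λ bb l hh h h′ u → (2 · u :< bb) ⇒ (bb :≤ l :+ hh) ⇒ (hh :≤ h :+ h′) ⇒ (h :≤ u) ⇒ (h′ :≤ u) ⇒ ⊢ con 1 :≤ l)
      _ _ _ _ _ u big (cnt-cover cover) (cnt-cover {f = heavy ∪ heavy′} λ _ → ∪-elim) (few-heavy B C e) (few-heavy B′ C′ e′))

    conclude : cnt (C ∪ C′) ≤ m + 3 * u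
    conclude =
      let b , lb = light-∃
          b∈ , ¬hv = ∖-elim lb
          b∈B , b∈B′ = ∩-elim b∈
          le = ≮⇒≥ λ q → ¬hv (∪-introˡ (∩-intro b∈B (above-intro q)))
          le′ = ≮⇒≥ λ q → ¬hv (∪-introʳ (∩-intro b∈B′ (above-intro q)))
      in lin 6 (λ cc n d d′ m u → (cc :≤ n :+ (m :+ u)) ⇒ (n :≤ d :+ d′) ⇒ (d :≤ u) ⇒ (d′ :≤ u) ⇒ ⊢ cc :≤ m :+ 3 · u)
        _ _ _ _ m u (nb-large j≢k (C ∪ C′) b)
        (cnt-cover {g = C ∩ a j k b} {C′ ∩ a j k b} λ c h → let p , q = ∩-elim h in split p q) le le′

  ∩-refl-size : (X : Fin N → Bool) → cnt X ≤ cnt (X ∩ X)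
  ∩-refl-size X = cnt-mono λ _ h → ∩-intro h h

  -- B and C are nearly all that their neighbours miss: a set pair (B′ , C′) that is sparse as well and
  -- meets B or C substantially must nearly coincide with (B , C).
  module Dichotomy {i j k : Fin 3} (t : Tri i j k) (Yⱼ Yₖ B C : Fin N → Bool)
    (B⊆Y : ∀ x → B x ≡ true → Yⱼ x ≡ true) (C⊆Y : ∀ x → C x ≡ true → Yₖ x ≡ true)
    (B-large : m ≤ cnt B + 8 * u) (C-large : m ≤ cnt C + 8 * u) (BC-sparse : E (a j k) B C ≤ u * u)
    (Y-large : 2 * m ≤ cnt Yⱼ + 8 * u) where

    private
      CB-sparse : E (a k j) C B ≤ u * u
      CB-sparse = subst (_≤ u * u) (E-sym j k B C) BC-sparse

      k≢j : k ≢ j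
      k≢j e = ≢₂₃ t (sym e)

    -- The vertices that complete `B` and `C` to a sparse triple.
    off : Fin N → Bool
    off = full ∖ (above (2 * u) (nb (a i j) B) ∪ above (2 * u) (nb (a i k) C))

    -- The vertices seeing hardly anything of `Yⱼ` outside `B`. The 11 is 3 + 8: `B ∪ B′` has at
    -- most `m + 3 u` vertices and `B` at least `m - 8 u`.
    away : Fin N → Bool
    away = full ∖ above (11 * u) (nb (a i j) (Yⱼ ∖ B))

    B-small : cnt B ≤ m + 3 * u
    B-small = ≤-trans (cnt-mono {g = B ∪ B} λ _ → ∪-introˡ)
      (union-bound k≢j C B C B CB-sparse CB-sparse
        (lin 4 (λ m u c cc → (m :≤ c :+ 8 · u) ⇒ (c :≤ cc) ⇒ (1000 · u :≤ m) ⇒ (con 1 :≤ u) ⇒ ⊢ 2 · u :< cc)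
          m u (cnt C) _ C-large (∩-refl-size C) u-small u-pos))

    -- If `z` is not in `off`, its neighbourhood meets `B` or `C` in more than `2 u` vertices. A
    -- large `C ∩ C′` keeps `B ∪ B′` small, which leaves little of `B′` outside `B`. A large
    -- `B ∩ B′` keeps `C ∪ C′` small and thereby makes `C ∩ C′` large.
    dichotomy : ∀ z → m ≤ cnt (Yⱼ ∩ a i j z) + 8 * u → m ≤ cnt (Yₖ ∩ a i k z) + 8 * u →
      E (a j k) (Yⱼ ∩ a i j z) (Yₖ ∩ a i k z) ≤ u * u → off z ≡ true ⊎ away z ≡ true
    dichotomy z B′-large C′-large sparse′ = decide
      where
      B′ C′ : Fin N → Bool
      B′ = Yⱼ ∩ a i j z
      C′ = Yₖ ∩ a i k z

      from-C : 2 * u < cnt (C ∩ C′) → away z ≡ true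
      from-C big = ∖-intro refl λ h → <⇒≱ (above-elim h)
        (lin 5 (λ y b bb m u → (y :+ b :≤ bb) ⇒ (bb :≤ m :+ 3 · u) ⇒ (m :≤ b :+ 8 · u) ⇒ ⊢ y :≤ 11 · u)
          _ (cnt B) (cnt (B ∪ B′)) m u
          (cnt-disjoint (λ x h → let p , q = ∩-elim h in ∪-introʳ (∩-intro (proj₁ (∖-elim p)) q)) (λ x → ∪-introˡ)
            (λ x h h′ → proj₂ (∖-elim (proj₁ (∩-elim h))) h′))
          (union-bound k≢j C B C′ B′ CB-sparse (subst (_≤ u * u) (E-sym j k B′ C′) sparse′) big) B-large)

      from-B : 2 * u < cnt (B ∩ B′) → away z ≡ true
      from-B big = from-C (lin 6 (λ c c′ cu ci m u → (c :+ c′ :≤ cu :+ ci) ⇒ (cu :≤ m :+ 3 · u) ⇒ (m :≤ c :+ 8 · u) ⇒ (m :≤ c′ :+ 8 · u) ⇒ (1000 · u :≤ m) ⇒ (con 1 :≤ u) ⇒ ⊢ 2 · u :< ci)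
        (cnt C) (cnt C′) _ _ m u (≤-reflexive (cnt-∪∩ C C′)) (union-bound (≢₂₃ t) B C B′ C′ BC-sparse sparse′ big) C-large C′-large u-small u-pos)

      decide : off z ≡ true ⊎ away z ≡ true
      decide with bool? (off z)
      ... | inj₁ h = inj₁ h
      ... | inj₂ h with bool? ((above (2 * u) (nb (a i j) B) ∪ above (2 * u) (nb (a i k) C)) z)
      ...   | inj₂ h′ = ⊥-elim (h (∖-intro refl h′))
      ...   | inj₁ h′ with ∪-elim h′
      ...     | inj₁ p = inj₂ (from-B (≤-trans (above-elim p) (cnt-mono λ x q → let r , s = ∩-elim q in ∩-intro r (∩-intro (B⊆Y x r) s))))
      ...     | inj₂ p = inj₂ (from-C (≤-trans (above-elim p) (cnt-mono λ x q → let r , s = ∩-elim q in ∩-intro r (∩-intro (C⊆Y x r) s))))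

    -- As `B` has at most `m + 3 u` of the nearly `2 m` vertices of `Yⱼ`, the rest has more than
    -- `m / 2`, and few vertices can miss nearly all of it.
    away-small : cnt away ≤ m + 67 * u
    away-small = few-neighbours-small (≢₁₂ t) away (Yⱼ ∖ B) 11 (λ x h → ≮⇒≥ λ q → proj₂ (∖-elim h) (above-intro q))
      (lin 6 (λ y yb b bi m u → (y :≤ bi :+ yb) ⇒ (bi :≤ b) ⇒ (b :≤ m :+ 3 · u) ⇒ (2 · m :≤ y :+ 8 · u) ⇒ (1000 · u :≤ m) ⇒ (con 1 :≤ u) ⇒ ⊢ m :≤ 2 · yb)
        _ _ _ _ m u (≤-reflexive (cnt-split Yⱼ B)) (cnt-mono {g = B} λ x h → proj₂ (∩-elim h)) B-small Y-large u-small u-pos)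

    off-small : cnt off + 200 * u < m
    off-small with m ≤? cnt off + 200 * u
    ... | no p = ≰⇒> p
    ... | yes p = ⊥-elim (no-sparse t off B C p (weaken (cnt B) B-large) (weaken (cnt C) C-large)
        (scale (E-≤N off B (2 * u) λ x h → ≮⇒≥ λ q → proj₂ (∖-elim h) (∪-introˡ (above-intro q))))
        (scale (E-≤N off C (2 * u) λ x h → ≮⇒≥ λ q → proj₂ (∖-elim h) (∪-introʳ (above-intro q))))
        (≤-trans BC-sparse (lin 3 (λ u N m → (u :* u :≤ u :* m) ⇒ (u :* N :≤ u :* (3 · m)) ⇒ (u :* (3 · m) :≤ u :* N) ⇒ ⊢ (u :* u :≤ 200 · (u :* N)))
          u N m (*-monoʳ-≤ u (lin 2 (λ u m → (1000 · u :≤ m) ⇒ ⊢ u :≤ m) u m u-small)) (≤-reflexive (cong (u *_) N≡3m)) (≤-reflexive (cong (u *_) (sym N≡3m))))))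
      where
      weaken : ∀ x → m ≤ x + 8 * u → m ≤ x + 200 * u
      weaken x = lin 3 (λ m u x → (m :≤ x :+ 8 · u) ⇒ ⊢ m :≤ x :+ 200 · u) m u x
      scale : ∀ {e} → e ≤ 2 * u * N → e ≤ 200 * (u * N)
      scale {e} = lin 3 (λ e u N → (e :≤ 2 · u :* N) ⇒ ⊢ e :≤ 200 · (u :* N)) e u N

  common : ∀ {i j} → i ≢ j → ∀ x y → m ≤ cnt (a i j x ∩ a i j y) + 2 * u
  common {i} {j} i≢j x y = lin 6 (λ m u N p q c → (p :+ q :≤ N :+ c) ⇒ (2 · m :≤ p :+ u) ⇒ (2 · m :≤ q :+ u) ⇒ (N :≤ 3 · m) ⇒ ⊢ m :≤ c :+ 2 · u)
    m u N (cnt (a i j x)) (cnt (a i j y)) _ (inter (a i j x) (a i j y)) (degree i≢j x) (degree i≢j y) (≤-reflexive N≡3m)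

  connections : ∀ (i j k : Fin 3) → Fin N → Fin N → ℕ
  connections i j k x z = E (a j k) (a i j x ∩ a i j z) (a i k x ∩ a i k z)

  reach : ∀ (i j k : Fin 3) → Fin N → Fin N → Bool
  reach i j k x = above (u * u) (connections i j k x)

  module _ {i j k : Fin 3} (t : Tri i j k) (x y : Fin N) (unreached : reach i j k x y ≡ true → ⊥) where

    private
      sparse : ∀ x z → (reach i j k x z ≡ true → ⊥) → connections i j k x z ≤ u * u
      sparse x z h = ≮⇒≥ λ q → h (above-intro q)

      weaken : ∀ {x} → m ≤ x + 2 * u → m ≤ x + 8 * u
      weaken {x} = lin 3 (λ m u x → (m :≤ x :+ 2 · u) ⇒ ⊢ m :≤ x :+ 8 · u) m u x

      enough : ∀ v → 2 * m ≤ cnt (a i j v) + 8 * u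
      enough v = lin 3 (λ m u d → (2 · m :≤ d :+ u) ⇒ ⊢ 2 · m :≤ d :+ 8 · u) m u (cnt (a i j v)) (degree (≢₁₂ t) v)

      B C : Fin N → Bool
      B = a i j x ∩ a i j y
      C = a i k x ∩ a i k y

      module X = Dichotomy t (a i j x) (a i k x) B C (λ _ h → proj₁ (∩-elim h)) (λ _ h → proj₁ (∩-elim h))
        (weaken {cnt B} (common (≢₁₂ t) x y)) (weaken {cnt C} (common (≢₁₃ t) x y)) (sparse x y unreached) (enough x)
      module Y = Dichotomy t (a i j y) (a i k y) B C (λ _ h → proj₂ (∩-elim h)) (λ _ h → proj₂ (∩-elim h))
        (weaken {cnt B} (common (≢₁₂ t) x y)) (weaken {cnt C} (common (≢₁₃ t) x y)) (sparse x y unreached) (enough y)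

      both : Fin N → Bool
      both = reach i j k x ∩ reach i j k y

      cover : ∀ z → full z ≡ true → both z ≡ true ⊎ (X.off ∪ (X.away ∪ Y.away)) z ≡ true
      cover z _ = by-cases (bool? (reach i j k x z)) (bool? (reach i j k y z))
        where
        by-cases : reach i j k x z ≡ true ⊎ (reach i j k x z ≡ true → ⊥) → reach i j k y z ≡ true ⊎ (reach i j k y z ≡ true → ⊥) →
          both z ≡ true ⊎ (X.off ∪ (X.away ∪ Y.away)) z ≡ true
        by-cases (inj₁ p) (inj₁ q) = inj₁ (∩-intro p q)
        by-cases (inj₂ p) _ = inj₂ ([ ∪-introˡ , (λ h → ∪-introʳ (∪-introˡ h)) ]′
          (X.dichotomy z (weaken {cnt (a i j x ∩ a i j z)} (common (≢₁₂ t) x z)) (weaken {cnt (a i k x ∩ a i k z)} (common (≢₁₃ t) x z)) (sparse x z p)))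
        by-cases (inj₁ _) (inj₂ q) = inj₂ ([ ∪-introˡ , (λ h → ∪-introʳ (∪-introʳ h)) ]′
          (Y.dichotomy z (weaken {cnt (a i j y ∩ a i j z)} (common (≢₁₂ t) y z)) (weaken {cnt (a i k y ∩ a i k z)} (common (≢₁₃ t) y z)) (sparse y z q)))

    -- The dichotomy is applied with the same `B` and `C` inside the neighbourhoods of `x` and of
    -- `y`. The set `off` depends on `B` and `C` only, so it is shared: fewer than `m - 200 u`
    -- vertices are off, at most `2 (m + 67 u)` are away, and some of the `3 m` vertices remain.
    many-reach-both : u ≤ cnt (reach i j k x ∩ reach i j k y)
    many-reach-both = lin 10 (λ m u N f b o oxy xy ax ay →
        (f :≤ b :+ oxy) ⇒ (oxy :≤ o :+ xy) ⇒ (xy :≤ ax :+ ay) ⇒ (o :+ 200 · u :< m) ⇒ (ax :≤ m :+ 67 · u) ⇒ (ay :≤ m :+ 67 · u) ⇒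
        (N :≤ f) ⇒ (3 · m :≤ N) ⇒ ⊢ u :≤ b)
      m u N (cnt {N} full) (cnt both) (cnt X.off) (cnt (X.off ∪ (X.away ∪ Y.away))) (cnt (X.away ∪ Y.away)) (cnt X.away) (cnt Y.away)
      (cnt-cover cover) (cnt-cover λ _ → ∪-elim) (cnt-cover λ _ → ∪-elim) X.off-small X.away-small Y.away-small
      (≤-reflexive (sym (cnt-all N))) (≤-reflexive (sym N≡3m))

-- Tilings and exchanges

-- A state lists the vertices of each class by positions; position p carries one vertex of each class.
State : ℕ → Set
State N = Fin 3 → Permutation′ N

vert : ∀ {N} → State N → Fin 3 → Fin N → Fin N
vert τ i p = τ i ⟨$⟩ʳ p

transpose-ˡ : ∀ {n} (d t : Fin n) → PC.transpose d t d ≡ t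
transpose-ˡ d t rewrite dec-true (d Fin.≟ d) refl = refl

transpose-ʳ : ∀ {n} (d t : Fin n) → PC.transpose d t t ≡ d
transpose-ʳ d t with t Fin.≟ d
... | yes p = p
... | no _ rewrite dec-true (t Fin.≟ t) refl = refl

transpose-≢ : ∀ {n} {d t p : Fin n} → p ≢ d → p ≢ t → PC.transpose d t p ≡ p
transpose-≢ {d = d} {t} {p} p≢d p≢t rewrite dec-false (p Fin.≟ d) p≢d | dec-false (p Fin.≟ t) p≢t = refl

opaque
  swapAt : ∀ {N} → State N → Fin 3 → Fin N → Fin N → State N
  swapAt τ i d t j with j Fin.≟ i
  ... | yes _ = transpose d t ∘ₚ τ j
  ... | no _ = τ j

  swap-ˡ : ∀ {N} (τ : State N) i d t → vert (swapAt τ i d t) i d ≡ vert τ i t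
  swap-ˡ τ i d t with i Fin.≟ i
  ... | yes _ = cong (τ i ⟨$⟩ʳ_) (transpose-ˡ d t)
  ... | no h = ⊥-elim (h refl)

  swap-ʳ : ∀ {N} (τ : State N) i d t → vert (swapAt τ i d t) i t ≡ vert τ i d
  swap-ʳ τ i d t with i Fin.≟ i
  ... | yes _ = cong (τ i ⟨$⟩ʳ_) (transpose-ʳ d t)
  ... | no h = ⊥-elim (h refl)

  swap-class : ∀ {N} (τ : State N) {i} d t {j} p → j ≢ i → vert (swapAt τ i d t) j p ≡ vert τ j p
  swap-class τ {i} d t {j} p h with j Fin.≟ i
  ... | yes e = ⊥-elim (h e)
  ... | no _ = refl

  swap-pos : ∀ {N} (τ : State N) i {d t} j {p} → p ≢ d → p ≢ t → vert (swapAt τ i d t) j p ≡ vert τ j p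
  swap-pos τ i {d} {t} j {p} h h′ with j Fin.≟ i
  ... | yes _ = cong (τ j ⟨$⟩ʳ_) (transpose-≢ h h′)
  ... | no _ = refl

module Triangles {N : ℕ} (a : Fin 3 → Fin 3 → Fin N → Fin N → Bool) (a-sym : ∀ i j x y → a i j x y ≡ a j i y x) where

  opaque
    bad : State N → Fin N → Bool
    bad τ p = not (a c₁ c₂ (vert τ c₁ p) (vert τ c₂ p) ∧ a c₁ c₃ (vert τ c₁ p) (vert τ c₃ p) ∧ a c₂ c₃ (vert τ c₂ p) (vert τ c₃ p))

    bad-cong : ∀ {τ τ′} {p} → (∀ i → vert τ′ i p ≡ vert τ i p) → bad τ′ p ≡ bad τ p
    bad-cong h rewrite h c₁ | h c₂ | h c₃ = refl

    good-intro : ∀ {τ p i j k} → Tri i j k → a i j (vert τ i p) (vert τ j p) ≡ true →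
      a i k (vert τ i p) (vert τ k p) ≡ true → a j k (vert τ j p) (vert τ k p) ≡ true → bad τ p ≡ false
    good-intro {τ} {p} t x y z = build t x y z
      where
      v : Fin 3 → Fin N
      v i = vert τ i p
      flip-a : ∀ {i j} → a i j (v i) (v j) ≡ true → a j i (v j) (v i) ≡ true
      flip-a {i} {j} h = trans (sym (a-sym i j (v i) (v j))) h
      make : ∀ {A B C} → A ≡ true → B ≡ true → C ≡ true → not (A ∧ B ∧ C) ≡ false
      make refl refl refl = refl
      build : ∀ {i j k} → Tri i j k → a i j (v i) (v j) ≡ true → a i k (v i) (v k) ≡ true → a j k (v j) (v k) ≡ true → bad τ p ≡ false
      build t₁₂₃ x y z = make x y z
      build t₁₃₂ x y z = make y x (flip-a z)
      build t₂₁₃ x y z = make (flip-a x) z y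
      build t₂₃₁ x y z = make (flip-a y) (flip-a z) x
      build t₃₁₂ x y z = make z (flip-a x) (flip-a y)
      build t₃₂₁ x y z = make (flip-a z) (flip-a y) (flip-a x)

    good-elim : ∀ {τ p i j k} → Tri i j k → bad τ p ≡ false → a i j (vert τ i p) (vert τ j p) ≡ true
    good-elim {τ} {p} t h = read t (split _ _ _ h)
      where
      split : ∀ A B C → not (A ∧ B ∧ C) ≡ false → A ≡ true × B ≡ true × C ≡ true
      split true true true _ = refl , refl , refl
      v : Fin 3 → Fin N
      v i = vert τ i p
      read : ∀ {i j k} → Tri i j k → a c₁ c₂ (v c₁) (v c₂) ≡ true × a c₁ c₃ (v c₁) (v c₃) ≡ true × a c₂ c₃ (v c₂) (v c₃) ≡ true →
        a i j (v i) (v j) ≡ true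
      read t₁₂₃ (x , y , z) = x
      read t₁₃₂ (x , y , z) = y
      read t₂₁₃ (x , y , z) = trans (a-sym _ _ _ _) x
      read t₂₃₁ (x , y , z) = z
      read t₃₁₂ (x , y , z) = trans (a-sym _ _ _ _) y
      read t₃₂₁ (x , y , z) = trans (a-sym _ _ _ _) z

  bc : State N → ℕ
  bc τ = cnt (bad τ)

  bc-< : ∀ {τ τ′} → (∀ p → bad τ′ p ≡ true → bad τ p ≡ true) → ∀ d → bad τ′ d ≡ false → bad τ d ≡ true → bc τ′ < bc τ
  bc-< = cnt-<

-- Each of the six edges of holes is created inside a block of four bad positions of its own.
Slot : Set
Slot = Fin 6 × Fin 4

_≟ˢ_ : (s s′ : Slot) → Dec (s ≡ s′)
_≟ˢ_ = Product.≡-dec Fin._≟_ Fin._≟_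

-- The vertex in a hole is named by the position it has in the base state.
Holes : ℕ → Set
Holes N = Fin 3 → Slot → Fin N

opaque
  upd : ∀ {N} → Holes N → Fin 3 → Slot → Fin N → Holes N
  upd η i s t j s′ with j Fin.≟ i | s′ ≟ˢ s
  ... | yes _ | yes _ = t
  ... | _ | _ = η j s′

  upd-≡ : ∀ {N} (η : Holes N) i s {t} → upd η i s t i s ≡ t
  upd-≡ η i s with i Fin.≟ i | s ≟ˢ s
  ... | yes _ | yes _ = refl
  ... | no h | _ = ⊥-elim (h refl)
  ... | yes _ | no h = ⊥-elim (h refl)

  upd-class : ∀ {N} (η : Holes N) {i s t j s′} → j ≢ i → upd η i s t j s′ ≡ η j s′
  upd-class η {i} {s} {t} {j} {s′} h with j Fin.≟ i | s′ ≟ˢ s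
  ... | yes e | _ = ⊥-elim (h e)
  ... | no _ | yes _ = refl
  ... | no _ | no _ = refl

  upd-slot : ∀ {N} (η : Holes N) {i s t j s′} → s′ ≢ s → upd η i s t j s′ ≡ η j s′
  upd-slot η {i} {s} {t} {j} {s′} h with j Fin.≟ i | s′ ≟ˢ s
  ... | _ | yes e = ⊥-elim (h e)
  ... | yes _ | no _ = refl
  ... | no _ | no _ = refl

-- Exchanging holes in an optimal tiling

module Moves {N : ℕ} (a : Fin 3 → Fin 3 → Fin N → Fin N → Bool) (a-sym : ∀ i j x y → a i j x y ≡ a j i y x)
  (σ : State N) (P Z : List (Fin N)) (δ : Slot → Fin N)
  (δ-injective : ∀ {s s′} → δ s ≡ δ s′ → s ≡ s′)
  (δ∈Z : ∀ s → δ s ∈ Z) (P⊆Z : ∀ {p} → p ∈ P → p ∈ Z)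
  (δ∉P : ∀ s {p} → p ∈ P → p ≢ δ s)
  (δ-bad : ∀ s → Triangles.bad a a-sym σ (δ s) ≡ true)
  (optimal : ∀ τ → (∀ p → p ∈ P → ∀ i → vert τ i p ≡ vert σ i p) → Triangles.bc a a-sym σ ≤ Triangles.bc a a-sym τ)
  where

  open Triangles a a-sym

  b : Fin 3 → Fin 3 → Fin N → Fin N → Bool
  b i j s t = a i j (vert σ i s) (vert σ j t)

  b-sym : ∀ i j s t → b i j s t ≡ b j i t s
  b-sym i j s t = a-sym i j _ _

  b-flip : ∀ {i j s t} → b i j s t ≡ true → b j i t s ≡ true
  b-flip {i} {j} {s} {t} h = trans (b-sym j i t s) h

  -- The list `S` holds the positions touched so far. Outside it the state still coincides with `σ`,
  -- so candidates for the next exchange can be tested by the fixed relation `b`.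
  record Reached (S : List (Fin N)) (η : Holes N) : Set where
    field
      τ : State N
      untouched : ∀ p → fresh S p ≡ true → ∀ i → vert τ i p ≡ vert σ i p
      reserved : ∀ p → p ∈ P → ∀ i → vert τ i p ≡ vert σ i p
      holes : ∀ s i → vert τ i (δ s) ≡ vert σ i (η i s)
      holes-bad : ∀ s → bad τ (δ s) ≡ true
      no-worse : bc τ ≤ bc σ
      Z⊆S : ∀ {p} → p ∈ Z → p ∈ S

  start : Reached Z (λ _ s → δ s)
  start = record { τ = σ ; untouched = λ _ _ _ → refl ; reserved = λ _ _ _ → refl ; holes = λ _ _ → refl
                 ; holes-bad = δ-bad ; no-worse = ≤-refl ; Z⊆S = λ p → p }

  hole? : ∀ p → (∃[ s ] p ≡ δ s) ⊎ (∀ s → p ≢ δ s)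
  hole? p with Fin.any? (λ x → Fin.any? (λ y → p Fin.≟ δ (x , y)))
  ... | yes (x , y , e) = inj₁ ((x , y) , e)
  ... | no h = inj₂ λ s e → h (proj₁ s , proj₂ s , e)

  module _ {S η} (r : Reached S η) where
    open Reached r

    δ≢fresh : ∀ {t} → fresh S t ≡ true → ∀ s → δ s ≢ t
    δ≢fresh h s e = fresh-∈ h (Z⊆S (δ∈Z s)) (sym e)

    reserved≢fresh : ∀ {t p} → fresh S t ≡ true → p ∈ P → p ≢ t
    reserved≢fresh h q e = fresh-∈ h (Z⊆S (P⊆Z q)) (sym e)

    no-gain : ∀ {τ′} → (∀ p → p ∈ P → ∀ i → vert τ′ i p ≡ vert τ i p) →
      (∀ p → bad τ′ p ≡ true → bad τ p ≡ true) → ∀ d → bad τ d ≡ true → bad τ′ d ≡ false → ⊥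
    no-gain {τ′} agree mono d h g = <⇒≱ (bc-< {τ} {τ′} mono d g h)
      (≤-trans no-worse (optimal τ′ λ p q i → trans (agree p q i) (reserved p q i)))

    module _ {t} τ′ (t-fresh : fresh S t ≡ true) (t-ok : bad τ′ t ≡ false ⊎ bad τ t ≡ true)
      (elsewhere : ∀ p → (∀ s → p ≢ δ s) → p ≢ t → ∀ i → vert τ′ i p ≡ vert τ i p) where

      agree-reserved : ∀ p → p ∈ P → ∀ i → vert τ′ i p ≡ vert τ i p
      agree-reserved p q = elsewhere p (λ s → δ∉P s q) (reserved≢fresh t-fresh q)

      bad-mono : ∀ p → bad τ′ p ≡ true → bad τ p ≡ true
      bad-mono p h with hole? p | p Fin.≟ t
      ... | inj₁ (s , refl) | _ = holes-bad s
      ... | inj₂ _ | yes refl = [ (λ g → ⊥-elim (true≢false (trans (sym h) g))) , (λ g → g) ]′ t-ok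
      ... | inj₂ n | no e = trans (sym (bad-cong {τ} {τ′} (elsewhere p n e))) h

      -- An exchange that spoils no position cannot turn a hole position into a triangle, for this
      -- would beat the optimal `σ`. Hence the hole positions stay bad and remain available.
      commit : ∀ η′ → (∀ s i → vert τ′ i (δ s) ≡ vert σ i (η′ i s)) → Reached (t ∷ S) η′
      commit η′ holes′ = record
        { τ = τ′
        ; untouched = λ p h i → trans (elsewhere p (λ s e → δ≢fresh (fresh-tail h) s (sym e)) (fresh-head h) i) (untouched p (fresh-tail h) i)
        ; reserved = λ p q i → trans (agree-reserved p q i) (reserved p q i)
        ; holes = holes′
        ; holes-bad = still-bad
        ; no-worse = ≤-trans (cnt-mono bad-mono) no-worse
        ; Z⊆S = λ p → there (Z⊆S p) }
        where
        still-bad : ∀ s → bad τ′ (δ s) ≡ true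
        still-bad s with bad τ′ (δ s) in eq
        ... | true = refl
        ... | false = ⊥-elim (no-gain {τ′} agree-reserved bad-mono (δ s) (holes-bad s) eq)

    δ≢ : ∀ {s s′} → s ≢ s′ → δ s ≢ δ s′
    δ≢ h e = h (δ-injective e)

    bad-untouched : ∀ {t} → fresh S t ≡ true → bad τ t ≡ bad σ t
    bad-untouched {t} h = bad-cong {σ} {τ} (untouched t h)

    module _ (i : Fin 3) (s : Slot) {t : Fin N} (t-fresh : fresh S t ≡ true) where

      swap-holes : ∀ s′ c → vert (swapAt τ i (δ s) t) c (δ s′) ≡ vert σ c (upd η i s t c s′)
      swap-holes s′ c with c Fin.≟ i | s′ ≟ˢ s
      ... | yes refl | yes refl = trans (swap-ˡ τ i (δ s) t) (trans (untouched t t-fresh i) (cong (vert σ i) (sym (upd-≡ η i s))))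
      ... | no n | _ = trans (swap-class τ (δ s) t (δ s′) n) (trans (holes s′ c) (cong (vert σ c) (sym (upd-class η n))))
      ... | yes refl | no n = trans (swap-pos τ i i (δ≢ n) (δ≢fresh t-fresh s′)) (trans (holes s′ i) (cong (vert σ i) (sym (upd-slot η n))))

      swap-vert : vert (swapAt τ i (δ s) t) i t ≡ vert σ i (η i s)
      swap-vert = trans (swap-ʳ τ i (δ s) t) (holes s i)

      swap-vert′ : ∀ {c} → i ≢ c → vert (swapAt τ i (δ s) t) c t ≡ vert σ c t
      swap-vert′ {c} n = trans (swap-class τ (δ s) t t λ e → n (sym e)) (untouched t t-fresh c)

    move₁ : ∀ {i j k} → Tri i j k → ∀ s {t} → fresh S t ≡ true → b i j (η i s) t ≡ true → b i k (η i s) t ≡ true → b j k t t ≡ true →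
      Reached (t ∷ S) (upd η i s t)
    move₁ {i} {j} {k} tr s {t} t-fresh x y z = commit (swapAt τ i (δ s) t) t-fresh
        (inj₁ (good-intro {swapAt τ i (δ s) t} {t} tr
          (subst₂ (λ v w → a i j v w ≡ true) (sym (swap-vert i s t-fresh)) (sym (swap-vert′ i s t-fresh (≢₁₂ tr))) x)
          (subst₂ (λ v w → a i k v w ≡ true) (sym (swap-vert i s t-fresh)) (sym (swap-vert′ i s t-fresh (≢₁₃ tr))) y)
          (subst₂ (λ v w → a j k v w ≡ true) (sym (swap-vert′ i s t-fresh (≢₁₂ tr))) (sym (swap-vert′ i s t-fresh (≢₁₃ tr))) z)))
        (λ p n e c → swap-pos τ i c (n s) e) (upd η i s t) (swap-holes i s t-fresh)

    -- Permuting the vertices of bad positions is free.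
    move₃ : ∀ i s {t} → fresh S t ≡ true → bad σ t ≡ true → Reached (t ∷ S) (upd η i s t)
    move₃ i s {t} t-fresh h = commit (swapAt τ i (δ s) t) t-fresh (inj₂ (trans (bad-untouched t-fresh) h))
      (λ p n e c → swap-pos τ i c (n s) e) (upd η i s t) (swap-holes i s t-fresh)

    module _ {i j k} (tr : Tri i j k) s s′ {t} (t-fresh : fresh S t ≡ true)
      (x : b i j (η i s) (η j s′) ≡ true) (y : b i k (η i s) t ≡ true) (z : b j k (η j s′) t ≡ true) where
      private
        τ¹ = swapAt τ i (δ s) t
        τ² = swapAt τ¹ j (δ s′) t

        elsewhere : ∀ p → (∀ s → p ≢ δ s) → p ≢ t → ∀ c → vert τ² c p ≡ vert τ c p
        elsewhere p n e c = trans (swap-pos τ¹ j c (n s′) e) (swap-pos τ i c (n s) e)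

        at-i : vert τ² i t ≡ vert σ i (η i s)
        at-i = trans (swap-class τ¹ (δ s′) t t (≢₁₂ tr)) (swap-vert i s t-fresh)

        at-j : vert τ² j t ≡ vert σ j (η j s′)
        at-j = trans (swap-ʳ τ¹ j (δ s′) t) (trans (swap-class τ (δ s) t (δ s′) (λ e → ≢₁₂ tr (sym e))) (holes s′ j))

        at-k : vert τ² k t ≡ vert σ k t
        at-k = trans (swap-class τ¹ (δ s′) t t (λ e → ≢₂₃ tr (sym e))) (swap-vert′ i s t-fresh (≢₁₃ tr))

        t-good : bad τ² t ≡ false
        t-good = good-intro {τ²} {t} tr
          (subst₂ (λ v w → a i j v w ≡ true) (sym at-i) (sym at-j) x)
          (subst₂ (λ v w → a i k v w ≡ true) (sym at-i) (sym at-k) y)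
          (subst₂ (λ v w → a j k v w ≡ true) (sym at-j) (sym at-k) z)

        holes² : ∀ s″ c → vert τ² c (δ s″) ≡ vert σ c (upd (upd η i s t) j s′ t c s″)
        holes² s″ c with c Fin.≟ j | s″ ≟ˢ s′
        ... | yes refl | yes refl = trans (swap-ˡ τ¹ j (δ s′) t)
          (trans (swap-vert′ i s t-fresh (≢₁₂ tr)) (cong (vert σ j) (sym (upd-≡ (upd η i s t) j s′))))
        ... | no n | _ = trans (swap-class τ¹ (δ s′) t (δ s″) n)
          (trans (swap-holes i s t-fresh s″ c) (cong (vert σ c) (sym (upd-class (upd η i s t) n))))
        ... | yes refl | no n = trans (swap-pos τ¹ j j (δ≢ n) (δ≢fresh t-fresh s″))
          (trans (swap-holes i s t-fresh s″ j) (cong (vert σ j) (sym (upd-slot (upd η i s t) n))))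

      move₂ : Reached (t ∷ S) (upd (upd η i s t) j s′ t)
      move₂ = commit τ² t-fresh (inj₁ t-good) elsewhere (upd (upd η i s t) j s′ t) holes²

      -- Otherwise the exchange would repair `t` and spoil nothing, against optimality. It ensures
      -- that the two vertices released from `t` are again adjacent, so that the edge of holes
      -- persists.
      absorbing-good : bad σ t ≡ false
      absorbing-good with bad σ t in eq
      ... | false = refl
      ... | true = ⊥-elim (no-gain {τ²} (agree-reserved τ² t-fresh (inj₁ t-good) elsewhere)
        (bad-mono τ² t-fresh (inj₁ t-good) elsewhere) t (trans (bad-untouched t-fresh) eq) t-good)

    -- The three vertices are gathered at `δ s`, which repairs it at the expense of bad positions
    -- only. The slots may coincide, since `swap-ˡ` also holds for a position swapped with itself.
    no-triangle : ∀ {i j k} → Tri i j k → ∀ s s′ s″ → b i j (η i s) (η j s′) ≡ true → b i k (η i s) (η k s″) ≡ true →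
      b j k (η j s′) (η k s″) ≡ true → ⊥
    no-triangle {i} {j} {k} tr s s′ s″ x y z = no-gain {τ²} (λ p q c → elsewhere p (λ s → δ∉P s q) c) mono (δ s) (holes-bad s) s-good
      where
      τ¹ = swapAt τ j (δ s) (δ s′)
      τ² = swapAt τ¹ k (δ s) (δ s″)
      elsewhere : ∀ p → (∀ s → p ≢ δ s) → ∀ c → vert τ² c p ≡ vert τ c p
      elsewhere p n c = trans (swap-pos τ¹ k c (n s) (n s″)) (swap-pos τ j c (n s) (n s′))
      mono : ∀ p → bad τ² p ≡ true → bad τ p ≡ true
      mono p h with hole? p
      ... | inj₁ (s , refl) = holes-bad s
      ... | inj₂ n = trans (sym (bad-cong {τ} {τ²} (elsewhere p n))) h
      at-i : vert τ² i (δ s) ≡ vert σ i (η i s)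
      at-i = trans (swap-class τ¹ (δ s) (δ s″) (δ s) (≢₁₃ tr)) (trans (swap-class τ (δ s) (δ s′) (δ s) (≢₁₂ tr)) (holes s i))
      at-j : vert τ² j (δ s) ≡ vert σ j (η j s′)
      at-j = trans (swap-class τ¹ (δ s) (δ s″) (δ s) (≢₂₃ tr)) (trans (swap-ˡ τ j (δ s) (δ s′)) (holes s′ j))
      at-k : vert τ² k (δ s) ≡ vert σ k (η k s″)
      at-k = trans (swap-ˡ τ¹ k (δ s) (δ s″)) (trans (swap-class τ (δ s) (δ s′) (δ s″) (λ e → ≢₂₃ tr (sym e))) (holes s″ k))
      s-good : bad τ² (δ s) ≡ false
      s-good = good-intro {τ²} {δ s} tr
        (subst₂ (λ v w → a i j v w ≡ true) (sym at-i) (sym at-j) x)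
        (subst₂ (λ v w → a i k v w ≡ true) (sym at-i) (sym at-k) y)
        (subst₂ (λ v w → a j k v w ≡ true) (sym at-j) (sym at-k) z)

  module Optimal (m u : ℕ) (nonextremal : Nonextremal m u b) (Z-small : length Z + 200 ≤ u) (N-small : 3 * N ≤ u * u) where
    open Nonextremal nonextremal
    open Neighbourhoods nonextremal

    one : (i j k : Fin 3) → Fin N → List (Fin N) → Fin N → Bool
    one i j k v S = (b i j v ∩ b i k v) ∩ fresh S

    -- The test concerns the vertices of class `k`; by `move₂` the vertices of classes `i` and `j`
    -- at the same positions can then become holes, and it is in those classes that the set is
    -- mostly used.
    two : (i j k : Fin 3) → Fin N → Fin N → List (Fin N) → Fin N → Bool
    two i j k v w S = (b i k v ∩ b j k w) ∩ fresh S

    candidates : ∀ {f g} S → 2 * m ≤ cnt f + u → 2 * m ≤ cnt g + u → length S ≤ u → m ≤ cnt ((f ∩ g) ∩ fresh S) + 3 * u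
    candidates {f} {g} S x y l = lin 8 (λ m u N f g fg c s → (2 · m :≤ f :+ u) ⇒ (2 · m :≤ g :+ u) ⇒ (s :≤ u) ⇒ (f :+ g :≤ N :+ fg) ⇒ (fg :≤ c :+ s) ⇒ (N :≤ 3 · m) ⇒ ⊢ m :≤ c :+ 3 · u)
      m u N (cnt f) (cnt g) (cnt (f ∩ g)) _ (length S) x y l (inter f g) (cnt-fresh (f ∩ g) S) (≤-reflexive N≡3m)

    one-large : ∀ {i j k} → Tri i j k → ∀ v S → length S ≤ u → m ≤ cnt (one i j k v S) + 3 * u
    one-large {i} {j} {k} t v S = candidates {b i j v} {b i k v} S (degree (≢₁₂ t) v) (degree (≢₁₃ t) v)

    two-large : ∀ {i j k} → Tri i j k → ∀ v w S → length S ≤ u → m ≤ cnt (two i j k v w S) + 3 * u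
    two-large {i} {j} {k} t v w S = candidates {b i k v} {b j k w} S (degree (≢₁₃ t) v) (degree (≢₂₃ t) w)

    missing : ∀ {i j} → i ≢ j → ∀ v → cnt (full ∖ b i j v) ≤ m + u
    missing {i} {j} n v = lin 7 (λ m u N f fb x d → (f :≤ fb :+ x) ⇒ (x :+ d :≤ f) ⇒ (2 · m :≤ d :+ u) ⇒ (f :≤ N) ⇒ (N :≤ 3 · m) ⇒ ⊢ x :≤ m :+ u)
      m u N (cnt {N} full) (cnt (full ∩ b i j v)) (cnt (full ∖ b i j v)) (cnt (b i j v)) (≤-reflexive (cnt-split full (b i j v)))
      (cnt-disjoint (λ _ _ → refl) (λ _ _ → refl) (λ x p q → proj₂ (∖-elim p) q)) (degree n v) (cnt≤n full) (≤-reflexive N≡3m)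

    -- Each of `v` and `w` misses at most `m + u` vertices of class `k`. If both miss `R`, the
    -- missed sets overlap in `R`, and the common neighbourhood gains as much.
    two-larger : ∀ {i j k} → Tri i j k → ∀ v w S R → length S ≤ u →
      (∀ x → R x ≡ true → b i k v x ≡ true → ⊥) → (∀ x → R x ≡ true → b j k w x ≡ true → ⊥) → m + cnt R ≤ cnt (two i j k v w S) + 3 * u
    two-larger {i} {j} {k} t v w S R l p q = lin 11 (λ m u N f c s r x y xy xny →
        (f :≤ c :+ (xy :+ s)) ⇒ (x :+ y :≤ xy :+ xny) ⇒ (r :≤ xny) ⇒ (x :≤ m :+ u) ⇒ (y :≤ m :+ u) ⇒ (s :≤ u) ⇒ (N :≤ f) ⇒ (3 · m :≤ N) ⇒
        (xy :+ xny :≤ x :+ y) ⇒ ⊢ m :+ r :≤ c :+ 3 · u)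
      m u N (cnt {N} full) (cnt (two i j k v w S)) (length S) (cnt R) (cnt X) (cnt Y) (cnt (X ∪ Y)) (cnt (X ∩ Y))
      (≤-trans (cnt-cover cover) (+-monoʳ-≤ (cnt (two i j k v w S)) (≤-trans (cnt-cover {f = (X ∪ Y) ∪ stale} λ _ → ∪-elim) (+-monoʳ-≤ (cnt (X ∪ Y)) stale-few))))
      (≤-reflexive (cnt-∪∩ X Y)) (cnt-mono λ x h → ∩-intro (∖-intro refl (p x h)) (∖-intro refl (q x h)))
      (missing (≢₁₃ t) v) (missing (≢₂₃ t) w) l (≤-reflexive (sym (cnt-all N))) (≤-reflexive (sym N≡3m)) (≤-reflexive (sym (cnt-∪∩ X Y)))
      where
      X Y stale : Fin N → Bool
      X = full ∖ b i k v
      Y = full ∖ b j k w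
      stale = full ∖ fresh S
      stale-few : cnt stale ≤ length S
      stale-few = cnt-stale′ S
      cover : ∀ x → full x ≡ true → two i j k v w S x ≡ true ⊎ ((X ∪ Y) ∪ stale) x ≡ true
      cover x _ with bool? (b i k v x) | bool? (b j k w x) | bool? (fresh S x)
      ... | inj₁ p | inj₁ q | inj₁ r = inj₁ (∩-intro (∩-intro p q) r)
      ... | inj₂ p | _ | _ = inj₂ (∪-introˡ (∪-introˡ (∖-intro refl p)))
      ... | _ | inj₂ p | _ = inj₂ (∪-introˡ (∪-introʳ (∖-intro refl p)))
      ... | _ | _ | inj₂ p = inj₂ (∪-introʳ (∖-intro refl p))

    module _ {i j : Fin 3} (X Y : Fin N → Bool) (apart : ∀ s t → X s ≡ true → Y t ≡ true → s ≢ t → b i j s t ≡ true → ⊥) where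

      -- Two vertices at the same position cannot both be brought in by separate moves, so nothing
      -- excludes an edge between them; this is the single exception.
      apart-nb : ∀ s → X s ≡ true → nb (b i j) Y s ≤ 1
      apart-nb s h = ≤-trans (cnt-mono {g = _== s} λ t q → same t (∩-elim q)) (cnt-== s)
        where
        same : ∀ t → Y t ≡ true × b i j s t ≡ true → (t == s) ≡ true
        same t (y , e) with bool? (t == s)
        ... | inj₁ r = r
        ... | inj₂ r = ⊥-elim (apart s t h y (λ { refl → r (==-refl s) }) e)

      apart-E : E (b i j) X Y ≤ 200 * (u * N)
      apart-E = ≤-trans (E-≤N X Y 1 apart-nb) (lin 2 (λ N uN → (N :≤ uN) ⇒ ⊢ con 1 :* N :≤ 200 · uN) N (u * N)
        (≤-trans (≤-reflexive (sym (*-identityˡ N))) (*-monoˡ-≤ N u-pos)))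

    weaken-size : ∀ {x} → m ≤ x + 3 * u → m ≤ x + 200 * u
    weaken-size {x} = lin 3 (λ m u x → (m :≤ x :+ 3 · u) ⇒ ⊢ m :≤ x :+ 200 · u) m u x

    adjacent-or-bad : ∀ {i j k} → Tri i j k → ∀ {t} → (bad σ t ≡ true → ⊥) → b i j t t ≡ true
    adjacent-or-bad tr {t} h with bad σ t in eq
    ... | true = ⊥-elim (h refl)
    ... | false = good-elim {σ} {t} tr eq

    -- Forcing an edge of holes between two given classes inside one block

    module Block (β : Fin 6) (η₀ : Holes N) (ℓ : ℕ) (ℓ≤u : ℓ ≤ u) where

      -- n bounds the number of further moves that may still be made.
      record Q (n : ℕ) (S : List (Fin N)) (η : Holes N) : Set where
        field
          reached : Reached S η
          outside : ∀ c s → proj₁ s ≢ β → η c s ≡ η₀ c s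
          fuel : length S + n ≤ ℓ

      NoEdge : Fin 3 → Fin 3 → Set
      NoEdge i j = ∀ {n S η} → Q n S η → ∀ p q {v w} → η i (β , p) ≡ v → η j (β , q) ≡ w → b i j v w ≡ true → ⊥

      slot≢ : ∀ {p q : Fin 4} → p ≢ q → (β , p) ≢ (β , q)
      slot≢ h refl = h refl

      module _ {n S η} (st : Q (suc n) S η) where
        open Q st

        len : length S ≤ u
        len = ≤-trans (m≤m+n (length S) (suc n)) (≤-trans fuel ℓ≤u)

        relax : Q n S η
        relax = record { reached = reached ; outside = outside ; fuel = ≤-trans (+-monoʳ-≤ (length S) (n≤1+n n)) fuel }

        private
          fuel′ : suc (length S) + n ≤ ℓ
          fuel′ = subst (_≤ ℓ) (+-suc (length S) n) fuel

          upd-outside : ∀ {i p t} c s → proj₁ s ≢ β → upd η i (β , p) t c s ≡ η₀ c s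
          upd-outside c s h = trans (upd-slot η (λ { refl → h refl })) (outside c s h)

        q₁ : ∀ {i j k} → Tri i j k → ∀ p {v t} → η i (β , p) ≡ v → one i j k v S t ≡ true → b j k t t ≡ true → Q n (t ∷ S) (upd η i (β , p) t)
        q₁ tr p refl h z = let xy , f = ∩-elim h ; x , y = ∩-elim xy in
          record { reached = move₁ reached tr (β , p) f x y z ; outside = upd-outside ; fuel = fuel′ }

        q₃ : ∀ i p {t} → fresh S t ≡ true → bad σ t ≡ true → Q n (t ∷ S) (upd η i (β , p) t)
        q₃ i p f h = record { reached = move₃ reached i (β , p) f h ; outside = upd-outside ; fuel = fuel′ }

        q₂ : ∀ {i j k} → Tri i j k → ∀ p q {v w t} → η i (β , p) ≡ v → η j (β , q) ≡ w → b i j v w ≡ true → two i j k v w S t ≡ true →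
          Q n (t ∷ S) (upd (upd η i (β , p) t) j (β , q) t)
        q₂ tr p q refl refl e h = let xy , f = ∩-elim h ; x , y = ∩-elim xy in
          record { reached = move₂ reached tr (β , p) (β , q) f e x y
                 ; outside = λ c s h → trans (upd-slot _ (λ { refl → h refl })) (upd-outside c s h) ; fuel = fuel′ }

        q₂-good : ∀ {i j k} → Tri i j k → ∀ p q {v w t} → η i (β , p) ≡ v → η j (β , q) ≡ w → b i j v w ≡ true → two i j k v w S t ≡ true →
          bad σ t ≡ false
        q₂-good tr p q refl refl e h = let xy , f = ∩-elim h ; x , y = ∩-elim xy in absorbing-good reached tr (β , p) (β , q) f e x y

      module _ {i j k : Fin 3} (tr : Tri i j k) (η : Holes N) where
        upd₂-ˡ : ∀ {s s′ t} → upd (upd η i s t) j s′ t i s ≡ t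
        upd₂-ˡ {s} = trans (upd-class _ (≢₁₂ tr)) (upd-≡ η i s)

        upd₂-ʳ : ∀ {s s′ t} → upd (upd η i s t) j s′ t j s′ ≡ t
        upd₂-ʳ {s} {s′} = upd-≡ _ j s′

        upd₂-class : ∀ {s s′ t s″} → upd (upd η i s t) j s′ t k s″ ≡ η k s″
        upd₂-class = trans (upd-class _ (λ e → ≢₂₃ tr (sym e))) (upd-class η (λ e → ≢₁₃ tr (sym e)))

        upd₂-slotʳ : ∀ {s s′ t s″} → s″ ≢ s′ → upd (upd η i s t) j s′ t j s″ ≡ η j s″
        upd₂-slotʳ n = trans (upd-slot _ n) (upd-class η (λ e → ≢₁₂ tr (sym e)))

        upd₂-slotˡ : ∀ {s s′ t s″} → s″ ≢ s → upd (upd η i s t) j s′ t i s″ ≡ η i s″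
        upd₂-slotˡ n = trans (upd-class _ (≢₁₂ tr)) (upd-slot η n)

      fresh-cons : ∀ {f : Fin N → Bool} {S x t} → (f ∩ fresh S) t ≡ true → t ≢ x → (f ∩ fresh (x ∷ S)) t ≡ true
      fresh-cons h n = let p , q = ∩-elim h in ∩-intro p (fresh-∷ n q)

      swap-no : ∀ {i j} → NoEdge i j → NoEdge j i
      swap-no noE st p q x y e = noE st q p y x (b-flip e)

      Others : Holes N → Holes N → Fin 4 → Fin 4 → Set
      Others η η′ p q = ∀ c r → r ≢ p → r ≢ q → η′ c (β , r) ≡ η c (β , r)

      -- The negation of the aim: edges from the holes of classes `i` and `j` in slot `p` to the two
      -- holes of class `k` in slots `p` and `q`. Either matching has to count, since the first edge
      -- may be rerouted to slot `q` when the second is found.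
      Goal : Fin 3 → Fin 3 → Fin 3 → ℕ → Holes N → Fin 4 → Fin 4 → Set
      Goal i j k n η p q = ∀ {S′ η′} → Q n S′ η′ → Others η η′ p q → ∀ z z′ → (z ≡ p × z′ ≡ q) ⊎ (z ≡ q × z′ ≡ p) →
        b i k (η′ i (β , p)) (η′ k (β , z)) ≡ true → b j k (η′ j (β , p)) (η′ k (β , z′)) ≡ true → ⊥

      -- If `t` were bad, its vertex of class `j` could be made a hole for free, and it is adjacent
      -- to the hole of class `i`.
      one-ok : ∀ {i j k} → Tri i j k → NoEdge i j → ∀ {n S η} → Q (suc n) S η → ∀ p {t} → one i j k (η i (β , p)) S t ≡ true → b j k t t ≡ true
      one-ok {i} {j} {k} tr noE {η = η} st p {t} h = adjacent-or-bad (swapʳ (swapˡ tr)) λ bd →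
        let xy , f = ∩-elim h ; x , y = ∩-elim xy in
        noE (q₃ st j p f bd) p p (upd-class η (≢₁₂ tr)) (upd-≡ η j (β , p)) x

      subst-edge : ∀ {i j v v′ w w′} → v′ ≡ v → w′ ≡ w → b i j v w ≡ true → b i j v′ w′ ≡ true
      subst-edge refl refl e = e

      module FromEdge {i j k : Fin 3} (tr : Tri i j k) (noE : NoEdge i j) {p q : Fin 4} (p≢q : p ≢ q) where

        -- One of the two edges is present. The possible holes `A`, `R₂`, `R₃` for class `i` in slot
        -- `p`, class `j` in slot `p` and class `k` in slot `q` would form a sparse triple: an edge
        -- between `A` and `R₂` violates `NoEdge`, one between `R₂` and `R₃` attains the aim, and
        -- `hA3` excludes the third kind.
        both₁₃ : ∀ {n S η} → Q (4 + n) S η → b i k (η i (β , p)) (η k (β , p)) ≡ true → Goal i j k n η p q → ⊥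
        both₁₃ {n} {S} {η} st e goal = no-sparse tr A R₂ R₃ (weaken-size {cnt A} (two-large tikj _ _ S (len st)))
            (weaken-size {cnt R₂} (one-large tjik _ S (len st))) (weaken-size {cnt R₃} (one-large tkij _ S (len st)))
            (apart-E A R₂ hA2) (apart-E A R₃ hA3) (apart-E R₂ R₃ h23)
          where
          tikj : Tri i k j
          tikj = swapʳ tr
          tjik : Tri j i k
          tjik = swapˡ tr
          tkij : Tri k i j
          tkij = swapˡ tikj
          A R₂ R₃ : Fin N → Bool
          A = two i k j (η i (β , p)) (η k (β , p)) S
          R₂ = one j i k (η j (β , p)) S
          R₃ = one k i j (η k (β , q)) S
          k≢j : k ≢ j
          k≢j e = ≢₂₃ tr (sym e)
          q≢p : (β , q) ≢ (β , p)
          q≢p = slot≢ (λ e → p≢q (sym e))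
          relax² : ∀ {n S η} → Q (2 + n) S η → Q n S η
          relax² st = relax (relax st)

          ok₂ : ∀ {t} → R₂ t ≡ true → b i k t t ≡ true
          ok₂ = one-ok tjik (swap-no noE) st p

          ok₃ : ∀ {t} → R₃ t ≡ true → b i j t t ≡ true
          ok₃ {t} h = adjacent-or-bad tr λ bd → let xy , f = ∩-elim h ; x , y = ∩-elim xy in
            goal (relax (relax² (q₃ st j p f bd))) (λ c r n₁ n₂ → upd-slot η (slot≢ n₁)) p q (inj₁ (refl , refl))
              (subst-edge (upd-class η (≢₁₂ tr)) (upd-class η k≢j) e)
              (subst-edge (upd-≡ η j (β , p)) (upd-class η k≢j) (b-flip y))

          hA2 : ∀ s t → A s ≡ true → R₂ t ≡ true → s ≢ t → b i j s t ≡ true → ⊥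
          hA2 s t hs ht s≢t x =
            let st¹ = q₂ st tikj p p refl refl e hs
                st² = q₁ st¹ tjik p (upd₂-class tikj η) (fresh-cons ht (λ e → s≢t (sym e))) (ok₂ ht)
            in noE st² p p (trans (upd-class _ (≢₁₂ tr)) (upd₂-ˡ tikj η)) (upd-≡ _ j (β , p)) x

          h23 : ∀ s t → R₂ s ≡ true → R₃ t ≡ true → s ≢ t → b j k s t ≡ true → ⊥
          h23 s t hs ht s≢t x =
            let st¹ = q₁ st tjik p refl hs (ok₂ hs)
                st² = q₁ st¹ tkij q (upd-slot η q≢p) (fresh-cons ht (λ e → s≢t (sym e))) (ok₃ ht)
            in goal (relax² st²) (λ c r n₁ n₂ → trans (upd-slot _ (slot≢ n₂)) (upd-slot η (slot≢ n₁))) p q (inj₁ (refl , refl))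
              (subst-edge (trans (upd-class _ (≢₁₃ tr)) (upd-class η (≢₁₂ tr))) (trans (upd-slot _ (slot≢ p≢q)) (upd-class η (λ e → ≢₂₃ tr (sym e)))) e)
              (subst-edge (trans (upd-class _ (≢₂₃ tr)) (upd-≡ η j (β , p))) (upd-≡ _ k (β , q)) x)

          -- With `s` placed in classes `i` and `k` and `t` in slot `q` of class `k`, both ends of
          -- the edge at `s` miss `R₂`: adjacency in class `i` violates `NoEdge`, and adjacency in
          -- class `k` attains the aim, with `t` serving class `i`. So the edge has about `2 m`
          -- common neighbours `A′`, all of them possible holes of class `i`. But a vertex of `R₂`
          -- has about `m` neighbours among `2 m` vertices, whereas it may have at most one in `A′`.
          hA3 : ∀ s t → A s ≡ true → R₃ t ≡ true → s ≢ t → b i k s t ≡ true → ⊥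
          hA3 s t hs ht s≢t x = 1≰0 (lin 6 (λ m u a r r′ o → (m :+ r′ :≤ a :+ 3 · u) ⇒ (a :≤ o :+ (m :+ u)) ⇒ (o :≤ con 1) ⇒ (r :≤ r′ :+ con 2) ⇒ (m :≤ r :+ 3 · u) ⇒ (1000 · u :≤ m) ⇒ (con 1 :≤ u) ⇒ ⊢ con 1 :≤ con 0)
              m u (cnt A′) (cnt R₂) (cnt R′) (nb (b j i) A′ r₀)
              (two-larger tikj s s (t ∷ s ∷ S) R′ (len st²) far-i far-k)
              (nb-large (≢₁₂ tjik) A′ r₀) (apart-nb R′ A′ (λ r v hr hv n y → A′R₂ v r hv hr (λ e → n (sym e)) (b-flip y)) r₀ r₀∈)
              (cnt-fresh R₂ (t ∷ s ∷ [])) (one-large tjik _ S (len st)) u-small u-pos)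
            where
            t≢s : t ≢ s
            t≢s e = s≢t (sym e)
            st¹ = q₂ st tikj p p refl refl e hs
            η¹ = upd (upd η i (β , p) s) k (β , p) s
            st² = q₁ st¹ tkij q (upd₂-slotʳ tikj η q≢p) (fresh-cons ht t≢s) (ok₃ ht)
            η² = upd η¹ k (β , q) t
            i² : η² i (β , p) ≡ s
            i² = trans (upd-class _ (≢₁₃ tr)) (upd₂-ˡ tikj η)
            k² : η² k (β , p) ≡ s
            k² = trans (upd-slot _ (slot≢ p≢q)) (upd₂-ʳ tikj η)
            j² : η² j (β , p) ≡ η j (β , p)
            j² = trans (upd-class _ (≢₂₃ tr)) (upd₂-class tikj η)
            others² : Others η η² p q
            others² c r n₁ n₂ = trans (upd-slot _ (slot≢ n₂)) (trans (upd-slot _ (slot≢ n₁)) (upd-slot η (slot≢ n₁)))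
            R′ A′ : Fin N → Bool
            R′ = R₂ ∩ fresh (t ∷ s ∷ [])
            A′ = two i k j s s (t ∷ s ∷ S)
            s-edge : b i k s s ≡ true
            s-edge = good-elim {σ} {s} tikj (q₂-good st tikj p p refl refl e hs)
            R′-fresh : ∀ {r} → R′ r ≡ true → one j i k (η j (β , p)) (t ∷ s ∷ S) r ≡ true
            R′-fresh h = let h₁ , f = ∩-elim h in fresh-cons (fresh-cons h₁ (fresh-head (fresh-tail f))) (fresh-head f)
            far-i : ∀ r → R′ r ≡ true → b i j s r ≡ true → ⊥
            far-i r h y = let h₁ , f = ∩-elim h in hA2 s r hs h₁ (λ e → fresh-head (fresh-tail f) (sym e)) y
            far-k : ∀ r → R′ r ≡ true → b k j s r ≡ true → ⊥
            far-k r h y = let h₁ , f = ∩-elim h in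
              goal (relax (q₁ st² tjik p j² (R′-fresh h) (ok₂ h₁))) (λ c w n₁ n₂ → trans (upd-slot _ (slot≢ n₁)) (others² c w n₁ n₂)) q p (inj₂ (refl , refl))
                (subst-edge (trans (upd-class _ (≢₁₂ tr)) i²) (trans (upd-class _ (λ e → ≢₂₃ tr (sym e))) (upd-≡ _ k (β , q))) x)
                (subst-edge (upd-≡ _ j (β , p)) (trans (upd-class _ (λ e → ≢₂₃ tr (sym e))) k²) (b-flip y))
            A′R₂ : ∀ v r → A′ v ≡ true → R′ r ≡ true → v ≢ r → b i j v r ≡ true → ⊥
            A′R₂ v r hv hr v≢r y =
              let st³ = q₂ st² tikj p p i² k² s-edge hv
                  st⁴ = q₁ st³ tjik p (trans (upd₂-class tikj η²) j²) (fresh-cons (R′-fresh hr) (λ e → v≢r (sym e))) (ok₂ (proj₁ (∩-elim hr)))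
              in noE st⁴ p p (trans (upd-class _ (≢₁₂ tr)) (upd₂-ˡ tikj η²)) (upd-≡ _ j (β , p)) y
            some-r : ∃[ r ] R′ r ≡ true
            some-r = cnt-∃ R′ (lin 4 (λ m u r r′ → (r :≤ r′ :+ con 2) ⇒ (m :≤ r :+ 3 · u) ⇒ (1000 · u :≤ m) ⇒ (con 1 :≤ u) ⇒ ⊢ con 1 :≤ r′)
              m u (cnt R₂) (cnt R′) (cnt-fresh R₂ (t ∷ s ∷ [])) (one-large tjik _ S (len st)) u-small u-pos)
            r₀ = proj₁ some-r
            r₀∈ = proj₂ some-r

      module Both {i j k : Fin 3} (tr : Tri i j k) (noE : NoEdge i j) {p q : Fin 4} (p≢q : p ≢ q) where
        open FromEdge tr noE p≢q

        -- The sets of single replacements for the three holes in slot `p` would be a sparse triple,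
        -- so there is an edge from class `k` to class `i` or `j`. At most two moves create it, and
        -- `both₁₃`, possibly with `i` and `j` exchanged, has four left for the second edge.
        both : ∀ {n S η} → Q (6 + n) S η → Goal i j k n η p q → ⊥
        both {n} {S} {η} st goal = no-sparse tr R₁ R₂ R₃ (weaken-size {cnt R₁} (one-large tr _ S (len st)))
            (weaken-size {cnt R₂} (one-large tjik _ S (len st))) (weaken-size {cnt R₃} (one-large tkij _ S (len st)))
            (apart-E R₁ R₂ h12) (apart-E R₁ R₃ h13) (apart-E R₂ R₃ h23)
          where
          tjik : Tri j i k
          tjik = swapˡ tr
          tkij : Tri k i j
          tkij = swapˡ (swapʳ tr)
          i≢k : i ≢ k
          i≢k = ≢₁₃ tr
          k≢i : k ≢ i
          k≢i e = ≢₁₃ tr (sym e)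
          k≢j : k ≢ j
          k≢j e = ≢₂₃ tr (sym e)
          R₁ R₂ R₃ : Fin N → Bool
          R₁ = one i j k (η i (β , p)) S
          R₂ = one j i k (η j (β , p)) S
          R₃ = one k i j (η k (β , p)) S
          ok₁ : ∀ {t} → R₁ t ≡ true → b j k t t ≡ true
          ok₁ = one-ok tr noE st p
          ok₂ : ∀ {t} → R₂ t ≡ true → b i k t t ≡ true
          ok₂ = one-ok tjik (swap-no noE) st p
          ok₃ : ∀ {t} → R₃ t ≡ true → b i j t t ≡ true
          ok₃ {t} h = adjacent-or-bad tr λ bd → let xy , f = ∩-elim h ; x , y = ∩-elim xy in
            both₁₃ (relax (q₃ st i p f bd)) (subst-edge (upd-≡ η i (β , p)) (upd-class η k≢i) (b-flip x))
              (λ st′ o → goal st′ λ c r n₁ n₂ → trans (o c r n₁ n₂) (upd-slot η (slot≢ n₁)))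

          h12 : ∀ s t → R₁ s ≡ true → R₂ t ≡ true → s ≢ t → b i j s t ≡ true → ⊥
          h12 s t hs ht s≢t x =
            let st¹ = q₁ st tr p refl hs (ok₁ hs)
                st² = q₁ st¹ tjik p (upd-class η (≢₁₂ tjik)) (fresh-cons ht (λ e → s≢t (sym e))) (ok₂ ht)
            in noE st² p p (trans (upd-class _ (≢₁₂ tr)) (upd-≡ η i (β , p))) (upd-≡ _ j (β , p)) x

          h13 : ∀ s t → R₁ s ≡ true → R₃ t ≡ true → s ≢ t → b i k s t ≡ true → ⊥
          h13 s t hs ht s≢t x =
            let st¹ = q₁ st tr p refl hs (ok₁ hs)
                st² = q₁ st¹ tkij p (upd-class η k≢i) (fresh-cons ht (λ e → s≢t (sym e))) (ok₃ ht)
            in both₁₃ st² (subst-edge (trans (upd-class _ i≢k) (upd-≡ η i (β , p))) (upd-≡ _ k (β , p)) x)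
              (λ st′ o → goal st′ λ c r n₁ n₂ → trans (o c r n₁ n₂) (trans (upd-slot _ (slot≢ n₁)) (upd-slot η (slot≢ n₁))))

          h23 : ∀ s t → R₂ s ≡ true → R₃ t ≡ true → s ≢ t → b j k s t ≡ true → ⊥
          h23 s t hs ht s≢t x =
            let st¹ = q₁ st tjik p refl hs (ok₂ hs)
                st² = q₁ st¹ tkij p (upd-class η k≢j) (fresh-cons ht (λ e → s≢t (sym e))) (ok₃ ht)
            in both₁₃ʳ st² (subst-edge (trans (upd-class _ (≢₂₃ tr)) (upd-≡ η j (β , p))) (upd-≡ _ k (β , p)) x)
              (λ st′ o z z′ zz e e′ → goal st′ (λ c r n₁ n₂ → trans (o c r n₁ n₂) (trans (upd-slot _ (slot≢ n₁)) (upd-slot η (slot≢ n₁)))) z′ z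
                ([ (λ { (x , y) → inj₂ (y , x) }) , (λ { (x , y) → inj₁ (y , x) }) ]′ zz) e′ e)
            where
            both₁₃ʳ : ∀ {n S η} → Q (4 + n) S η → b j k (η j (β , p)) (η k (β , p)) ≡ true → Goal j i k n η p q → ⊥
            both₁₃ʳ = FromEdge.both₁₃ tjik (swap-no noE) p≢q

      -- Suppose that no edge between holes of classes i and j can be created, although there are two such
      -- edges for (i , k) and for (j , k). The possible holes A and C of classes i and j have no edges
      -- between them. A possible hole h of class k adjacent to some s in A sees in class j, outside C,
      -- essentially only the common neighbours of h and s; these can be turned into holes as well, so they
      -- nearly all lie in A.
      -- Hence it misses the m vertices outside A and C, so that about m of the 2m possible holes of
      -- class k have no neighbour in A or C.
      module Blocked {i j k : Fin 3} (tr : Tri i j k) (noE : NoEdge i j) {n S η} (st : Q (4 + n) S η)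
        {p r z₁ z₂ z₃ z₄ : Fin 4} (p≢r : p ≢ r) (z₁≢z₂ : z₁ ≢ z₂) (z₁≢z₃ : z₁ ≢ z₃) (z₁≢z₄ : z₁ ≢ z₄) (z₂≢z₃ : z₂ ≢ z₃) (z₂≢z₄ : z₂ ≢ z₄) (z₃≢z₄ : z₃ ≢ z₄)
        (e₁ : b i k (η i (β , p)) (η k (β , z₁)) ≡ true) (e₂ : b j k (η j (β , p)) (η k (β , z₂)) ≡ true)
        (e₃ : b i k (η i (β , r)) (η k (β , z₃)) ≡ true) (e₄ : b j k (η j (β , r)) (η k (β , z₄)) ≡ true) where

        private
          tikj : Tri i k j
          tikj = swapʳ tr
          tjki : Tri j k i
          tjki = swapʳ (swapˡ tr)
          i≢j : i ≢ j
          i≢j = ≢₁₂ tr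
          i≢k : i ≢ k
          i≢k = ≢₁₃ tr
          j≢k : j ≢ k
          j≢k = ≢₂₃ tr

        A C A″ C″ : Fin N → Bool
        A = two i k j (η i (β , p)) (η k (β , z₁)) S
        C = two j k i (η j (β , p)) (η k (β , z₂)) S
        A″ = two i k j (η i (β , r)) (η k (β , z₃)) S
        C″ = two j k i (η j (β , r)) (η k (β , z₄)) S

        A-large : m ≤ cnt A + 3 * u
        A-large = two-large tikj _ _ S (len st)
        C-large : m ≤ cnt C + 3 * u
        C-large = two-large tjki _ _ S (len st)
        A″-large : m ≤ cnt A″ + 3 * u
        A″-large = two-large tikj _ _ S (len st)
        C″-large : m ≤ cnt C″ + 3 * u
        C″-large = two-large tjki _ _ S (len st)

        -- Trading the edge `e₃` for `t` makes the vertex of class `i` at `t` a hole, and this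
        -- vertex is adjacent to both ends of the edge `e₄`: three holes would form a triangle.
        A″C″-disjoint : ∀ t → A″ t ≡ true → C″ t ≡ true → ⊥
        A″C″-disjoint t hA hC =
          let st¹ = q₂ st tikj r z₃ refl refl e₃ hA
              x , y = ∩-elim (proj₁ (∩-elim hC))
          in no-triangle (Q.reached st¹) tr (β , r) (β , r) (β , z₄)
            (subst-edge (upd₂-ˡ tikj η) (upd₂-class tikj η) (b-flip x))
            (subst-edge (upd₂-ˡ tikj η) (upd₂-slotʳ tikj η (slot≢ (λ e → z₃≢z₄ (sym e)))) (b-flip y))
            (subst-edge (upd₂-class tikj η) (upd₂-slotʳ tikj η (slot≢ (λ e → z₃≢z₄ (sym e)))) e₄)

        AC-apart : ∀ s t → A s ≡ true → C t ≡ true → s ≢ t → b i j s t ≡ true → ⊥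
        AC-apart s t hs ht s≢t x =
          let st¹ = q₂ st tikj p z₁ refl refl e₁ hs
              st² = q₂ st¹ tjki p z₂ (upd₂-class tikj η) (upd₂-slotʳ tikj η (slot≢ (λ e → z₁≢z₂ (sym e)))) e₂ (fresh-cons ht (λ e → s≢t (sym e)))
          in noE st² p p (trans (upd₂-class tjki _) (upd₂-ˡ tikj η)) (upd₂-ˡ tjki _) x

        -- The vertex `h` occupies a hole of class `k`, while the ends of `e₁` and `e₂` are still in
        -- place.
        record Placed (h : Fin N) : Set where
          field
            {η′} : Holes N
            z : Fin 4
            z≢z₁ : z ≢ z₁
            z≢z₂ : z ≢ z₂
            state : Q (3 + n) (h ∷ S) η′
            at-z : η′ k (β , z) ≡ h
            at-i : η′ i (β , p) ≡ η i (β , p)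
            at-j : η′ j (β , p) ≡ η j (β , p)
            at-z₁ : η′ k (β , z₁) ≡ η k (β , z₁)
            at-z₂ : η′ k (β , z₂) ≡ η k (β , z₂)

        place : ∀ {h} → A″ h ≡ true ⊎ C″ h ≡ true → Placed h
        place (inj₁ hA) = record
          { z = z₃ ; z≢z₁ = λ e → z₁≢z₃ (sym e) ; z≢z₂ = λ e → z₂≢z₃ (sym e) ; state = q₂ st tikj r z₃ refl refl e₃ hA
          ; at-z = upd₂-ʳ tikj η {β , r} ; at-i = upd₂-slotˡ tikj η (slot≢ p≢r) ; at-j = upd₂-class tikj η
          ; at-z₁ = upd₂-slotʳ tikj η (slot≢ z₁≢z₃) ; at-z₂ = upd₂-slotʳ tikj η (slot≢ z₂≢z₃) }
        place (inj₂ hC) = record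
          { z = z₄ ; z≢z₁ = λ e → z₁≢z₄ (sym e) ; z≢z₂ = λ e → z₂≢z₄ (sym e) ; state = q₂ st tjki r z₄ refl refl e₄ hC
          ; at-z = upd₂-ʳ tjki η {β , r} ; at-i = upd₂-class tjki η ; at-j = upd₂-slotˡ tjki η (slot≢ p≢r)
          ; at-z₁ = upd₂-slotʳ tjki η (slot≢ z₁≢z₄) ; at-z₂ = upd₂-slotʳ tjki η (slot≢ z₂≢z₄) }

        module _ {h s : Fin N} (pl : Placed h) (hs : A s ≡ true) (s≢h : s ≢ h) (x : b i k s h ≡ true) where
          open Placed pl

          A′ : Fin N → Bool
          A′ = two i k j s h (s ∷ h ∷ S)

          private
            st¹ : Q (2 + n) (s ∷ h ∷ S) (upd (upd η′ i (β , p) s) k (β , z₁) s)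
            st¹ = q₂ state tikj p z₁ at-i at-z₁ e₁ (fresh-cons hs s≢h)

            A′C-apart : ∀ v t → A′ v ≡ true → C t ≡ true → t ≢ s → t ≢ h → v ≢ t → b i j v t ≡ true → ⊥
            A′C-apart v t hv ht t≢s t≢h v≢t y =
              let η¹ = upd (upd η′ i (β , p) s) k (β , z₁) s
                  st² = q₂ st¹ tikj p z (upd₂-ˡ tikj η′) (trans (upd₂-slotʳ tikj η′ (slot≢ z≢z₁)) at-z) x hv
                  st³ = q₂ st² tjki p z₂ (trans (upd₂-class tikj η¹) (trans (upd₂-class tikj η′) at-j))
                    (trans (upd₂-slotʳ tikj η¹ (slot≢ (λ e → z≢z₂ (sym e)))) (trans (upd₂-slotʳ tikj η′ (slot≢ (λ e → z₁≢z₂ (sym e)))) at-z₂))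
                    e₂ (fresh-cons (fresh-cons (fresh-cons ht t≢h) t≢s) (λ e → v≢t (sym e)))
              in noE st³ p p (trans (upd₂-class tjki _) (upd₂-ˡ tikj η¹)) (upd₂-ˡ tjki _) y

            C′ : Fin N → Bool
            C′ = C ∩ fresh (s ∷ h ∷ [])

            some-t : ∃[ t ] C′ t ≡ true
            some-t = cnt-∃ C′ (lin 4 (λ m u r r′ → (r :≤ r′ :+ con 2) ⇒ (m :≤ r :+ 3 · u) ⇒ (1000 · u :≤ m) ⇒ (con 1 :≤ u) ⇒ ⊢ con 1 :≤ r′)
              m u (cnt C) (cnt C′) (cnt-fresh C (s ∷ h ∷ [])) C-large u-small u-pos)

            apart′ : ∀ t v → C′ t ≡ true → (A ∪ A′) v ≡ true → t ≢ v → b j i t v ≡ true → ⊥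
            apart′ t v ht hv t≢v y = let ht₁ , f = ∩-elim ht in
              [ (λ hA → AC-apart v t hA ht₁ (λ e → t≢v (sym e)) (b-flip y))
              , (λ hA → A′C-apart v t hA ht₁ (fresh-head f) (fresh-head (fresh-tail f)) (λ e → t≢v (sym e)) (b-flip y)) ]′ (∪-elim hv)

          -- Vertices of `A′` can replace the hole of class `i` just as those of `A`, so a vertex of
          -- `C` away from `s` and `h` misses all of `A ∪ A′` except perhaps the vertex at its own
          -- position.
          cap : cnt (A ∪ A′) ≤ 1 + (m + u)
          cap = ≤-trans (nb-large (λ e → i≢j (sym e)) (A ∪ A′) (proj₁ some-t))
            (+-monoˡ-≤ (m + u) (apart-nb C′ (A ∪ A′) apart′ (proj₁ some-t) (proj₂ some-t)))

          few : nb (b k j) (full ∖ (A ∪ C)) h ≤ 11 * u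
          few = lin 11 (λ m u y w w₁ w₂ aa a c c′ bs →
              (y :≤ w :+ (w₁ :+ w₂)) ⇒ (w :+ a :≤ aa) ⇒ (aa :≤ con 1 :+ (m :+ u)) ⇒ (m :≤ a :+ 3 · u) ⇒ (w₁ :≤ u) ⇒
              (w₂ :+ c′ :≤ bs) ⇒ (c :≤ c′ :+ con 1) ⇒ (m :≤ c :+ 3 · u) ⇒ (bs :≤ m :+ u) ⇒ (con 1 :≤ u) ⇒ ⊢ y :≤ 11 · u)
            m u (nb (b k j) Y h) (cnt ((A ∪ A′) ∖ A)) (cnt (full ∖ fresh (s ∷ h ∷ S))) (cnt ((full ∖ b i j s) ∖ C)) (cnt (A ∪ A′)) (cnt A) (cnt C)
              (cnt (C ∩ fresh (s ∷ []))) (cnt (full ∖ b i j s))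
            (≤-trans (cnt-cover cover) (+-monoʳ-≤ (cnt ((A ∪ A′) ∖ A)) (cnt-cover {f = (full ∖ fresh (s ∷ h ∷ S)) ∪ ((full ∖ b i j s) ∖ C)} λ _ → ∪-elim)))
            (cnt-disjoint (λ v q → proj₁ (∖-elim q)) (λ v → ∪-introˡ) (λ v q → proj₂ (∖-elim q))) cap A-large
            (≤-trans (cnt-stale′ (s ∷ h ∷ S)) (len st¹))
            (cnt-disjoint (λ v q → proj₁ (∖-elim q)) (λ v q → let c , f = ∩-elim q in ∖-intro refl λ y → AC-apart s v hs c (λ e → fresh-head f (sym e)) y)
              (λ v q q′ → proj₂ (∖-elim q) (proj₁ (∩-elim q′))))
            (cnt-fresh C (s ∷ [])) C-large (missing i≢j s) u-pos
            where
            Y : Fin N → Bool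
            Y = full ∖ (A ∪ C)
            cover : ∀ y → (Y ∩ b k j h) y ≡ true → ((A ∪ A′) ∖ A) y ≡ true ⊎ ((full ∖ fresh (s ∷ h ∷ S)) ∪ ((full ∖ b i j s) ∖ C)) y ≡ true
            cover y q = split (∩-elim q) (bool? (b i j s y)) (bool? (fresh (s ∷ h ∷ S) y))
              where
              split : Y y ≡ true × b k j h y ≡ true → b i j s y ≡ true ⊎ (b i j s y ≡ true → ⊥) → fresh (s ∷ h ∷ S) y ≡ true ⊎ (fresh (s ∷ h ∷ S) y ≡ true → ⊥) →
                ((A ∪ A′) ∖ A) y ≡ true ⊎ ((full ∖ fresh (s ∷ h ∷ S)) ∪ ((full ∖ b i j s) ∖ C)) y ≡ true
              split (q₁ , q₂) (inj₁ e) (inj₁ f) = inj₁ (∖-intro (∪-introʳ (∩-intro (∩-intro e q₂) f)) (λ a → proj₂ (∖-elim q₁) (∪-introˡ a)))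
              split (q₁ , q₂) (inj₂ e) _ = inj₂ (∪-introʳ (∖-intro (∖-intro refl e) (λ c → proj₂ (∖-elim q₁) (∪-introʳ c))))
              split (q₁ , q₂) (inj₁ _) (inj₂ f) = inj₂ (∪-introˡ (∖-intro refl f))

        A-small : cnt A ≤ 1 + (m + u)
        A-small = ≤-trans (nb-large (λ e → i≢j (sym e)) A (proj₁ some-t))
          (+-monoˡ-≤ (m + u) (apart-nb C A (λ t v ht hv n y → AC-apart v t hv ht (λ e → n (sym e)) (b-flip y)) (proj₁ some-t) (proj₂ some-t)))
          where
          some-t : ∃[ t ] C t ≡ true
          some-t = cnt-∃ C (lin 3 (λ m u r → (m :≤ r :+ 3 · u) ⇒ (1000 · u :≤ m) ⇒ (con 1 :≤ u) ⇒ ⊢ con 1 :≤ r) m u (cnt C) C-large u-small u-pos)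

      module Contradiction {i j k : Fin 3} (tr : Tri i j k) (noE : NoEdge i j) {n S η} (st : Q (4 + n) S η)
        {p r z₁ z₂ z₃ z₄ : Fin 4} (p≢r : p ≢ r) (z₁≢z₂ : z₁ ≢ z₂) (z₁≢z₃ : z₁ ≢ z₃) (z₁≢z₄ : z₁ ≢ z₄) (z₂≢z₃ : z₂ ≢ z₃) (z₂≢z₄ : z₂ ≢ z₄) (z₃≢z₄ : z₃ ≢ z₄)
        (e₁ : b i k (η i (β , p)) (η k (β , z₁)) ≡ true) (e₂ : b j k (η j (β , p)) (η k (β , z₂)) ≡ true)
        (e₃ : b i k (η i (β , r)) (η k (β , z₃)) ≡ true) (e₄ : b j k (η j (β , r)) (η k (β , z₄)) ≡ true) where

        open Blocked tr noE st p≢r z₁≢z₂ z₁≢z₃ z₁≢z₄ z₂≢z₃ z₂≢z₄ z₃≢z₄ e₁ e₂ e₃ e₄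
        module Sw = Blocked (swapˡ tr) (swap-no noE) st p≢r (λ e → z₁≢z₂ (sym e)) z₂≢z₄ z₂≢z₃ z₁≢z₄ z₁≢z₃ (λ e → z₃≢z₄ (sym e)) e₂ e₁ e₄ e₃

        private
          Y : Fin N → Bool
          Y = full ∖ (A ∪ C)

          near : Fin N → Bool
          near = full ∖ above (11 * u) (nb (b k j) Y)

          W : Fin N → Bool
          W = (A″ ∪ C″) ∖ near

          k≢j : k ≢ j
          k≢j e = ≢₂₃ tr (sym e)

          A-free : ∀ {h} → W h ≡ true → ∀ s → A s ≡ true → h ≢ s → b i k s h ≡ true → ⊥
          A-free {h} w s hs h≢s x = let wh , far = ∖-elim w in
            far (∖-intro refl λ q → <⇒≱ (above-elim q) (few (place (∪-elim wh)) hs (λ e → h≢s (sym e)) x))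

          -- Both ends of the edge from `t` to `h` miss `A`, by `AC-apart` and `A-free`, so they
          -- have about `2 m` common neighbours in class `i`. These are candidates for the hole of
          -- class `j`, of which the mirrored `cap` allows about `m` only.
          C-free : ∀ {h} → W h ≡ true → ∀ t → C t ≡ true → h ≢ t → b j k t h ≡ true → ⊥
          C-free {h} w t ht h≢t x = 1≰0 (lin 6 (λ m u r a c cc → (m :+ r :≤ c :+ 3 · u) ⇒ (a :≤ r :+ con 2) ⇒ (m :≤ a :+ 3 · u) ⇒ (c :≤ cc) ⇒ (cc :≤ con 1 :+ (m :+ u)) ⇒ (1000 · u :≤ m) ⇒ (con 1 :≤ u) ⇒ ⊢ con 1 :≤ con 0)
              m u (cnt R) (cnt A) (cnt C′) (cnt (C ∪ C′))
              (two-larger (swapʳ (swapˡ tr)) t h (t ∷ h ∷ S) R short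
                (λ s q y → let hA , f = ∩-elim q in AC-apart s t hA ht (fresh-head f) (b-flip y))
                (λ s q y → let hA , f = ∩-elim q in A-free w s hA (λ e → fresh-head (fresh-tail f) (sym e)) (b-flip y)))
              (cnt-fresh A (t ∷ h ∷ [])) A-large (cnt-mono λ v → ∪-introʳ) (Sw.cap pl ht (λ e → h≢t (sym e)) x) u-small u-pos)
            where
            pl : Sw.Placed h
            pl = Sw.place ([ inj₂ , inj₁ ]′ (∪-elim (proj₁ (∖-elim w))))
            C′ : Fin N → Bool
            C′ = Sw.A′ pl ht (λ e → h≢t (sym e)) x
            R : Fin N → Bool
            R = A ∩ fresh (t ∷ h ∷ [])
            short : length (t ∷ h ∷ S) ≤ u
            short = ≤-trans (≤-trans (≤-reflexive (+-comm 2 (length S))) (+-monoʳ-≤ (length S) (s≤s (s≤s z≤n)))) (≤-trans (Q.fuel st) ℓ≤u)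

          Y-large : m ≤ 2 * cnt Y
          Y-large = lin 8 (λ m u N f a c ac y → (f :≤ ac :+ y) ⇒ (ac :≤ a :+ c) ⇒ (a :≤ con 1 :+ (m :+ u)) ⇒ (c :≤ con 1 :+ (m :+ u)) ⇒ (N :≤ f) ⇒ (3 · m :≤ N) ⇒ (1000 · u :≤ m) ⇒ (con 1 :≤ u) ⇒ ⊢ m :≤ 2 · y)
            m u N (cnt {N} full) (cnt A) (cnt C) (cnt (A ∪ C)) (cnt Y)
            (≤-trans (≤-reflexive (cnt-split full (A ∪ C))) (+-monoˡ-≤ (cnt Y) (cnt-mono λ v q → proj₂ (∩-elim q))))
            (cnt-cover λ _ → ∪-elim) A-small Sw.A-small (≤-reflexive (sym (cnt-all N))) (≤-reflexive (sym N≡3m)) u-small u-pos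

          near-small : cnt near ≤ m + 67 * u
          near-small = few-neighbours-small k≢j near Y 11 (λ x h → ≮⇒≥ λ q → proj₂ (∖-elim h) (above-intro q)) Y-large

          W-large : m ≤ cnt W + 200 * u
          W-large = lin 8 (λ m u w h hn nr a c → (h :≤ hn :+ w) ⇒ (hn :≤ nr) ⇒ (nr :≤ m :+ 67 · u) ⇒ (a :+ c :≤ h) ⇒ (m :≤ a :+ 3 · u) ⇒ (m :≤ c :+ 3 · u) ⇒ ⊢ m :≤ w :+ 200 · u)
            m u (cnt W) (cnt (A″ ∪ C″)) (cnt ((A″ ∪ C″) ∩ near)) (cnt near) (cnt A″) (cnt C″)
            (≤-reflexive (cnt-split (A″ ∪ C″) near)) (cnt-mono λ v q → proj₂ (∩-elim q)) near-small
            (cnt-disjoint (λ v → ∪-introˡ) (λ v → ∪-introʳ) A″C″-disjoint) A″-large C″-large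

        absurd : ⊥
        absurd = no-sparse (swapˡ (swapʳ tr)) W A C W-large (weaken-size {cnt A} A-large) (weaken-size {cnt C} C-large)
          (apart-E W A λ h s w hs n y → A-free w s hs n (b-flip y)) (apart-E W C λ h t w ht n y → C-free w t ht n (b-flip y)) (apart-E A C AC-apart)

      -- Slots 0 and 1 carry the first pair of edges, slots 2 and 3 the second, and `Others`
      -- protects the first pair while the second is made. Each use of `both` spends up to six
      -- moves, so that 20 become 14 and then 8.
      blocked-absurd : ∀ {i j k} → Tri i j k → NoEdge i j → ∀ {S η} → Q 20 S η → ⊥
      blocked-absurd {i} {j} {k} tr noE st =
        Both.both tr noE {0F} {1F} (λ ()) {14} st λ {_} {η¹} st¹ _ z₁ z₂ zz e₁ e₂ →
        Both.both tr noE {2F} {3F} (λ ()) {8} st¹ λ st² o z₃ z₄ zz′ e₃ e₄ →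
        finish {η¹ = η¹} st² o zz zz′ e₁ e₂ e₃ e₄
        where
        finish : ∀ {S² η¹ η² z₁ z₂ z₃ z₄} → Q 8 S² η² → Others η¹ η² 2F 3F → (z₁ ≡ 0F × z₂ ≡ 1F) ⊎ (z₁ ≡ 1F × z₂ ≡ 0F) →
          (z₃ ≡ 2F × z₄ ≡ 3F) ⊎ (z₃ ≡ 3F × z₄ ≡ 2F) →
          b i k (η¹ i (β , 0F)) (η¹ k (β , z₁)) ≡ true → b j k (η¹ j (β , 0F)) (η¹ k (β , z₂)) ≡ true →
          b i k (η² i (β , 2F)) (η² k (β , z₃)) ≡ true → b j k (η² j (β , 2F)) (η² k (β , z₄)) ≡ true → ⊥
        finish st o (inj₁ (refl , refl)) (inj₁ (refl , refl)) e₁ e₂ e₃ e₄ =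
          Contradiction.absurd tr noE st (λ ()) (λ ()) (λ ()) (λ ()) (λ ()) (λ ()) (λ ())
            (subst-edge (o i 0F (λ ()) (λ ())) (o k 0F (λ ()) (λ ())) e₁) (subst-edge (o j 0F (λ ()) (λ ())) (o k 1F (λ ()) (λ ())) e₂) e₃ e₄
        finish st o (inj₁ (refl , refl)) (inj₂ (refl , refl)) e₁ e₂ e₃ e₄ =
          Contradiction.absurd tr noE st (λ ()) (λ ()) (λ ()) (λ ()) (λ ()) (λ ()) (λ ())
            (subst-edge (o i 0F (λ ()) (λ ())) (o k 0F (λ ()) (λ ())) e₁) (subst-edge (o j 0F (λ ()) (λ ())) (o k 1F (λ ()) (λ ())) e₂) e₃ e₄
        finish st o (inj₂ (refl , refl)) (inj₁ (refl , refl)) e₁ e₂ e₃ e₄ =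
          Contradiction.absurd tr noE st (λ ()) (λ ()) (λ ()) (λ ()) (λ ()) (λ ()) (λ ())
            (subst-edge (o i 0F (λ ()) (λ ())) (o k 1F (λ ()) (λ ())) e₁) (subst-edge (o j 0F (λ ()) (λ ())) (o k 0F (λ ()) (λ ())) e₂) e₃ e₄
        finish st o (inj₂ (refl , refl)) (inj₂ (refl , refl)) e₁ e₂ e₃ e₄ =
          Contradiction.absurd tr noE st (λ ()) (λ ()) (λ ()) (λ ()) (λ ()) (λ ()) (λ ())
            (subst-edge (o i 0F (λ ()) (λ ())) (o k 1F (λ ()) (λ ())) e₁) (subst-edge (o j 0F (λ ()) (λ ())) (o k 0F (λ ()) (λ ())) e₂) e₃ e₄

    edge : ∀ {i j k} → Tri i j k → ∀ β {S η} → Reached S η → length S + 20 ≤ u →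
      (∀ {S′ η′} → Reached S′ η′ → (∀ c s → proj₁ s ≢ β → η′ c s ≡ η c s) → length S′ ≤ length S + 20 →
        ∀ p q → b i j (η′ i (β , p)) (η′ j (β , q)) ≡ true → ⊥) → ⊥
    edge {i} {j} {k} tr β {S} {η} r l cont = Block.blocked-absurd β η (length S + 20) l tr unjoined
      (record { reached = r ; outside = λ _ _ _ → refl ; fuel = ≤-refl })
      where
      unjoined : Block.NoEdge β η (length S + 20) l i j
      unjoined st p q refl refl e = cont (Block.Q.reached st) (Block.Q.outside st) (≤-trans (m≤m+n _ _) (Block.Q.fuel st)) p q e

    -- The classes joined by the edge that is to be created in each block, followed by the third class.
    ends : Fin 6 → Fin 3 × Fin 3 × Fin 3
    ends 0F = c₁ , c₂ , c₃
    ends 1F = c₁ , c₂ , c₃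
    ends 2F = c₁ , c₃ , c₂
    ends 3F = c₁ , c₃ , c₂
    ends 4F = c₂ , c₃ , c₁
    ends 5F = c₂ , c₃ , c₁

    I J K : Fin 6 → Fin 3
    I β = proj₁ (ends β)
    J β = proj₁ (proj₂ (ends β))
    K β = proj₂ (proj₂ (ends β))

    ends-Tri : ∀ β → Tri (I β) (J β) (K β)
    ends-Tri 0F = t₁₂₃
    ends-Tri 1F = t₁₂₃
    ends-Tri 2F = t₁₃₂
    ends-Tri 3F = t₁₃₂
    ends-Tri 4F = t₂₃₁
    ends-Tri 5F = t₂₃₁

    HasEdge : Holes N → Fin 6 → Set
    HasEdge η β = ∃[ p ] ∃[ q ] b (I β) (J β) (η (I β) (β , p)) (η (J β) (β , q)) ≡ true

    -- Work in one block leaves the holes of the other blocks alone, so edges made earlier survive.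
    -- All six blocks use at most 120 positions, within the reserve of 200 in `Z-small`.
    create : ∀ n → n ≤ 6 → (∀ {S η} → Reached S η → length S ≤ length Z + 20 * n → (∀ β → Fin.toℕ β < n → HasEdge η β) → ⊥) → ⊥
    create zero _ cont = cont start (m≤m+n _ _) (λ _ ())
    create (suc n) n<6 cont = create n (≤-trans (n≤1+n n) n<6) λ {S} {η} r l has →
      edge (ends-Tri β₀) β₀ r (lin 4 (λ s z n u → (s :≤ z :+ 20 · n) ⇒ (con 1 :+ n :≤ con 6) ⇒ (z :+ con 200 :≤ u) ⇒ ⊢ s :+ con 20 :≤ u) (length S) (length Z) n u l n<6 Z-small)
        λ {S′} {η′} r′ same l′ p q e → cont r′
          (lin 4 (λ s s′ z n → (s :≤ z :+ 20 · n) ⇒ (s′ :≤ s :+ con 20) ⇒ ⊢ s′ :≤ z :+ 20 · (con 1 :+ n)) (length S) (length S′) (length Z) n l l′)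
          λ β β<1+n → extend has same p q e β β<1+n (β Fin.≟ β₀)
      where
      β₀ : Fin 6
      β₀ = Fin.fromℕ< n<6
      extend : ∀ {η η′} → (∀ β → Fin.toℕ β < n → HasEdge η β) → (∀ c s → proj₁ s ≢ β₀ → η′ c s ≡ η c s) → ∀ p q →
        b (I β₀) (J β₀) (η′ (I β₀) (β₀ , p)) (η′ (J β₀) (β₀ , q)) ≡ true → ∀ β → Fin.toℕ β < suc n → Dec (β ≡ β₀) → HasEdge η′ β
      extend has same p q e β _ (yes refl) = p , q , e
      extend {η} {η′} has same p q e β (s≤s β≤n) (no β≢) =
        let p′ , q′ , e′ = has β (≤∧≢⇒< β≤n λ x → β≢ (Fin.toℕ-injective (trans x (sym (Fin.toℕ-fromℕ< n<6))))) in
        p′ , q′ , transport (same (I β) (β , p′) β≢) (same (J β) (β , q′) β≢) e′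
        where
        transport : ∀ {i j v v′ w w′} → v′ ≡ v → w′ ≡ w → b i j v w ≡ true → b i j v′ w′ ≡ true
        transport refl refl e = e

    -- Six edges of holes in a non-extremal graph

    module SixEdges {S η} (r : Reached S η) (short : length S ≤ u) (has : ∀ β → HasEdge η β) where

      P₁ P₂ : Fin 6 → Slot
      P₁ β = β , proj₁ (has β)
      P₂ β = β , proj₁ (proj₂ (has β))

      joined : ∀ β → b (I β) (J β) (η (I β) (P₁ β)) (η (J β) (P₂ β)) ≡ true
      joined β = proj₂ (proj₂ (has β))

      A : Fin 6 → Fin N → Bool
      A β = two (I β) (J β) (K β) (η (I β) (P₁ β)) (η (J β) (P₂ β)) S

      A-large : ∀ β → m ≤ cnt (A β) + 3 * u
      A-large β = two-large (ends-Tri β) _ _ S short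

      -- The class whose holes the block provides.
      role : Fin 6 → Fin 3
      role 0F = c₁
      role 1F = c₂
      role 2F = c₁
      role 3F = c₃
      role 4F = c₂
      role 5F = c₃

      record Put (c : Fin 3) (x : Fin N) : Set where
        field
          β : Fin 6
          role≡ : role β ≡ c
          s : Slot
          s∈β : proj₁ s ≡ β
          put : ∀ {S′ η′} → Reached S′ η′ → (∀ c s → proj₁ s ≡ β → η′ c s ≡ η c s) → fresh S′ x ≡ true →
            ∃[ η″ ] Reached (x ∷ S′) η″ × η″ c s ≡ x × (∀ c s → proj₁ s ≢ β → η″ c s ≡ η′ c s)

      put-both : ∀ β {x} → A β x ≡ true → ∀ {S′ η′} → Reached S′ η′ → (∀ c s → proj₁ s ≡ β → η′ c s ≡ η c s) → fresh S′ x ≡ true →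
        ∃[ η″ ] Reached (x ∷ S′) η″ × (η″ (I β) (P₁ β) ≡ x × η″ (J β) (P₂ β) ≡ x) × (∀ c s → proj₁ s ≢ β → η″ c s ≡ η′ c s)
      put-both β {x} h {S′} {η′} r′ same f =
        let y , z = ∩-elim (proj₁ (∩-elim h))
            e₁ = same (I β) (P₁ β) refl
            e₂ = same (J β) (P₂ β) refl
        in upd (upd η′ (I β) (P₁ β) x) (J β) (P₂ β) x
          , move₂ r′ (ends-Tri β) (P₁ β) (P₂ β) f (trans (cong₂ (b (I β) (J β)) e₁ e₂) (joined β))
              (trans (cong (λ v → b (I β) (K β) v x) e₁) y) (trans (cong (λ v → b (J β) (K β) v x) e₂) z)
          , (trans (upd-class _ (≢₁₂ (ends-Tri β))) (upd-≡ η′ (I β) (P₁ β)) , upd-≡ _ (J β) (P₂ β))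
          , (λ c s n → trans (upd-slot _ (λ { refl → n refl })) (upd-slot η′ (λ { refl → n refl })))

      putˡ : ∀ β {x} → role β ≡ I β → A β x ≡ true → Put (I β) x
      putˡ β e h = record { β = β ; role≡ = e ; s = P₁ β ; s∈β = refl
        ; put = λ r same f → let η″ , r″ , (x , _) , o = put-both β h r same f in η″ , r″ , x , o }

      putʳ : ∀ β {x} → role β ≡ J β → A β x ≡ true → Put (J β) x
      putʳ β e h = record { β = β ; role≡ = e ; s = P₂ β ; s∈β = refl
        ; put = λ r same f → let η″ , r″ , (_ , x) , o = put-both β h r same f in η″ , r″ , x , o }

      -- Each class draws on one edge to each of the other two classes, and no block serves two
      -- classes; so vertices of `H₁`, `H₂` and `H₃` at distinct positions can be made holes
      -- simultaneously.
      H₁ H₂ H₃ : Fin N → Bool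
      H₁ = A 0F ∪ A 2F
      H₂ = A 1F ∪ A 4F
      H₃ = A 3F ∪ A 5F

      put₁ : ∀ {x} → H₁ x ≡ true → Put c₁ x
      put₁ h = [ putˡ 0F refl , putˡ 2F refl ]′ (∪-elim h)

      put₂ : ∀ {x} → H₂ x ≡ true → Put c₂ x
      put₂ h = [ putʳ 1F refl , putˡ 4F refl ]′ (∪-elim h)

      put₃ : ∀ {x} → H₃ x ≡ true → Put c₃ x
      put₃ h = [ putʳ 3F refl , putʳ 5F refl ]′ (∪-elim h)

      fresh-S : ∀ {f : Fin N → Bool} {x} → (f ∩ fresh S) x ≡ true → fresh S x ≡ true
      fresh-S h = proj₂ (∩-elim h)

      fresh₁ : ∀ {x} → H₁ x ≡ true → fresh S x ≡ true
      fresh₁ h = [ fresh-S , fresh-S ]′ (∪-elim h)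

      fresh₂ : ∀ {x} → H₂ x ≡ true → fresh S x ≡ true
      fresh₂ h = [ fresh-S , fresh-S ]′ (∪-elim h)

      fresh₃ : ∀ {x} → H₃ x ≡ true → fresh S x ≡ true
      fresh₃ h = [ fresh-S , fresh-S ]′ (∪-elim h)

      triangle-free : ∀ {x y z} → H₁ x ≡ true → H₂ y ≡ true → H₃ z ≡ true → y ≢ x → z ≢ x → z ≢ y →
        b c₁ c₂ x y ≡ true → b c₁ c₃ x z ≡ true → b c₂ c₃ y z ≡ true → ⊥
      triangle-free {x} {y} {z} hx hy hz y≢x z≢x z≢y xy xz yz =
        let module X = Put (put₁ hx)
            module Y = Put (put₂ hy)
            module Z = Put (put₃ hz)
            distinct : ∀ {c c′ β β′} → c ≢ c′ → role β ≡ c → role β′ ≡ c′ → β ≢ β′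
            distinct = λ { n e e′ refl → n (trans (sym e) e′) }
            X≢Y = distinct {c₁} {c₂} (λ ()) X.role≡ Y.role≡
            X≢Z = distinct {c₁} {c₃} (λ ()) X.role≡ Z.role≡
            Y≢Z = distinct {c₂} {c₃} (λ ()) Y.role≡ Z.role≡
            η¹ , r¹ , at-x , o¹ = X.put r (λ _ _ _ → refl) (fresh₁ hx)
            η² , r² , at-y , o² = Y.put r¹ (λ c s e → o¹ c s (λ e′ → X≢Y (trans (sym e′) e))) (fresh-∷ y≢x (fresh₂ hy))
            η³ , r³ , at-z , o³ = Z.put r² (λ c s e → trans (o² c s (λ e′ → Y≢Z (trans (sym e′) e))) (o¹ c s (λ e′ → X≢Z (trans (sym e′) e))))
              (fresh-∷ z≢y (fresh-∷ z≢x (fresh₃ hz)))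
            x³ = trans (o³ c₁ X.s (λ e → X≢Z (trans (sym X.s∈β) e))) (trans (o² c₁ X.s (λ e → X≢Y (trans (sym X.s∈β) e))) at-x)
            y³ = trans (o³ c₂ Y.s (λ e → Y≢Z (trans (sym Y.s∈β) e))) at-y
        in no-triangle r³ t₁₂₃ X.s Y.s Z.s
          (trans (cong₂ (b c₁ c₂) x³ y³) xy) (trans (cong₂ (b c₁ c₃) x³ at-z) xz) (trans (cong₂ (b c₂ c₃) y³ at-z) yz)

      -- Trading the first edge for `t` frees the vertex of class `j` at `t`, which is adjacent to
      -- both ends of the second edge, against `no-triangle`. So the two candidate sets of a class
      -- add up to about `2 m`.
      disjoint : ∀ {i j k} → Tri i j k → ∀ s s′ w w′ {t} → w ≢ s → b i j (η i s) (η j s′) ≡ true → b i k (η i w) (η k w′) ≡ true →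
        fresh S t ≡ true → b i k (η i s) t ≡ true → b j k (η j s′) t ≡ true → b i j (η i w) t ≡ true → b k j (η k w′) t ≡ true → ⊥
      disjoint {i} {j} {k} tr s s′ w w′ {t} w≢s e e′ f x y x′ y′ =
        no-triangle (move₂ r tr s s′ f e x y) tr w s′ w′ (trans (cong₂ (b i j) at-i at-j) x′) (trans (cong₂ (b i k) at-i at-k) e′)
          (trans (cong₂ (b j k) at-j at-k) (b-flip y′))
        where
        at-i : upd (upd η i s t) j s′ t i w ≡ η i w
        at-i = trans (upd-class _ (≢₁₂ tr)) (upd-slot η w≢s)
        at-j : upd (upd η i s t) j s′ t j s′ ≡ t
        at-j = upd-≡ _ j s′
        at-k : upd (upd η i s t) j s′ t k w′ ≡ η k w′
        at-k = trans (upd-class _ (λ e → ≢₂₃ tr (sym e))) (upd-class η (λ e → ≢₁₃ tr (sym e)))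

      parts : ∀ {f g : Fin N → Bool} {t} → ((f ∩ g) ∩ fresh S) t ≡ true → f t ≡ true × g t ≡ true × fresh S t ≡ true
      parts h = let xy , q = ∩-elim h ; x , y = ∩-elim xy in x , y , q

      large : ∀ β β′ → (∀ t → A β t ≡ true → A β′ t ≡ true → ⊥) → 2 * m ≤ cnt (A β ∪ A β′) + 6 * u
      large β β′ d = lin 5 (λ m u x y xy → (x :+ y :≤ xy) ⇒ (m :≤ x :+ 3 · u) ⇒ (m :≤ y :+ 3 · u) ⇒ ⊢ 2 · m :≤ xy :+ 6 · u)
        m u (cnt (A β)) (cnt (A β′)) _ (cnt-disjoint (λ _ → ∪-introˡ) (λ _ → ∪-introʳ) d) (A-large β) (A-large β′)

      H₁-large : 2 * m ≤ cnt H₁ + 6 * u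
      H₁-large = large 0F 2F λ t p q → let x , y , f = parts p ; x′ , y′ , _ = parts q in
        disjoint t₁₂₃ (P₁ 0F) (P₂ 0F) (P₁ 2F) (P₂ 2F) (λ ()) (joined 0F) (joined 2F) f x y x′ y′

      H₂-large : 2 * m ≤ cnt H₂ + 6 * u
      H₂-large = large 1F 4F λ t p q → let x , y , f = parts p ; x′ , y′ , _ = parts q in
        disjoint t₂₁₃ (P₂ 1F) (P₁ 1F) (P₁ 4F) (P₂ 4F) (λ ()) (b-flip (joined 1F)) (joined 4F) f y x x′ y′

      H₃-large : 2 * m ≤ cnt H₃ + 6 * u
      H₃-large = large 3F 5F λ t p q → let x , y , f = parts p ; x′ , y′ , _ = parts q in
        disjoint t₃₁₂ (P₂ 3F) (P₁ 3F) (P₂ 5F) (P₁ 5F) (λ ()) (b-flip (joined 3F)) (b-flip (joined 5F)) f y x y′ x′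

      link : ∀ {j} → c₁ ≢ j → ∀ (H : Fin N → Bool) → 2 * m ≤ cnt H + 6 * u → ∀ z → m ≤ cnt (H ∩ b c₁ j z) + 8 * u
      link {j} n H l z = lin 4 (λ m u h n → (2 · m :≤ h :+ 6 · u) ⇒ (h :≤ n :+ (m :+ u)) ⇒ ⊢ m :≤ n :+ 8 · u) m u (cnt H) (cnt (H ∩ b c₁ j z)) l (nb-large n H z)

      -- An edge here would complete a triangle of holes unless two of the three positions coincide.
      -- That leaves at most `2 N` edges at positions other than `z` and at most `N` at `z`; the
      -- bound `N-small` covers these `3 N`.
      link-sparse : ∀ z → H₁ z ≡ true → E (b c₂ c₃) (H₂ ∩ b c₁ c₂ z) (H₃ ∩ b c₁ c₃ z) ≤ u * u
      link-sparse z hz = lin 6 (λ e e₁ e₂ n x uu → (e :≤ e₁ :+ e₂) ⇒ (e₁ :≤ 2 · n) ⇒ (e₂ :≤ n :* x) ⇒ (n :* x :≤ n :* con 1) ⇒ (3 · n :≤ uu) ⇒ ⊢ e :≤ uu)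
          (E (b c₂ c₃) X Y) (E (b c₂ c₃) (X ∩ fresh (z ∷ [])) Y) (E (b c₂ c₃) (_== z) Y) N (cnt (_== z)) (u * u)
          (E-cover (b c₂ c₃) cover) (E-≤N (X ∩ fresh (z ∷ [])) Y 2 two-neighbours) (E-≤ (b c₂ c₃) N (λ _ _ → cnt≤n _)) (*-monoʳ-≤ N (cnt-== z)) N-small
        where
        X Y : Fin N → Bool
        X = H₂ ∩ b c₁ c₂ z
        Y = H₃ ∩ b c₁ c₃ z
        cover : ∀ y → X y ≡ true → (X ∩ fresh (z ∷ [])) y ≡ true ⊎ (y == z) ≡ true
        cover y h with bool? (y == z)
        ... | inj₁ q = inj₂ q
        ... | inj₂ q = inj₁ (∩-intro h (fresh-∷ (λ { refl → q (==-refl z) }) fresh-[]))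
        two-neighbours : ∀ y → (X ∩ fresh (z ∷ [])) y ≡ true → nb (b c₂ c₃) Y y ≤ 2
        two-neighbours y h = ≤-trans (cnt-cover {g = _== z} {_== y} only) (+-mono-≤ (cnt-== z) (cnt-== y))
          where
          only : ∀ w → (Y ∩ b c₂ c₃ y) w ≡ true → (w == z) ≡ true ⊎ (w == y) ≡ true
          only w q with bool? (w == z) | bool? (w == y)
          ... | inj₁ e | _ = inj₁ e
          ... | inj₂ _ | inj₁ e = inj₂ e
          ... | inj₂ n | inj₂ n′ =
            let hX , f = ∩-elim h ; y∈ , zy = ∩-elim hX ; hY , yw = ∩-elim q ; w∈ , zw = ∩-elim hY in
            ⊥-elim (triangle-free hz y∈ w∈ (fresh-head f) (λ { refl → n (==-refl z) }) (λ { refl → n′ (==-refl y) }) zy zw yw)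

      some-h : ∃[ h ] H₁ h ≡ true
      some-h = cnt-∃ H₁ (lin 3 (λ m u h → (2 · m :≤ h :+ 6 · u) ⇒ (1000 · u :≤ m) ⇒ (con 1 :≤ u) ⇒ ⊢ con 1 :≤ h) m u (cnt H₁) H₁-large u-small u-pos)

      h₀ : Fin N
      h₀ = proj₁ some-h

      module D = Dichotomy t₁₂₃ H₂ H₃ (H₂ ∩ b c₁ c₂ h₀) (H₃ ∩ b c₁ c₃ h₀) (λ _ q → proj₁ (∩-elim q)) (λ _ q → proj₁ (∩-elim q))
        (link (λ ()) H₂ H₂-large h₀) (link (λ ()) H₃ H₃-large h₀) (link-sparse h₀ (proj₂ some-h))
        (lin 3 (λ m u h → (2 · m :≤ h :+ 6 · u) ⇒ ⊢ 2 · m :≤ h :+ 8 · u) m u (cnt H₂) H₂-large)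

      -- With the neighbourhood of `h₀` as reference pair, every vertex of `H₁` is off or away,
      -- which leaves room for fewer than `2 m - 133 u` vertices.
      absurd : ⊥
      absurd = 1≰0 (lin 5 (λ m u h o w → (h :≤ o :+ w) ⇒ (o :+ 200 · u :< m) ⇒ (w :≤ m :+ 67 · u) ⇒ (2 · m :≤ h :+ 6 · u) ⇒ ⊢ con 1 :≤ con 0)
        m u (cnt H₁) (cnt D.off) (cnt D.away)
        (cnt-cover λ z hz → D.dichotomy z (link (λ ()) H₂ H₂-large z) (link (λ ()) H₃ H₃-large z) (link-sparse z hz))
        D.off-small D.away-small H₁-large)

    not-optimal : ⊥
    not-optimal = create 6 ≤-refl λ {S} r l has →
      SixEdges.absurd r (lin 3 (λ s z u → (s :≤ z :+ con 120) ⇒ (z :+ con 200 :≤ u) ⇒ ⊢ s :≤ u) (length S) (length Z) u l Z-small) (λ β → has β (Fin.toℕ<n β))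

-- Absorbers

opaque
  conj : List Bool → Bool
  conj [] = true
  conj (x ∷ xs) = x ∧ conj xs

  conj-intro : ∀ {xs} → All (_≡ true) xs → conj xs ≡ true
  conj-intro [] = refl
  conj-intro (p ∷ ps) = ∧-intro p (conj-intro ps)

  conj-elim : ∀ {xs} → conj xs ≡ true → All (_≡ true) xs
  conj-elim {[]} _ = []
  conj-elim {x ∷ xs} h = let p , q = ∧-elim {x} h in p ∷ conj-elim {xs} q

  disj : Bool → Bool → Bool
  disj = _∨_

  disj-introˡ : ∀ {x y} → x ≡ true → disj x y ≡ true
  disj-introˡ = ∨-introˡ

  disj-introʳ : ∀ {x y} → y ≡ true → disj x y ≡ true
  disj-introʳ = ∨-introʳ

  disj-elim : ∀ {x y} → disj x y ≡ true → x ≡ true ⊎ y ≡ true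
  disj-elim = ∨-elim

sumL : {A : Set} → List A → (A → ℕ) → ℕ
sumL [] f = 0
sumL (x ∷ xs) f = f x + sumL xs f

-- Counting with pigeonhole (`average`), kept abstract so that it passes through products and tuples
-- of many vertices need no separate treatment.
record FinSum (A : Set) : Set where
  field
    Σ : (A → ℕ) → ℕ
    size : ℕ
    mono : ∀ {f g} → (∀ x → f x ≤ g x) → Σ f ≤ Σ g
    add : ∀ f g → Σ (λ x → f x + g x) ≡ Σ f + Σ g
    scale : ∀ c f → Σ (λ x → c * f x) ≡ c * Σ f
    average : ∀ f → ∃[ x ] Σ f ≤ size * f x

  Σ-sumL : ∀ {B : Set} (xs : List B) (f : A → B → ℕ) → Σ (λ x → sumL xs (f x)) ≡ sumL xs (λ y → Σ (λ x → f x y))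
  Σ-sumL [] f = scale 0 (λ _ → 0)
  Σ-sumL (y ∷ ys) f = trans (add (λ x → f x y) (λ x → sumL ys (f x))) (cong (Σ (λ x → f x y) +_) (Σ-sumL ys f))

  -- One stage of a multiplicative count: nested uses bound the number of ways to choose the
  -- components of a tuple one after the other.
  at-least : ∀ (g : A → Bool) {f w q} → w ≤ Σ (λ x → b2n (g x)) → (∀ x → g x ≡ true → q ≤ f x) → w * q ≤ Σ f
  at-least g {f} {w} {q} h k = ≤-trans (*-monoˡ-≤ q h) (≤-trans (≤-reflexive (trans (*-comm _ q) (sym (scale q _)))) (mono λ x → lem x))
    where
    lem : ∀ x → q * b2n (g x) ≤ f x
    lem x with g x in eq
    ... | true = subst (_≤ f x) (sym (*-identityʳ q)) (k x eq)
    ... | false = subst (_≤ f x) (sym (*-zeroʳ q)) z≤n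

finSum : ∀ {N} → 1 ≤ N → FinSum (Fin N)
finSum {N} N-pos = record { Σ = sumFin N ; size = N ; mono = sum-mono ; add = sum-+ ; scale = sum-* ; average = average′ N-pos }
  where
  average′ : ∀ {N} → 1 ≤ N → ∀ (f : Fin N → ℕ) → ∃[ x ] sumFin N f ≤ N * f x
  average′ {suc n} _ = some-above-average n

infixr 2 _⊗_
_⊗_ : ∀ {A B} → FinSum A → FinSum B → FinSum (A × B)
F ⊗ G = record
  { Σ = λ f → F.Σ λ x → G.Σ λ y → f (x , y)
  ; size = F.size * G.size
  ; mono = λ h → F.mono λ x → G.mono λ y → h (x , y)
  ; add = λ f g → trans (≤-antisym (F.mono λ x → ≤-reflexive (G.add _ _)) (F.mono λ x → ≤-reflexive (sym (G.add _ _)))) (F.add _ _)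
  ; scale = λ c f → trans (≤-antisym (F.mono λ x → ≤-reflexive (G.scale c _)) (F.mono λ x → ≤-reflexive (sym (G.scale c _)))) (F.scale c _)
  ; average = λ f → let x , p = F.average (λ x → G.Σ λ y → f (x , y)) ; y , q = G.average (λ y → f (x , y)) in
      (x , y) , ≤-trans p (≤-trans (*-monoʳ-≤ F.size q) (≤-reflexive (sym (*-assoc F.size G.size _))))
  }
  where
  module F = FinSum F
  module G = FinSum G

fifth : ℕ → ℕ
fifth x = x * (x * (x * (x * x)))

-- A unit has 18 = 3 + 3 · 5 vertices; the bracketing follows that of `units`.
eighteenth : ℕ → ℕ
eighteenth x = x * (x * (x * (fifth x * (fifth x * fifth x))))

-- Counting exchanges and absorbing units

module Connectors {N m u : ℕ} {a : Fin 3 → Fin 3 → Fin N → Fin N → Bool} (nonextremal : Nonextremal m u a)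
  (w : ℕ) (w-pairs : w * N + w * N + w * w ≤ u * u) (w-small : 2 * w ≤ u) (N-pos : 1 ≤ N) where
  open Nonextremal nonextremal
  open Neighbourhoods nonextremal

  V : FinSum (Fin N)
  V = finSum N-pos

  Conn : Set
  Conn = Fin N × Fin N × Fin N × Fin N × Fin N

  conns : FinSum Conn
  conns = V ⊗ V ⊗ V ⊗ V ⊗ V

  open FinSum

  opaque
    unfolding cnt E

    at-least-cnt : ∀ g {f w q} → w ≤ cnt g → (∀ x → g x ≡ true → q ≤ f x) → w * q ≤ Σ V f
    at-least-cnt = at-least V

    at-least-E : ∀ r X Y {f : Fin N → Fin N → ℕ} {w q} → w ≤ E r X Y → (∀ x y → X x ≡ true → Y y ≡ true → r x y ≡ true → q ≤ f x y) →
      w * q ≤ Σ V (λ x → Σ V (f x))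
    at-least-E r X Y h k = at-least (V ⊗ V) (λ { (x , y) → X x ∧ Y y ∧ r x y }) h
      λ { (x , y) p → let q , s = ∧-elim {X x} p ; s , t = ∧-elim {Y y} s in k x y q s t }

  trim : ∀ i j X Y L → length L ≤ w → E (a i j) X Y ≤ E (a i j) (X ∩ fresh L) Y + w * N
  trim i j X Y L l = ≤-trans (E-cover (a i j) {X₂ = full ∖ fresh L} cover)
    (+-monoʳ-≤ _ (≤-trans (E-≤ (a i j) N λ _ _ → cnt≤n _) (≤-trans (*-monoʳ-≤ N (≤-trans (cnt-stale′ L) l)) (≤-reflexive (*-comm N w)))))
    where
    cover : ∀ x → X x ≡ true → (X ∩ fresh L) x ≡ true ⊎ (full ∖ fresh L) x ≡ true
    cover x h with bool? (fresh L x)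
    ... | inj₁ p = inj₁ (∩-intro h p)
    ... | inj₂ p = inj₂ (∖-intro refl p)

  -- Forbidding at most `w` vertices on each side destroys at most `2 w N` of the more than `u * u`
  -- edges; `w-pairs` is chosen to leave `w * w`.
  pairs : ∀ {i j k} x z Lⱼ Lₖ → reach i j k x z ≡ true → length Lⱼ ≤ w → length Lₖ ≤ w →
    w * w ≤ E (a j k) ((a i j x ∩ a i j z) ∩ fresh Lⱼ) ((a i k x ∩ a i k z) ∩ fresh Lₖ)
  pairs {i} {j} {k} x z Lⱼ Lₖ r lⱼ lₖ = lin 7 (λ uu e e₁ e₁′ e₂ wN ww → (uu :< e) ⇒ (e :≤ e₁ :+ wN) ⇒ (e₁ :≤ e₁′) ⇒ (e₁′ :≤ e₂ :+ wN) ⇒ (wN :+ wN :+ ww :≤ uu) ⇒ ⊢ ww :≤ e₂)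
    (u * u) (E (a j k) X Y) (E (a j k) X′ Y) (E (a k j) Y X′) (E (a j k) X′ Y′) (w * N) (w * w)
    (above-elim r) (trim j k X Y Lⱼ lⱼ) (≤-reflexive (E-sym j k X′ Y))
    (subst (λ e → E (a k j) Y X′ ≤ e + w * N) (E-sym k j Y′ X′) (trim k j Y X′ Lₖ lₖ)) w-pairs
    where
    X Y X′ Y′ : Fin N → Bool
    X = a i j x ∩ a i j z
    Y = a i k x ∩ a i k z
    X′ = X ∩ fresh Lⱼ
    Y′ = Y ∩ fresh Lₖ

  many-fresh : ∀ {f : Fin N → Bool} L → length L ≤ w → m ≤ cnt f + 2 * u → w ≤ cnt (f ∩ fresh L)
  many-fresh {f} L l h = lin 6 (λ f c l w u m → (f :≤ c :+ l) ⇒ (l :≤ w) ⇒ (m :≤ f :+ 2 · u) ⇒ (2 · w :≤ u) ⇒ (1000 · u :≤ m) ⇒ (con 1 :≤ u) ⇒ ⊢ w :≤ c)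
    (cnt f) _ (length L) w u m (cnt-fresh f L) l h w-small u-small u-pos

  many-any : ∀ L → length L ≤ w → w ≤ cnt (full ∩ fresh L)
  many-any L l = many-fresh L l (lin 4 (λ m N f u → (3 · m :≤ N) ⇒ (N :≤ f) ⇒ ⊢ m :≤ f :+ 2 · u) m N (cnt {N} full) u (≤-reflexive (sym N≡3m)) (≤-reflexive (sym (cnt-all N))))

  many-adjacent : ∀ {i j} → i ≢ j → ∀ x L → length L ≤ w → w ≤ cnt (a i j x ∩ fresh L)
  many-adjacent {i} {j} n x L l = many-fresh L l (lin 3 (λ m d u → (2 · m :≤ d :+ u) ⇒ ⊢ m :≤ d :+ 2 · u) m (cnt (a i j x)) u (degree n x))

  many-common : ∀ {i j k} → Tri i j k → ∀ x y L → length L ≤ w → w ≤ cnt ((a i k x ∩ a j k y) ∩ fresh L)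
  many-common {i} {j} {k} t x y L l = many-fresh L l
    (lin 6 (λ m u N p q c → (p :+ q :≤ N :+ c) ⇒ (2 · m :≤ p :+ u) ⇒ (2 · m :≤ q :+ u) ⇒ (N :≤ 3 · m) ⇒ ⊢ m :≤ c :+ 2 · u)
      m u N (cnt (a i k x)) (cnt (a j k y)) (cnt (a i k x ∩ a j k y)) (inter (a i k x) (a j k y)) (degree (≢₁₃ t) x) (degree (≢₂₃ t) y) (≤-reflexive N≡3m))

  Lists : Set
  Lists = List (Fin N)

  -- The triangles (z , b , c) and (y , b′ , c′) let x be exchanged for y, via z or directly.
  conn : (i j k : Fin 3) (Lᵢ Lⱼ Lₖ : Lists) (x y : Fin N) → Conn → Bool
  conn i j k Lᵢ Lⱼ Lₖ x y (z , b , c , b′ , c′) = conj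
    (fresh Lᵢ z ∷ fresh Lⱼ b ∷ fresh Lₖ c ∷ fresh (b ∷ Lⱼ) b′ ∷ fresh (c ∷ Lₖ) c′ ∷
     a i j z b ∷ a i k z c ∷ a j k b c ∷ a i j y b′ ∷ a i k y c′ ∷ a j k b′ c′ ∷
     disj (conj (a i j x b ∷ a i k x c ∷ a i j z b′ ∷ a i k z c′ ∷ [])) (conj (a i j x b′ ∷ a i k x c′ ∷ [])) ∷ [])

  -- If `y` is reached from `x` directly, the triangle (`z`, `b`, `c`) is mere padding, which gives
  -- both kinds of connectors the same shape. Otherwise `many-reach-both` supplies `z`.
  conn-many : ∀ {i j k} → Tri i j k → ∀ Lᵢ Lⱼ Lₖ x y → length Lᵢ < w → length Lⱼ < w → length Lₖ < w →
    w * (w * (w * (w * w))) ≤ Σ conns (λ κ → b2n (conn i j k Lᵢ Lⱼ Lₖ x y κ))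
  conn-many {i} {j} {k} t Lᵢ Lⱼ Lₖ x y lᵢ lⱼ lₖ with bool? (reach i j k x y)
  ... | inj₁ r = at-least-cnt (full ∩ fresh Lᵢ) (many-any Lᵢ (<⇒≤ lᵢ)) λ z hz → let _ , fz = ∩-elim hz in
      at-least-cnt (a i j z ∩ fresh Lⱼ) (many-adjacent (≢₁₂ t) z Lⱼ (<⇒≤ lⱼ)) λ b hb → let zb , fb = ∩-elim hb in
      at-least-cnt ((a i k z ∩ a j k b) ∩ fresh Lₖ) (many-common t z b Lₖ (<⇒≤ lₖ)) λ c hc → let zbc , fc = ∩-elim hc ; zc , bc = ∩-elim zbc in
      ≤-trans (≤-reflexive (sym (*-identityʳ (w * w)))) (at-least-E (a j k) ((a i j x ∩ a i j y) ∩ fresh (b ∷ Lⱼ)) ((a i k x ∩ a i k y) ∩ fresh (c ∷ Lₖ)) (pairs x y (b ∷ Lⱼ) (c ∷ Lₖ) r lⱼ lₖ)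
        λ b′ c′ hb′ hc′ b′c′ → let xyb , fb′ = ∩-elim hb′ ; xb′ , yb′ = ∩-elim xyb ; xyc , fc′ = ∩-elim hc′ ; xc′ , yc′ = ∩-elim xyc in
        indicator (conj-intro (fz ∷ fb ∷ fc ∷ fb′ ∷ fc′ ∷ zb ∷ zc ∷ bc ∷ yb′ ∷ yc′ ∷ b′c′ ∷ disj-introʳ (conj-intro (xb′ ∷ xc′ ∷ [])) ∷ [])))
    where
    indicator : ∀ {q} → q ≡ true → 1 ≤ b2n q
    indicator refl = ≤-refl
  ... | inj₂ r = ≤-trans (≤-reflexive (cong (w *_) (trans (sym (*-assoc w w (w * w))) refl))) (
      at-least-cnt ((reach i j k x ∩ reach i j k y) ∩ fresh Lᵢ) (reachable (many-reach-both t x y r)) λ z hz → let rr , fz = ∩-elim hz ; rx , ry = ∩-elim rr in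
      at-least-E (a j k) ((a i j x ∩ a i j z) ∩ fresh Lⱼ) ((a i k x ∩ a i k z) ∩ fresh Lₖ) (pairs x z Lⱼ Lₖ rx (<⇒≤ lⱼ) (<⇒≤ lₖ))
        λ b c hb hc bc → let xzb , fb = ∩-elim hb ; xb , zb = ∩-elim xzb ; xzc , fc = ∩-elim hc ; xc , zc = ∩-elim xzc in
      ≤-trans (≤-reflexive (sym (*-identityʳ (w * w)))) (at-least-E (a j k) ((a i j y ∩ a i j z) ∩ fresh (b ∷ Lⱼ)) ((a i k y ∩ a i k z) ∩ fresh (c ∷ Lₖ)) (pairs y z (b ∷ Lⱼ) (c ∷ Lₖ) ry lⱼ lₖ)
        λ b′ c′ hb′ hc′ b′c′ → let yzb , fb′ = ∩-elim hb′ ; yb′ , zb′ = ∩-elim yzb ; yzc , fc′ = ∩-elim hc′ ; yc′ , zc′ = ∩-elim yzc in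
        indicator (conj-intro (fz ∷ fb ∷ fc ∷ fb′ ∷ fc′ ∷ zb ∷ zc ∷ bc ∷ yb′ ∷ yc′ ∷ b′c′ ∷ disj-introˡ (conj-intro (xb ∷ xc ∷ zb′ ∷ zc′ ∷ [])) ∷ []))))
    where
    indicator : ∀ {q} → q ≡ true → 1 ≤ b2n q
    indicator refl = ≤-refl
    reachable : u ≤ cnt (reach i j k x ∩ reach i j k y) → w ≤ cnt ((reach i j k x ∩ reach i j k y) ∩ fresh Lᵢ)
    reachable h = lin 5 (λ f c l w u → (f :≤ c :+ l) ⇒ (con 1 :+ l :≤ w) ⇒ (u :≤ f) ⇒ (2 · w :≤ u) ⇒ ⊢ w :≤ c)
      (cnt (reach i j k x ∩ reach i j k y)) _ (length Lᵢ) w u (cnt-fresh _ Lᵢ) lᵢ h w-small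

  Unit : Set
  Unit = Fin N × Fin N × Fin N × Conn × Conn × Conn

  units : FinSum Unit
  units = V ⊗ V ⊗ V ⊗ conns ⊗ conns ⊗ conns

  -- The triangle `y₁ y₂ y₃` is not one of the six reserved ones: its vertices lie in three
  -- different ones, and it arises at the position of `x` once each entry of `x` has been exchanged
  -- for the corresponding `y`. The growing lists keep all 18 vertices apart.
  unit : (Fin 3 → Lists) → (Fin 3 → Fin N) → Unit → Bool
  unit L x (y₁ , y₂ , y₃ , κ₁@(z₁ , b₁ , d₁ , b₁′ , d₁′) , κ₂@(z₂ , b₂ , d₂ , b₂′ , d₂′) , κ₃) = conj
    (fresh (L c₁) y₁ ∷ fresh (L c₂) y₂ ∷ fresh (L c₃) y₃ ∷ a c₁ c₂ y₁ y₂ ∷ a c₁ c₃ y₁ y₃ ∷ a c₂ c₃ y₂ y₃ ∷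
     conn c₁ c₂ c₃ (y₁ ∷ L c₁) (y₂ ∷ L c₂) (y₃ ∷ L c₃) (x c₁) y₁ κ₁ ∷
     conn c₂ c₁ c₃ (b₁′ ∷ b₁ ∷ y₂ ∷ L c₂) (z₁ ∷ y₁ ∷ L c₁) (d₁′ ∷ d₁ ∷ y₃ ∷ L c₃) (x c₂) y₂ κ₂ ∷
     conn c₃ c₁ c₂ (d₂′ ∷ d₂ ∷ d₁′ ∷ d₁ ∷ y₃ ∷ L c₃) (b₂′ ∷ b₂ ∷ z₁ ∷ y₁ ∷ L c₁) (z₂ ∷ b₁′ ∷ b₁ ∷ y₂ ∷ L c₂) (x c₃) y₃ κ₃ ∷ [])

  module _ (L : Fin 3 → Lists) (short : ∀ c → length (L c) + 18 ≤ w) where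

    private
      room : ∀ c n → n ≤ 17 → n + length (L c) < w
      room c n h = lin 3 (λ n l w → (l :+ con 18 :≤ w) ⇒ (n :≤ con 17) ⇒ ⊢ n :+ l :< w) n (length (L c)) w (short c) h

      slack : ∀ c → length (L c) ≤ w
      slack c = ≤-trans (m≤m+n _ 18) (short c)

      le : ∀ n → {_ : T (n ≤ᵇ 17)} → n ≤ 17
      le n {h} = ≤ᵇ⇒≤ n 17 h

    unit-many : ∀ x → eighteenth w ≤ Σ units (λ ω → b2n (unit L x ω))
    unit-many x =
      at-least-cnt (full ∩ fresh (L c₁)) (many-any (L c₁) (slack c₁)) λ y₁ h₁ → let _ , f₁ = ∩-elim h₁ in
      at-least-cnt (a c₁ c₂ y₁ ∩ fresh (L c₂)) (many-adjacent (λ ()) y₁ (L c₂) (slack c₂)) λ y₂ h₂ → let y₁₂ , f₂ = ∩-elim h₂ in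
      at-least-cnt ((a c₁ c₃ y₁ ∩ a c₂ c₃ y₂) ∩ fresh (L c₃)) (many-common t₁₂₃ y₁ y₂ (L c₃) (slack c₃)) λ y₃ h₃ → let y₃₃ , f₃ = ∩-elim h₃ ; y₁₃ , y₂₃ = ∩-elim y₃₃ in
      at-least conns (conn c₁ c₂ c₃ (y₁ ∷ L c₁) (y₂ ∷ L c₂) (y₃ ∷ L c₃) (x c₁) y₁)
        (conn-many t₁₂₃ (y₁ ∷ L c₁) (y₂ ∷ L c₂) (y₃ ∷ L c₃) (x c₁) y₁ (room c₁ 1 (le 1)) (room c₂ 1 (le 1)) (room c₃ 1 (le 1)))
        λ { κ₁@(z₁ , b₁ , d₁ , b₁′ , d₁′) k₁ →
      at-least conns (conn c₂ c₁ c₃ (b₁′ ∷ b₁ ∷ y₂ ∷ L c₂) (z₁ ∷ y₁ ∷ L c₁) (d₁′ ∷ d₁ ∷ y₃ ∷ L c₃) (x c₂) y₂)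
        (conn-many t₂₁₃ (b₁′ ∷ b₁ ∷ y₂ ∷ L c₂) (z₁ ∷ y₁ ∷ L c₁) (d₁′ ∷ d₁ ∷ y₃ ∷ L c₃) (x c₂) y₂ (room c₂ 3 (le 3)) (room c₁ 2 (le 2)) (room c₃ 3 (le 3)))
        λ { κ₂@(z₂ , b₂ , d₂ , b₂′ , d₂′) k₂ →
      ≤-trans (≤-reflexive (sym (*-identityʳ (fifth w)))) (at-least conns (conn c₃ c₁ c₂ (d₂′ ∷ d₂ ∷ d₁′ ∷ d₁ ∷ y₃ ∷ L c₃) (b₂′ ∷ b₂ ∷ z₁ ∷ y₁ ∷ L c₁) (z₂ ∷ b₁′ ∷ b₁ ∷ y₂ ∷ L c₂) (x c₃) y₃)
        (conn-many t₃₁₂ (d₂′ ∷ d₂ ∷ d₁′ ∷ d₁ ∷ y₃ ∷ L c₃) (b₂′ ∷ b₂ ∷ z₁ ∷ y₁ ∷ L c₁) (z₂ ∷ b₁′ ∷ b₁ ∷ y₂ ∷ L c₂) (x c₃) y₃ (room c₃ 5 (le 5)) (room c₁ 4 (le 4)) (room c₂ 4 (le 4)))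
        λ κ₃ k₃ → indicator (conj-intro (f₁ ∷ f₂ ∷ f₃ ∷ y₁₂ ∷ y₁₃ ∷ y₂₃ ∷ k₁ ∷ k₂ ∷ k₃ ∷ []))) } }
      where
      indicator : ∀ {q} → q ≡ true → 1 ≤ b2n q
      indicator refl = ≤-refl

    module _ (θ : ℕ) (N≤θw : N ≤ θ * w) (w-pos : 1 ≤ w) where

      private
        fifth-mono : ∀ {x y} → x ≤ y → fifth x ≤ fifth y
        fifth-mono h = *-mono-≤ h (*-mono-≤ h (*-mono-≤ h (*-mono-≤ h h)))

        units-size : size units ≤ eighteenth θ * eighteenth w
        units-size = ≤-trans (*-mono-≤ N≤θw (*-mono-≤ N≤θw (*-mono-≤ N≤θw (*-mono-≤ (fifth-mono N≤θw) (*-mono-≤ (fifth-mono N≤θw) (fifth-mono N≤θw))))))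
          (≤-reflexive (trans (cong (λ f → θ * w * (θ * w * (θ * w * (f * (f * f))))) (fifth-* θ w)) (regroup θ w (fifth θ) (fifth w))))
          where
          fifth-* : ∀ x y → x * y * (x * y * (x * y * (x * y * (x * y)))) ≡ x * (x * (x * (x * x))) * (y * (y * (y * (y * y))))
          fifth-* = solve-∀
          regroup : ∀ x y p q → x * y * (x * y * (x * y * (p * q * (p * q * (p * q))))) ≡ x * (x * (x * (p * (p * p)))) * (y * (y * (y * (q * (q * q)))))
          regroup = solve-∀

        fifth-pos : ∀ {x} → 1 ≤ x → 1 ≤ fifth x
        fifth-pos h = *-mono-≤ h (*-mono-≤ h (*-mono-≤ h (*-mono-≤ h h)))

        eighteenth-pos : 1 ≤ eighteenth w
        eighteenth-pos = *-mono-≤ w-pos (*-mono-≤ w-pos (*-mono-≤ w-pos (*-mono-≤ (fifth-pos w-pos) (*-mono-≤ (fifth-pos w-pos) (fifth-pos w-pos)))))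

        sumL-≥ : ∀ {A : Set} (xs : List A) {f : A → ℕ} q → (∀ x → q ≤ f x) → length xs * q ≤ sumL xs f
        sumL-≥ [] q h = z≤n
        sumL-≥ (x ∷ xs) q h = +-mono-≤ (h x) (sumL-≥ xs q h)

      -- Each triple is served by at least `eighteenth w` of at most `eighteenth θ * eighteenth w`
      -- candidates, so an average candidate serves the fraction 1 / `eighteenth θ` of `xs`.
      hitting-unit : ∀ {A : Set} (xs : List A) (f : A → Fin 3 → Fin N) → ∃[ ω ] length xs ≤ eighteenth θ * sumL xs (λ x → b2n (unit L (f x) ω))
      hitting-unit xs f =
        let ω , h = average units (λ ω → sumL xs (λ x → b2n (unit L (f x) ω))) in
        ω , *-cancelʳ-≤ _ _ (eighteenth w) ⦃ >-nonZero eighteenth-pos ⦄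
          (≤-trans (≤-trans (sumL-≥ xs (eighteenth w) (λ x → unit-many (f x))) (≤-trans (≤-reflexive (sym (Σ-sumL units xs _))) h))
            (≤-trans (*-monoˡ-≤ _ units-size) (≤-reflexive (swap-last (eighteenth θ) (eighteenth w) _))))
        where
        swap-last : ∀ x y z → x * y * z ≡ x * z * y
        swap-last = solve-∀

-- Reserving the triangles of a unit and absorbing with them

data Chain {N : ℕ} : List (Fin N) → List (Fin N) → Set where
  [] : ∀ {L} → Chain [] L
  _∷_ : ∀ {x xs L} → fresh (xs ++ L) x ≡ true → Chain xs L → Chain (x ∷ xs) L

-- Within each class `unit` selects the vertices in an order different from that in which the
-- triangles are placed.
chain-↭ : ∀ {N} {xs ys L : List (Fin N)} → xs ↭ ys → Chain xs L → Chain ys L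
chain-↭ ↭.refl ch = ch
chain-↭ {L = L} (↭.prep x p) (f ∷ ch) = fresh-weaken (∈-resp-↭ (++⁺ʳ L (↭.↭-sym p))) f ∷ chain-↭ p ch
chain-↭ {L = L} (↭.swap x y p) (f ∷ g ∷ ch) =
  fresh-∷ (λ e → fresh-head f (sym e)) (fresh-weaken (∈-resp-↭ (++⁺ʳ L (↭.↭-sym p))) g)
    ∷ fresh-weaken (∈-resp-↭ (++⁺ʳ L (↭.↭-sym p))) (fresh-tail f) ∷ chain-↭ p ch
chain-↭ (↭.trans p q) ch = chain-↭ q (chain-↭ p ch)

listed : ∀ {N} → State N → List (Fin N) → Fin 3 → List (Fin N)
listed σ P c = map (vert σ c) P

Agree : ∀ {N} → List (Fin N) → State N → State N → Set
Agree P σ τ = ∀ {p} → p ∈ P → ∀ c → vert τ c p ≡ vert σ c p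

record Added {N : ℕ} (σ : State N) (P : List (Fin N)) (v : Fin 3 → Fin N) : Set where
  field
    σ′ : State N
    p : Fin N
    agree : Agree P σ σ′
    new : ∀ {q} → q ∈ P → p ≢ q
    at-p : ∀ c → vert σ′ c p ≡ v c

add-triangle : ∀ {N} (σ : State N) P v → (∀ c → fresh (listed σ P c) (v c) ≡ true) → Added σ P v
add-triangle σ P v f = record { σ′ = σ² ; p = p ; agree = agree ; new = λ h e → off-p c₁ h (sym (trans (cong (vert σ c₁) (sym e)) (inverseʳ (σ c₁)))) ; at-p = at-p }
  where
  q₂ q₃ p : Fin _
  p = σ c₁ ⟨$⟩ˡ v c₁
  q₂ = σ c₂ ⟨$⟩ˡ v c₂
  q₃ = σ c₃ ⟨$⟩ˡ v c₃
  σ¹ σ² : State _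
  σ¹ = swapAt σ c₂ p q₂
  σ² = swapAt σ¹ c₃ p q₃
  off-p : ∀ c {q} → q ∈ P → v c ≢ vert σ c q
  off-p c h = fresh-∈ (f c) (∈-map⁺ (vert σ c) h)
  ≢p : ∀ {q} → q ∈ P → q ≢ p
  ≢p h refl = off-p c₁ h (sym (inverseʳ (σ c₁)))
  ≢q₂ : ∀ {q} → q ∈ P → q ≢ q₂
  ≢q₂ h refl = off-p c₂ h (sym (inverseʳ (σ c₂)))
  ≢q₃ : ∀ {q} → q ∈ P → q ≢ q₃
  ≢q₃ h refl = off-p c₃ h (sym (inverseʳ (σ c₃)))
  agree : Agree P σ σ²
  agree h c = trans (swap-pos σ¹ c₃ c (≢p h) (≢q₃ h)) (swap-pos σ c₂ c (≢p h) (≢q₂ h))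
  at-p : ∀ c → vert σ² c p ≡ v c
  at-p c₁ = trans (swap-class σ¹ p q₃ p (λ ())) (trans (swap-class σ p q₂ p (λ ())) (inverseʳ (σ c₁)))
  at-p c₂ = trans (swap-class σ¹ p q₃ p (λ ())) (trans (swap-ˡ σ c₂ p q₂) (inverseʳ (σ c₂)))
  at-p c₃ = trans (swap-ˡ σ¹ c₃ p q₃) (trans (swap-class σ p q₂ q₃ (λ ())) (inverseʳ (σ c₃)))

record AddedAll {N : ℕ} (σ : State N) (P : List (Fin N)) (vs : List (Fin 3 → Fin N)) : Set where
  field
    σ′ : State N
    ps : List (Fin N)
    agree : Agree P σ σ′
    distinct : AllPairs _≢_ ps
    new : All (λ p → ∀ {q} → q ∈ P → p ≢ q) ps
    at-ps : Pointwise (λ p v → ∀ c → vert σ′ c p ≡ v c) ps vs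

add-triangles : ∀ {N} (σ : State N) P vs → (∀ c → Chain (map (λ v → v c) vs) (listed σ P c)) → AddedAll σ P vs
add-triangles σ P [] ch = record { σ′ = σ ; ps = [] ; agree = λ _ _ → refl ; distinct = [] ; new = [] ; at-ps = [] }
add-triangles {N} σ P (v ∷ vs) ch = record
  { σ′ = B.σ′ ; ps = B.p ∷ A.ps
  ; agree = λ h c → trans (B.agree (∈-++⁺ʳ A.ps h) c) (A.agree h c)
  ; distinct = All.tabulate (λ h → B.new (∈-++⁺ˡ h)) ∷ A.distinct
  ; new = (λ h → B.new (∈-++⁺ʳ A.ps h)) ∷ A.new
  ; at-ps = B.at-p ∷ keep A.at-ps (λ h c → B.agree (∈-++⁺ˡ h) c) }
  where
  head-fresh : ∀ c → fresh (map (λ v → v c) vs ++ listed σ P c) (v c) ≡ true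
  head-fresh c with ch c
  ... | f ∷ _ = f
  tail-chain : ∀ c → Chain (map (λ v → v c) vs) (listed σ P c)
  tail-chain c with ch c
  ... | _ ∷ t = t
  module A = AddedAll (add-triangles σ P vs tail-chain)
  column : ∀ {ps vs} c → Pointwise (λ p v → ∀ c → vert A.σ′ c p ≡ v c) ps vs → map (vert A.σ′ c) ps ≡ map (λ v → v c) vs
  column c [] = refl
  column c (e ∷ es) = cong₂ _∷_ (e c) (column c es)
  lists : ∀ c → listed A.σ′ (A.ps ++ P) c ≡ map (λ v → v c) vs ++ listed σ P c
  lists c = trans (map-++ (vert A.σ′ c) A.ps P) (cong₂ _++_ (column c A.at-ps) (map-cong-local (All.tabulate λ h → A.agree h c)))
  module B = Added (add-triangle A.σ′ (A.ps ++ P) v (λ c → subst (λ l → fresh l (v c) ≡ true) (sym (lists c)) (head-fresh c)))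
  keep : ∀ {ps vs} → Pointwise (λ p v → ∀ c → vert A.σ′ c p ≡ v c) ps vs → (∀ {p} → p ∈ ps → ∀ c → vert B.σ′ c p ≡ vert A.σ′ c p) →
    Pointwise (λ p v → ∀ c → vert B.σ′ c p ≡ v c) ps vs
  keep [] h = []
  keep (e ∷ es) h = (λ c → trans (h (here refl) c) (e c)) ∷ keep es (λ q → h (there q))

module Absorption {N m u : ℕ} {a : Fin 3 → Fin 3 → Fin N → Fin N → Bool} (nonextremal : Nonextremal m u a)
  (w : ℕ) (w-pairs : w * N + w * N + w * w ≤ u * u) (w-small : 2 * w ≤ u) (N-pos : 1 ≤ N)
  (θ : ℕ) (N≤θw : N ≤ θ * w) (w-pos : 1 ≤ w) where
  open Nonextremal nonextremal using (a-sym)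
  open Connectors nonextremal w w-pairs w-small N-pos
  open Triangles a a-sym

  record Relay (i : Fin 3) (τ : State N) (d p p′ : Fin N) (y : Fin N) : Set where
    field
      τ′ : State N
      same-class : ∀ {c} → c ≢ i → ∀ q → vert τ′ c q ≡ vert τ c q
      same-pos : ∀ {q} → q ≢ d → q ≢ p → q ≢ p′ → ∀ c → vert τ′ c q ≡ vert τ c q
      at-d : vert τ′ i d ≡ y
      good-p : bad τ′ p ≡ false
      good-p′ : bad τ′ p′ ≡ false

  -- In the first alternative `x` replaces `z` at `p`, and `z` replaces `y` at `p′`; in the second
  -- `x` replaces `y` at once and `p` keeps its triangle. Either way `y` arrives at `d`.
  relay : ∀ {i j k} → Tri i j k → ∀ τ {d p p′ x y z b c b′ c′} → p ≢ d → p′ ≢ d → p ≢ p′ →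
    vert τ i d ≡ x → vert τ i p ≡ z → vert τ j p ≡ b → vert τ k p ≡ c → vert τ i p′ ≡ y → vert τ j p′ ≡ b′ → vert τ k p′ ≡ c′ →
    a i j z b ≡ true → a i k z c ≡ true → a j k b c ≡ true → a j k b′ c′ ≡ true →
    (a i j x b ≡ true × a i k x c ≡ true × a i j z b′ ≡ true × a i k z c′ ≡ true) ⊎ (a i j x b′ ≡ true × a i k x c′ ≡ true) →
    Relay i τ d p p′ y
  relay {i} {j} {k} t τ {d} {p} {p′} p≢d p′≢d p≢p′ refl refl refl refl refl refl refl zb zc bc b′c′ (inj₁ (xb , xc , zb′ , zc′)) = record
    { τ′ = τ²
    ; same-class = λ n q → trans (swap-class τ¹ d p′ q n) (swap-class τ d p q n)
    ; same-pos = λ n₁ n₂ n₃ c → trans (swap-pos τ¹ i c n₁ n₃) (swap-pos τ i c n₁ n₂)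
    ; at-d = trans (swap-ˡ τ¹ i d p′) (swap-pos τ i i p′≢d (λ e → p≢p′ (sym e)))
    ; good-p = good-intro {τ²} {p} t (edge at-p (off (≢₁₂ t)) xb) (edge at-p (off (≢₁₃ t)) xc) (edge (off (≢₁₂ t)) (off (≢₁₃ t)) bc)
    ; good-p′ = good-intro {τ²} {p′} t (edge at-p′ (off (≢₁₂ t)) zb′) (edge at-p′ (off (≢₁₃ t)) zc′) (edge (off (≢₁₂ t)) (off (≢₁₃ t)) b′c′) }
    where
    τ¹ τ² : State N
    τ¹ = swapAt τ i d p
    τ² = swapAt τ¹ i d p′
    edge : ∀ {i j v v′ w w′} → v′ ≡ v → w′ ≡ w → a i j v w ≡ true → a i j v′ w′ ≡ true
    edge refl refl e = e
    off : ∀ {c q} → i ≢ c → vert τ² c q ≡ vert τ c q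
    off {c} {q} n = trans (swap-class τ¹ d p′ q (λ e → n (sym e))) (swap-class τ d p q (λ e → n (sym e)))
    at-p : vert τ² i p ≡ vert τ i d
    at-p = trans (swap-pos τ¹ i i p≢d p≢p′) (swap-ʳ τ i d p)
    at-p′ : vert τ² i p′ ≡ vert τ i p
    at-p′ = trans (swap-ʳ τ¹ i d p′) (swap-ˡ τ i d p)
  relay {i} {j} {k} t τ {d} {p} {p′} p≢d p′≢d p≢p′ refl refl refl refl refl refl refl zb zc bc b′c′ (inj₂ (xb′ , xc′)) = record
    { τ′ = τ¹
    ; same-class = λ n q → swap-class τ d p′ q n
    ; same-pos = λ n₁ n₂ n₃ c → swap-pos τ i c n₁ n₃
    ; at-d = swap-ˡ τ i d p′
    ; good-p = good-intro {τ¹} {p} t (edge at-p at-p zb) (edge at-p at-p zc) (edge at-p at-p bc)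
    ; good-p′ = good-intro {τ¹} {p′} t (edge (swap-ʳ τ i d p′) (off (≢₁₂ t)) xb′) (edge (swap-ʳ τ i d p′) (off (≢₁₃ t)) xc′) (edge (off (≢₁₂ t)) (off (≢₁₃ t)) b′c′) }
    where
    τ¹ : State N
    τ¹ = swapAt τ i d p′
    edge : ∀ {i j v v′ w w′} → v′ ≡ v → w′ ≡ w → a i j v w ≡ true → a i j v′ w′ ≡ true
    edge refl refl e = e
    off : ∀ {c q} → i ≢ c → vert τ¹ c q ≡ vert τ c q
    off {c} {q} n = swap-class τ d p′ q (λ e → n (sym e))
    at-p : ∀ {c} → vert τ¹ c p ≡ vert τ c p
    at-p {c} = swap-pos τ i c p≢d p≢p′

  AllGood : List (Fin N) → State N → Set
  AllGood P σ = ∀ {p} → p ∈ P → bad σ p ≡ false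

  -- Absorbing the triple may use up triangles of the larger reserve `P′`, but the result still
  -- agrees with `σ` on the old reserve `P`. Rounds can therefore be stacked.
  Hit : State N → List (Fin N) → State N → List (Fin N) → (Fin 3 → Fin N) → Set
  Hit σ P σ′ P′ x = ∀ τ d → Agree P′ σ′ τ → (∀ {q} → q ∈ P′ → d ≢ q) → (∀ c → vert τ c d ≡ x c) → bad τ d ≡ true →
    ∃[ τ′ ] Agree P σ τ′ × bc τ′ < bc τ

  record Extension (σ : State N) (P : List (Fin N)) (ω : Unit) : Set where
    field
      σ′ : State N
      P′ : List (Fin N)
      agree : Agree P σ σ′
      P⊆P′ : ∀ {p} → p ∈ P → p ∈ P′
      good : AllGood P σ → AllGood P′ σ′
      P′-length : length P′ ≡ 6 + length P
      hits : ∀ x → unit (listed σ P) x ω ≡ true → Hit σ P σ′ P′ x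

  triple : Fin N → Fin N → Fin N → Fin 3 → Fin N
  triple x y z c₁ = x
  triple x y z c₂ = y
  triple x y z c₃ = z

  alternatives : ∀ {p q r s t v} → disj (conj (p ∷ q ∷ r ∷ s ∷ [])) (conj (t ∷ v ∷ [])) ≡ true →
    (p ≡ true × q ≡ true × r ≡ true × s ≡ true) ⊎ (t ≡ true × v ≡ true)
  alternatives h with disj-elim h
  ... | inj₁ e = inj₁ (four (conj-elim e))
    where
    four : ∀ {p q r s} → All (_≡ true) (p ∷ q ∷ r ∷ s ∷ []) → p ≡ true × q ≡ true × r ≡ true × s ≡ true
    four (p ∷ q ∷ r ∷ s ∷ []) = p , q , r , s
  ... | inj₂ e = inj₂ (two (conj-elim e))
    where
    two : ∀ {p q} → All (_≡ true) (p ∷ q ∷ []) → p ≡ true × q ≡ true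
    two (p ∷ q ∷ []) = p , q

  record ConnFacts (i j k : Fin 3) (Lᵢ Lⱼ Lₖ : Lists) (x y z b c b′ c′ : Fin N) : Set where
    field
      fz : fresh Lᵢ z ≡ true
      fb : fresh Lⱼ b ≡ true
      fc : fresh Lₖ c ≡ true
      fb′ : fresh (b ∷ Lⱼ) b′ ≡ true
      fc′ : fresh (c ∷ Lₖ) c′ ≡ true
      zb : a i j z b ≡ true
      zc : a i k z c ≡ true
      base : a j k b c ≡ true
      yb′ : a i j y b′ ≡ true
      yc′ : a i k y c′ ≡ true
      b′c′ : a j k b′ c′ ≡ true
      alt : (a i j x b ≡ true × a i k x c ≡ true × a i j z b′ ≡ true × a i k z c′ ≡ true) ⊎ (a i j x b′ ≡ true × a i k x c′ ≡ true)

  connFacts : ∀ {i j k Lᵢ Lⱼ Lₖ x y z b c b′ c′} → conn i j k Lᵢ Lⱼ Lₖ x y (z , b , c , b′ , c′) ≡ true → ConnFacts i j k Lᵢ Lⱼ Lₖ x y z b c b′ c′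
  connFacts h with conj-elim h
  ... | fz ∷ fb ∷ fc ∷ fb′ ∷ fc′ ∷ zb ∷ zc ∷ bc ∷ yb′ ∷ yc′ ∷ b′c′ ∷ dj ∷ [] = record
    { fz = fz ; fb = fb ; fc = fc ; fb′ = fb′ ; fc′ = fc′ ; zb = zb ; zc = zc ; base = bc ; yb′ = yb′ ; yc′ = yc′ ; b′c′ = b′c′ ; alt = alternatives dj }

  module Extend (σ : State N) (P : List (Fin N)) (ω : Unit) where

    L : Fin 3 → Lists
    L = listed σ P

    κ₁ κ₂ κ₃ : Conn
    κ₁ = proj₁ (proj₂ (proj₂ (proj₂ ω)))
    κ₂ = proj₁ (proj₂ (proj₂ (proj₂ (proj₂ ω))))
    κ₃ = proj₂ (proj₂ (proj₂ (proj₂ (proj₂ ω))))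

    z b c b′ c′ : Conn → Fin N
    z κ = proj₁ κ
    b κ = proj₁ (proj₂ κ)
    c κ = proj₁ (proj₂ (proj₂ κ))
    b′ κ = proj₁ (proj₂ (proj₂ (proj₂ κ)))
    c′ κ = proj₂ (proj₂ (proj₂ (proj₂ κ)))

    y₁ y₂ y₃ z₁ b₁ d₁ b₁′ d₁′ z₂ b₂ d₂ b₂′ d₂′ z₃ b₃ d₃ b₃′ d₃′ : Fin N
    y₁ = proj₁ ω
    y₂ = proj₁ (proj₂ ω)
    y₃ = proj₁ (proj₂ (proj₂ ω))
    z₁ = z κ₁
    b₁ = b κ₁
    d₁ = c κ₁
    b₁′ = b′ κ₁
    d₁′ = c′ κ₁
    z₂ = z κ₂
    b₂ = b κ₂
    d₂ = c κ₂
    b₂′ = b′ κ₂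
    d₂′ = c′ κ₂
    z₃ = z κ₃
    b₃ = b κ₃
    d₃ = c κ₃
    b₃′ = b′ κ₃
    d₃′ = c′ κ₃

    record UnitFacts (x : Fin 3 → Fin N) : Set where
      field
        f₁ : fresh (L c₁) y₁ ≡ true
        f₂ : fresh (L c₂) y₂ ≡ true
        f₃ : fresh (L c₃) y₃ ≡ true
        y₁₂ : a c₁ c₂ y₁ y₂ ≡ true
        y₁₃ : a c₁ c₃ y₁ y₃ ≡ true
        y₂₃ : a c₂ c₃ y₂ y₃ ≡ true
        k₁ : ConnFacts c₁ c₂ c₃ (y₁ ∷ L c₁) (y₂ ∷ L c₂) (y₃ ∷ L c₃) (x c₁) y₁ z₁ b₁ d₁ b₁′ d₁′
        k₂ : ConnFacts c₂ c₁ c₃ (b₁′ ∷ b₁ ∷ y₂ ∷ L c₂) (z₁ ∷ y₁ ∷ L c₁) (d₁′ ∷ d₁ ∷ y₃ ∷ L c₃) (x c₂) y₂ z₂ b₂ d₂ b₂′ d₂′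
        k₃ : ConnFacts c₃ c₁ c₂ (d₂′ ∷ d₂ ∷ d₁′ ∷ d₁ ∷ y₃ ∷ L c₃) (b₂′ ∷ b₂ ∷ z₁ ∷ y₁ ∷ L c₁) (z₂ ∷ b₁′ ∷ b₁ ∷ y₂ ∷ L c₂) (x c₃) y₃ z₃ b₃ d₃ b₃′ d₃′

    unitFacts : ∀ x → unit L x ω ≡ true → UnitFacts x
    unitFacts x h with conj-elim h
    ... | f₁ ∷ f₂ ∷ f₃ ∷ y₁₂ ∷ y₁₃ ∷ y₂₃ ∷ k₁ ∷ k₂ ∷ k₃ ∷ [] = record
      { f₁ = f₁ ; f₂ = f₂ ; f₃ = f₃ ; y₁₂ = y₁₂ ; y₁₃ = y₁₃ ; y₂₃ = y₂₃ ; k₁ = connFacts k₁ ; k₂ = connFacts k₂ ; k₃ = connFacts k₃ }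

    v₁ v₁′ v₂ v₂′ v₃ v₃′ : Fin 3 → Fin N
    v₁ = triple z₁ b₁ d₁
    v₁′ = triple y₁ b₁′ d₁′
    v₂ = triple b₂ z₂ d₂
    v₂′ = triple b₂′ y₂ d₂′
    v₃ = triple b₃ d₃ z₃
    v₃′ = triple b₃′ d₃′ y₃

    vs : List (Fin 3 → Fin N)
    vs = v₃′ ∷ v₃ ∷ v₂′ ∷ v₂ ∷ v₁′ ∷ v₁ ∷ []

    -- The edges and distinctness conditions inside the unit do not involve the triple. They are
    -- taken from one triple `x₀` that the unit serves; for the other triples only the field `alt`
    -- is consulted.
    module _ (x₀ : Fin 3 → Fin N) (facts : UnitFacts x₀) where
      open UnitFacts facts

      chains : ∀ c → Chain (map (λ v → v c) vs) (L c)
      chains c₁ = chain-↭ (↭.prep _ (↭.prep _ (↭.prep _ (↭.prep _ (↭.swap _ _ ↭.refl)))))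
        ((ConnFacts.fb′ k₃) ∷ (ConnFacts.fb k₃) ∷ (ConnFacts.fb′ k₂) ∷ (ConnFacts.fb k₂) ∷ (ConnFacts.fz k₁) ∷ f₁ ∷ [])
      chains c₂ = chain-↭ (↭.prep _ (↭.prep _ (shift y₂ (z₂ ∷ b₁′ ∷ b₁ ∷ []) [])))
        ((ConnFacts.fc′ k₃) ∷ (ConnFacts.fc k₃) ∷ (ConnFacts.fz k₂) ∷ (ConnFacts.fb′ k₁) ∷ (ConnFacts.fb k₁) ∷ f₂ ∷ [])
      chains c₃ = chain-↭ (shift y₃ (z₃ ∷ d₂′ ∷ d₂ ∷ d₁′ ∷ d₁ ∷ []) [])
        ((ConnFacts.fz k₃) ∷ (ConnFacts.fc′ k₂) ∷ (ConnFacts.fc k₂) ∷ (ConnFacts.fc′ k₁) ∷ (ConnFacts.fc k₁) ∷ f₃ ∷ [])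

      edge : ∀ {i j v v′ w w′} → v′ ≡ v → w′ ≡ w → a i j v w ≡ true → a i j v′ w′ ≡ true
      edge refl refl e = e

      record Placement (σ′ : State N) : Set where
        field
          agree : Agree P σ σ′
          p₁ p₁′ p₂ p₂′ p₃ p₃′ : Fin N
          e₁ : ∀ c → vert σ′ c p₁ ≡ v₁ c
          e₁′ : ∀ c → vert σ′ c p₁′ ≡ v₁′ c
          e₂ : ∀ c → vert σ′ c p₂ ≡ v₂ c
          e₂′ : ∀ c → vert σ′ c p₂′ ≡ v₂′ c
          e₃ : ∀ c → vert σ′ c p₃ ≡ v₃ c
          e₃′ : ∀ c → vert σ′ c p₃′ ≡ v₃′ c
          n₁₂ : p₃′ ≢ p₃
          n₁₃ : p₃′ ≢ p₂′
          n₁₄ : p₃′ ≢ p₂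
          n₁₅ : p₃′ ≢ p₁′
          n₁₆ : p₃′ ≢ p₁
          n₂₃ : p₃ ≢ p₂′
          n₂₄ : p₃ ≢ p₂
          n₂₅ : p₃ ≢ p₁′
          n₂₆ : p₃ ≢ p₁
          n₃₄ : p₂′ ≢ p₂
          n₃₅ : p₂′ ≢ p₁′
          n₃₆ : p₂′ ≢ p₁
          n₄₅ : p₂ ≢ p₁′
          n₄₆ : p₂ ≢ p₁
          n₅₆ : p₁′ ≢ p₁
          new : All (λ p → ∀ {q} → q ∈ P → p ≢ q) (p₃′ ∷ p₃ ∷ p₂′ ∷ p₂ ∷ p₁′ ∷ p₁ ∷ [])

        ps : List (Fin N)
        ps = p₃′ ∷ p₃ ∷ p₂′ ∷ p₂ ∷ p₁′ ∷ p₁ ∷ []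

        P′ : List (Fin N)
        P′ = ps ++ P

      module _ (σ′ : State N) (placement : Placement σ′) where
        open Placement placement

        good-at : ∀ {p} (v : Fin 3 → Fin N) {i j k} → Tri i j k → (∀ c → vert σ′ c p ≡ v c) → a i j (v i) (v j) ≡ true → a i k (v i) (v k) ≡ true → a j k (v j) (v k) ≡ true → bad σ′ p ≡ false
        good-at {p} v {i} {j} {k} t e x y z = good-intro {σ′} {p} t (edge (e i) (e j) x) (edge (e i) (e k) y) (edge (e j) (e k) z)

        good : AllGood P σ → AllGood P′ σ′
        good g h with ∈-++⁻ ps h
        ... | inj₂ q = trans (bad-cong {σ} {σ′} (agree q)) (g q)
        ... | inj₁ (here refl) = good-at v₃′ t₃₁₂ e₃′ (ConnFacts.yb′ k₃) (ConnFacts.yc′ k₃) (ConnFacts.b′c′ k₃)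
        ... | inj₁ (there (here refl)) = good-at v₃ t₃₁₂ e₃ (ConnFacts.zb k₃) (ConnFacts.zc k₃) (ConnFacts.base k₃)
        ... | inj₁ (there (there (here refl))) = good-at v₂′ t₂₁₃ e₂′ (ConnFacts.yb′ k₂) (ConnFacts.yc′ k₂) (ConnFacts.b′c′ k₂)
        ... | inj₁ (there (there (there (here refl)))) = good-at v₂ t₂₁₃ e₂ (ConnFacts.zb k₂) (ConnFacts.zc k₂) (ConnFacts.base k₂)
        ... | inj₁ (there (there (there (there (here refl))))) = good-at v₁′ t₁₂₃ e₁′ (ConnFacts.yb′ k₁) (ConnFacts.yc′ k₁) (ConnFacts.b′c′ k₁)
        ... | inj₁ (there (there (there (there (there (here refl)))))) = good-at v₁ t₁₂₃ e₁ (ConnFacts.zb k₁) (ConnFacts.zc k₁) (ConnFacts.base k₁)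

        module _ (x : Fin 3 → Fin N) (F : UnitFacts x) (τ : State N) (d : Fin N) (ag : Agree P′ σ′ τ) (d∉ : ∀ {q} → q ∈ P′ → d ≢ q)
          (at-d : ∀ c → vert τ c d ≡ x c) (bad-d : bad τ d ≡ true) where

          in-ps : ∀ {p} → p ∈ ps → p ∈ P′
          in-ps = ∈-++⁺ˡ
          i₃′ = in-ps (here refl)
          i₃ = in-ps (there (here refl))
          i₂′ = in-ps (there (there (here refl)))
          i₂ = in-ps (there (there (there (here refl))))
          i₁′ = in-ps (there (there (there (there (here refl)))))
          i₁ = in-ps (there (there (there (there (there (here refl))))))
          off : ∀ {p} → p ∈ P′ → p ≢ d
          off h e = d∉ h (sym e)
          ne : ∀ {p q : Fin N} → p ≢ q → q ≢ p
          ne n e = n (sym e)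
          τ-at : ∀ {p} (v : Fin 3 → Fin N) → p ∈ P′ → (∀ c → vert σ′ c p ≡ v c) → ∀ c → vert τ c p ≡ v c
          τ-at v h e c = trans (ag h c) (e c)
          R₁ : Relay c₁ τ d p₁ p₁′ y₁
          R₁ = (relay t₁₂₃ τ {d} {p₁} {p₁′} (off i₁) (off i₁′) (ne n₅₆) (at-d c₁)
            (τ-at v₁ i₁ e₁ c₁) (τ-at v₁ i₁ e₁ c₂) (τ-at v₁ i₁ e₁ c₃) (τ-at v₁′ i₁′ e₁′ c₁) (τ-at v₁′ i₁′ e₁′ c₂) (τ-at v₁′ i₁′ e₁′ c₃)
            (ConnFacts.zb k₁) (ConnFacts.zc k₁) (ConnFacts.base k₁) (ConnFacts.b′c′ k₁) (ConnFacts.alt (UnitFacts.k₁ F)))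
          τ¹ = Relay.τ′ R₁
          τ¹-at : ∀ {p} (v : Fin 3 → Fin N) → p ∈ P′ → p ≢ p₁ → p ≢ p₁′ → (∀ c → vert σ′ c p ≡ v c) → ∀ c → vert τ¹ c p ≡ v c
          τ¹-at v h n n′ e c = trans (Relay.same-pos R₁ (off h) n n′ c) (τ-at v h e c)
          R₂ : Relay c₂ τ¹ d p₂ p₂′ y₂
          R₂ = (relay t₂₁₃ τ¹ {d} {p₂} {p₂′} (off i₂) (off i₂′) (ne n₃₄) (trans (Relay.same-class R₁ (λ ()) d) (at-d c₂))
            (τ¹-at v₂ i₂ n₄₆ n₄₅ e₂ c₂) (τ¹-at v₂ i₂ n₄₆ n₄₅ e₂ c₁) (τ¹-at v₂ i₂ n₄₆ n₄₅ e₂ c₃)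
            (τ¹-at v₂′ i₂′ n₃₆ n₃₅ e₂′ c₂) (τ¹-at v₂′ i₂′ n₃₆ n₃₅ e₂′ c₁) (τ¹-at v₂′ i₂′ n₃₆ n₃₅ e₂′ c₃)
            (ConnFacts.zb k₂) (ConnFacts.zc k₂) (ConnFacts.base k₂) (ConnFacts.b′c′ k₂) (ConnFacts.alt (UnitFacts.k₂ F)))
          τ² = Relay.τ′ R₂
          τ²-at : ∀ {p} (v : Fin 3 → Fin N) → p ∈ P′ → p ≢ p₁ → p ≢ p₁′ → p ≢ p₂ → p ≢ p₂′ → (∀ c → vert σ′ c p ≡ v c) → ∀ c → vert τ² c p ≡ v c
          τ²-at v h n n′ m m′ e c = trans (Relay.same-pos R₂ (off h) m m′ c) (τ¹-at v h n n′ e c)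
          R₃ : Relay c₃ τ² d p₃ p₃′ y₃
          R₃ = (relay t₃₁₂ τ² {d} {p₃} {p₃′} (off i₃) (off i₃′) (ne n₁₂) (trans (Relay.same-class R₂ (λ ()) d) (trans (Relay.same-class R₁ (λ ()) d) (at-d c₃)))
            (τ²-at v₃ i₃ n₂₆ n₂₅ n₂₄ n₂₃ e₃ c₃) (τ²-at v₃ i₃ n₂₆ n₂₅ n₂₄ n₂₃ e₃ c₁) (τ²-at v₃ i₃ n₂₆ n₂₅ n₂₄ n₂₃ e₃ c₂)
            (τ²-at v₃′ i₃′ n₁₆ n₁₅ n₁₄ n₁₃ e₃′ c₃) (τ²-at v₃′ i₃′ n₁₆ n₁₅ n₁₄ n₁₃ e₃′ c₁) (τ²-at v₃′ i₃′ n₁₆ n₁₅ n₁₄ n₁₃ e₃′ c₂)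
            (ConnFacts.zb k₃) (ConnFacts.zc k₃) (ConnFacts.base k₃) (ConnFacts.b′c′ k₃) (ConnFacts.alt (UnitFacts.k₃ F)))
          τ³ = Relay.τ′ R₃

          good-d : bad τ³ d ≡ false
          good-d = good-intro {τ³} {d} t₁₂₃ (edge d₁₌ d₂₌ y₁₂) (edge d₁₌ (Relay.at-d R₃) y₁₃) (edge d₂₌ (Relay.at-d R₃) y₂₃)
            where
            d₁₌ : vert τ³ c₁ d ≡ y₁
            d₁₌ = trans (Relay.same-class R₃ (λ ()) d) (trans (Relay.same-class R₂ (λ ()) d) (Relay.at-d R₁))
            d₂₌ : vert τ³ c₂ d ≡ y₂
            d₂₌ = trans (Relay.same-class R₃ (λ ()) d) (Relay.at-d R₂)

          elsewhere : ∀ {q} → q ≢ d → (∀ {p} → p ∈ ps → q ≢ p) → ∀ c → vert τ³ c q ≡ vert τ c q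
          elsewhere n f c = trans (Relay.same-pos R₃ n (f (there (here refl))) (f (here refl)) c)
            (trans (Relay.same-pos R₂ n (f (there (there (there (here refl))))) (f (there (there (here refl)))) c)
              (Relay.same-pos R₁ n (f (there (there (there (there (there (here refl))))))) (f (there (there (there (there (here refl)))))) c))

          agree³ : Agree P σ τ³
          agree³ {q} h c = trans (elsewhere (off (∈-++⁺ʳ ps h)) (λ p∈ e → All.lookup new p∈ h (sym e)) c) (trans (ag (∈-++⁺ʳ ps h) c) (agree h c))

          good¹ : ∀ {p} → p ≢ d → p ≢ p₂ → p ≢ p₂′ → p ≢ p₃ → p ≢ p₃′ → bad τ¹ p ≡ false → bad τ³ p ≡ false
          good¹ n m m′ l l′ g = trans (bad-cong {τ¹} {τ³} (λ c → trans (Relay.same-pos R₃ n l l′ c) (Relay.same-pos R₂ n m m′ c))) g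

          good² : ∀ {p} → p ≢ d → p ≢ p₃ → p ≢ p₃′ → bad τ² p ≡ false → bad τ³ p ≡ false
          good² n l l′ g = trans (bad-cong {τ²} {τ³} (λ c → Relay.same-pos R₃ n l l′ c)) g

          mono : ∀ q → bad τ³ q ≡ true → bad τ q ≡ true
          mono q h = decide (q Fin.≟ d) (q Fin.≟ p₁) (q Fin.≟ p₁′) (q Fin.≟ p₂) (q Fin.≟ p₂′) (q Fin.≟ p₃) (q Fin.≟ p₃′)
            where
            clash : bad τ³ q ≡ false → bad τ q ≡ true
            clash g = ⊥-elim (true≢false (trans (sym h) g))
            decide : Dec (q ≡ d) → Dec (q ≡ p₁) → Dec (q ≡ p₁′) → Dec (q ≡ p₂) → Dec (q ≡ p₂′) → Dec (q ≡ p₃) → Dec (q ≡ p₃′) → bad τ q ≡ true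
            decide (yes refl) _ _ _ _ _ _ = bad-d
            decide _ (yes refl) _ _ _ _ _ = clash (good¹ (off i₁) (ne n₄₆) (ne n₃₆) (ne n₂₆) (ne n₁₆) (Relay.good-p R₁))
            decide _ _ (yes refl) _ _ _ _ = clash (good¹ (off i₁′) (ne n₄₅) (ne n₃₅) (ne n₂₅) (ne n₁₅) (Relay.good-p′ R₁))
            decide _ _ _ (yes refl) _ _ _ = clash (good² (off i₂) (ne n₂₄) (ne n₁₄) (Relay.good-p R₂))
            decide _ _ _ _ (yes refl) _ _ = clash (good² (off i₂′) (ne n₂₃) (ne n₁₃) (Relay.good-p′ R₂))
            decide _ _ _ _ _ (yes refl) _ = clash (Relay.good-p R₃)
            decide _ _ _ _ _ _ (yes refl) = clash (Relay.good-p′ R₃)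
            decide (no n) (no n₁) (no n₁′) (no n₂) (no n₂′) (no n₃) (no n₃′) = trans (sym (bad-cong {τ} {τ³} (elsewhere n away))) h
              where
              away : ∀ {p} → p ∈ ps → q ≢ p
              away (here refl) = n₃′
              away (there (here refl)) = n₃
              away (there (there (here refl))) = n₂′
              away (there (there (there (here refl)))) = n₂
              away (there (there (there (there (here refl))))) = n₁′
              away (there (there (there (there (there (here refl)))))) = n₁

          hit : ∃[ τ′ ] Agree P σ τ′ × bc τ′ < bc τ
          hit = τ³ , agree³ , bc-< {τ} {τ³} mono d good-d bad-d

        build : Extension σ P ω
        build = record
          { σ′ = σ′ ; P′ = P′ ; agree = agree ; P⊆P′ = ∈-++⁺ʳ ps ; good = good ; P′-length = refl
          ; hits = λ x u → hit x (unitFacts x u) }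

      collect : ∀ {σ′ ps} → Agree P σ σ′ → Pointwise (λ p v → ∀ c → vert σ′ c p ≡ v c) ps vs →
        AllPairs _≢_ ps → All (λ p → ∀ {q} → q ∈ P → p ≢ q) ps → Placement σ′
      collect agree (e₃′ ∷ e₃ ∷ e₂′ ∷ e₂ ∷ e₁′ ∷ e₁ ∷ [])
        ((n₁₂ ∷ n₁₃ ∷ n₁₄ ∷ n₁₅ ∷ n₁₆ ∷ []) ∷ (n₂₃ ∷ n₂₄ ∷ n₂₅ ∷ n₂₆ ∷ []) ∷ (n₃₄ ∷ n₃₅ ∷ n₃₆ ∷ []) ∷ (n₄₅ ∷ n₄₆ ∷ []) ∷ (n₅₆ ∷ []) ∷ [] ∷ [])
        new = record
          { agree = agree ; e₁ = e₁ ; e₁′ = e₁′ ; e₂ = e₂ ; e₂′ = e₂′ ; e₃ = e₃ ; e₃′ = e₃′ ; new = new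
          ; n₁₂ = n₁₂ ; n₁₃ = n₁₃ ; n₁₄ = n₁₄ ; n₁₅ = n₁₅ ; n₁₆ = n₁₆ ; n₂₃ = n₂₃ ; n₂₄ = n₂₄ ; n₂₅ = n₂₅ ; n₂₆ = n₂₆ ; n₃₄ = n₃₄ ; n₃₅ = n₃₅ ; n₃₆ = n₃₆ ; n₄₅ = n₄₅ ; n₄₆ = n₄₆ ; n₅₆ = n₅₆ }

      extension : Extension σ P ω
      extension = let open AddedAll (add-triangles σ P vs chains) in build σ′ (collect agree at-ps distinct new)

  extend : ∀ σ P ω x → unit (listed σ P) x ω ≡ true → Extension σ P ω
  extend σ P ω x h = Extend.extension σ P ω x (Extend.unitFacts σ P ω x h)

-- Greedy choice of units until every triple is served

remaining : {A : Set} → (A → Bool) → List A → List A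
remaining f [] = []
remaining f (x ∷ xs) with f x
... | true = remaining f xs
... | false = x ∷ remaining f xs

remaining-length : {A : Set} (f : A → Bool) (xs : List A) → length (remaining f xs) + sumL xs (λ x → b2n (f x)) ≡ length xs
remaining-length f [] = refl
remaining-length f (x ∷ xs) with f x
... | true = trans (+-suc _ _) (cong suc (remaining-length f xs))
... | false = cong suc (remaining-length f xs)

remaining-∈ : {A : Set} (f : A → Bool) {xs : List A} {x : A} → x ∈ xs → x ∈ remaining f xs ⊎ f x ≡ true
remaining-∈ f {y ∷ xs} {x} p with f y in eq
remaining-∈ f (here refl) | true = inj₂ eq
remaining-∈ f (there p) | true = remaining-∈ f p
remaining-∈ f (here refl) | false = inj₁ (here refl)
remaining-∈ f (there p) | false = [ inj₁ ∘ there , inj₂ ]′ (remaining-∈ f p)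

sumL-pos : {A : Set} (f : A → Bool) (xs : List A) → 1 ≤ sumL xs (λ x → b2n (f x)) → ∃[ x ] f x ≡ true
sumL-pos f (x ∷ xs) h with f x in eq
... | true = x , eq
... | false = sumL-pos f xs h

length-cartesianProduct : {A B : Set} (xs : List A) (ys : List B) → length (cartesianProduct xs ys) ≡ length xs * length ys
length-cartesianProduct [] ys = refl
length-cartesianProduct (x ∷ xs) ys =
  trans (length-++ (map (x ,_) ys)) (cong₂ _+_ (length-map (x ,_) ys) (length-cartesianProduct xs ys))

shrunk : ∀ K κ A B r l n → K * r ≤ κ * l → A * l ≤ B * n → K * A * r ≤ κ * B * n
shrunk K κ A B r l n h h′ = begin
  K * A * r    ≡⟨ move K A r ⟩
  A * (K * r)  ≤⟨ *-monoʳ-≤ A h ⟩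
  A * (κ * l)  ≡⟨ move′ A κ l ⟩
  κ * (A * l)  ≤⟨ *-monoʳ-≤ κ h′ ⟩
  κ * (B * n)  ≡⟨ *-assoc κ B n ⟨
  κ * B * n    ∎
  where
  open ≤-Reasoning
  move : ∀ x y z → x * y * z ≡ y * (x * z)
  move = solve-∀
  move′ : ∀ x y z → x * (y * z) ≡ y * (x * z)
  move′ = solve-∀

module Rounding {N m u : ℕ} {a : Fin 3 → Fin 3 → Fin N → Fin N → Bool} (nonextremal : Nonextremal m u a)
  (w : ℕ) (w-pairs : w * N + w * N + w * w ≤ u * u) (w-small : 2 * w ≤ u) (N-pos : 1 ≤ N)
  (θ : ℕ) (N≤θw : N ≤ θ * w) (w-pos : 1 ≤ w)
  (κ : ℕ) (κ≡ : suc κ ≡ eighteenth θ)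
  (M : ℕ) (M-large : κ ^ M * (N * (N * N)) < suc κ ^ M) where

  open Nonextremal nonextremal using (a-sym)
  open Triangles a a-sym
  open Absorption nonextremal w w-pairs w-small N-pos θ N≤θw w-pos using (AllGood; Hit; triple; Extension; extend)
  open Connectors nonextremal w w-pairs w-small N-pos using (unit; hitting-unit; Unit)

  Triple : Set
  Triple = Fin N × Fin N × Fin N

  entries : Triple → Fin 3 → Fin N
  entries (x , y , z) = triple x y z

  triples : List Triple
  triples = cartesianProduct (allFin N) (cartesianProduct (allFin N) (allFin N))

  triples-length : length triples ≡ N * (N * N)
  triples-length = trans (length-cartesianProduct (allFin N) _)
    (cong₂ _*_ (length-tabulate (λ (x : Fin N) → x)) (trans (length-cartesianProduct (allFin N) (allFin N)) (cong₂ _*_ (length-tabulate (λ (x : Fin N) → x)) (length-tabulate (λ (x : Fin N) → x)))))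

  module _ (σ : State N) (P : List (Fin N)) (P-good : AllGood P σ) where

    -- κ / (1 + κ) bounds the fraction of the uncovered triples that survives one more unit.
    record Covering (k : ℕ) : Set where
      field
        σ′ : State N
        P′ : List (Fin N)
        agree : Agree P σ σ′
        P⊆P′ : ∀ {p} → p ∈ P → p ∈ P′
        good : AllGood P′ σ′
        P′-length : length P′ ≤ length P + 6 * k
        uncovered : List Triple
        covered : ∀ x → x ∈ uncovered ⊎ Hit σ P σ′ P′ (entries x)
        few : suc κ ^ k * length uncovered ≤ κ ^ k * (N * (N * N))

    covering : ∀ k → length P + 6 * k + 18 ≤ w → Covering k
    covering zero _ = record
      { σ′ = σ ; P′ = P ; agree = λ _ _ → refl ; P⊆P′ = λ h → h ; good = P-good ; P′-length = m≤m+n _ _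
      ; uncovered = triples ; covered = λ { (x , y , z) → inj₁ (∈-cartesianProduct⁺ (∈-allFin x) (∈-cartesianProduct⁺ (∈-allFin y) (∈-allFin z))) }
      ; few = ≤-reflexive (cong (1 *_) triples-length) }
    covering (suc k) l = step (covering k (lin 3 (λ p k w → (p :+ 6 · (con 1 :+ k) :+ con 18 :≤ w) ⇒ ⊢ p :+ 6 · k :+ con 18 :≤ w) (length P) k w l))
      where
      step : Covering k → Covering (suc k)
      step C = by-cases uncovered refl
        where
        open Covering C

        short : ∀ c → length (listed σ′ P′ c) + 18 ≤ w
        short c = lin 5 (λ q p′ p k w → (q :≤ p′) ⇒ (p′ :≤ p :+ 6 · k) ⇒ (p :+ 6 · (con 1 :+ k) :+ con 18 :≤ w) ⇒ ⊢ q :+ con 18 :≤ w)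
          (length (listed σ′ P′ c)) (length P′) (length P) k w (≤-reflexive (length-map (vert σ′ c) P′)) P′-length l

        by-cases : ∀ U → U ≡ uncovered → Covering (suc k)
        by-cases [] e = record
          { σ′ = σ′ ; P′ = P′ ; agree = agree ; P⊆P′ = P⊆P′ ; good = good
          ; P′-length = ≤-trans P′-length (+-monoʳ-≤ (length P) (*-monoʳ-≤ 6 (n≤1+n k)))
          ; uncovered = [] ; covered = λ x → inj₂ ([ (λ h → none (subst (x ∈_) (sym e) h)) , (λ h → h) ]′ (covered x))
          ; few = ≤-trans (≤-reflexive (*-zeroʳ (suc κ ^ suc k))) z≤n }
          where
          none : ∀ {x} {A : Set} → x ∈ [] → A
          none ()
        by-cases (x₀ ∷ U₀) e = let ω , h = hitting-unit (listed σ′ P′) short θ N≤θw w-pos (x₀ ∷ U₀) entries in choose ω h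
          where
          U : List Triple
          U = x₀ ∷ U₀

          module _ (ω : Unit) where
            f : Triple → Bool
            f x = unit (listed σ′ P′) (entries x) ω

            F : ℕ
            F = sumL U (λ x → b2n (f x))

            extended : Extension σ′ P′ ω → length U ≤ suc κ * F → Covering (suc k)
            extended ext F-large = record
              { σ′ = E.σ′ ; P′ = E.P′ ; agree = λ h c → trans (E.agree (P⊆P′ h) c) (agree h c) ; P⊆P′ = E.P⊆P′ ∘ P⊆P′ ; good = E.good good
              ; P′-length = lin 4 (λ q p′ p k → (q :≤ con 6 :+ p′) ⇒ (p′ :≤ p :+ 6 · k) ⇒ ⊢ q :≤ p :+ 6 · (con 1 :+ k)) (length E.P′) (length P′) (length P) k (≤-reflexive E.P′-length) P′-length
              ; uncovered = remaining f U ; covered = λ x → cover x (covered x) ; few = few′ }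
              where
              module E = Extension ext
              old : ∀ {x} → Hit σ P σ′ P′ x → Hit σ P E.σ′ E.P′ x
              old h τ d ag d∉ = h τ d (λ p c → trans (ag (E.P⊆P′ p) c) (E.agree p c)) (d∉ ∘ E.P⊆P′)
              new : ∀ x → f x ≡ true → Hit σ P E.σ′ E.P′ (entries x)
              new x h τ d ag d∉ at bd = let τ′ , ag′ , lt = E.hits (entries x) h τ d ag d∉ at bd in
                τ′ , (λ p c → trans (ag′ (P⊆P′ p) c) (agree p c)) , lt
              cover : ∀ x → x ∈ uncovered ⊎ Hit σ P σ′ P′ (entries x) → x ∈ remaining f U ⊎ Hit σ P E.σ′ E.P′ (entries x)
              cover x (inj₂ h) = inj₂ (old h)
              cover x (inj₁ h) = [ inj₁ , (λ q → inj₂ (new x q)) ]′ (remaining-∈ f (subst (x ∈_) (sym e) h))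
              shrink : suc κ * length (remaining f U) ≤ κ * length U
              shrink = lin 4 (λ κ r F U → (U :≤ (con 1 :+ κ) :* F) ⇒ ((con 1 :+ κ) :* (r :+ F) :≤ (con 1 :+ κ) :* U) ⇒ ⊢ (con 1 :+ κ) :* r :≤ κ :* U)
                κ (length (remaining f U)) F (length U) F-large (*-monoʳ-≤ (suc κ) (≤-reflexive (remaining-length f U)))
              few′ : suc κ ^ suc k * length (remaining f U) ≤ κ ^ suc k * (N * (N * N))
              few′ = shrunk (suc κ) κ (suc κ ^ k) (κ ^ k) (length (remaining f U)) (length U) (N * (N * N)) shrink
                (subst (λ z → suc κ ^ k * length z ≤ κ ^ k * (N * (N * N))) (sym e) few)

            choose : length U ≤ eighteenth θ * F → Covering (suc k)
            -- Averaging yields only a tuple `ω`; that it serves at least one triple shows that its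
            -- triangles exist and can be reserved.
            choose h = let x , q = sumL-pos f U (positive F F-large) in extended (extend σ′ P′ ω (entries x) q) F-large
              where
              F-large : length U ≤ suc κ * F
              F-large = subst (λ z → length U ≤ z * F) (sym κ≡) h
              positive : ∀ F → length U ≤ suc κ * F → 1 ≤ F
              positive zero h = ⊥-elim (1≰0 (≤-trans (s≤s z≤n) (≤-trans h (≤-reflexive (*-zeroʳ (suc κ))))))
              positive (suc _) _ = s≤s z≤n

    all-hit : length P + 6 * M + 18 ≤ w → ∃[ σ′ ] ∃[ P′ ] Agree P σ σ′ × (∀ {p} → p ∈ P → p ∈ P′) × AllGood P′ σ′ × length P′ ≤ length P + 6 * M × (∀ x → Hit σ P σ′ P′ (entries x))
    all-hit l = σ′ , P′ , agree , P⊆P′ , good , P′-length , λ x → [ (λ h → ⊥-elim (none h)) , (λ h → h) ]′ (covered x)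
      where
      open Covering (covering M l)
      empty : ∀ (U : List Triple) → suc κ ^ M * length U ≤ κ ^ M * (N * (N * N)) → ∀ {x} → x ∈ U → ⊥
      empty (_ ∷ U) h _ = <⇒≱ M-large (≤-trans (≤-trans (≤-reflexive (sym (*-identityʳ _))) (*-monoʳ-≤ (suc κ ^ M) (s≤s z≤n))) h)
      none : ∀ {x} → x ∈ uncovered → ⊥
      none = empty uncovered few

  Absorbing : ℕ → State N → List (Fin N) → Set
  Absorbing r σ P = ∀ τ → Agree P σ τ → bc τ ≤ r → ⊥

  -- A state with `r + 1` bad positions has one of them outside `P′`, because the reserve consists
  -- of triangles. The triple there is hit, which leaves at most `r` bad positions and the old
  -- reserve intact.
  next-round : ∀ {r σ P} → AllGood P σ → Absorbing r σ P → length P + 6 * M + 18 ≤ w →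
    ∃[ σ′ ] ∃[ P′ ] AllGood P′ σ′ × Absorbing (suc r) σ′ P′ × length P′ ≤ length P + 6 * M
  next-round {r} {σ} {P} g ab l = finish (all-hit σ P g l)
    where
    finish : ∃[ σ′ ] ∃[ P′ ] Agree P σ σ′ × (∀ {p} → p ∈ P → p ∈ P′) × AllGood P′ σ′ × length P′ ≤ length P + 6 * M × (∀ x → Hit σ P σ′ P′ (entries x)) →
      ∃[ σ′ ] ∃[ P′ ] AllGood P′ σ′ × Absorbing (suc r) σ′ P′ × length P′ ≤ length P + 6 * M
    finish (σ′ , P′ , agree , sub , good , len , hit) = σ′ , P′ , good , absorb , len
      where
      absorb : Absorbing (suc r) σ′ P′
      absorb τ ag h with bc τ ≤? r
      ... | yes h′ = ab τ (λ p c → trans (ag (sub p) c) (agree p c)) h′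
      ... | no h′ = let d , bd = cnt-∃ (bad τ) (≤-trans (s≤s z≤n) (≰⇒> h′))
                        x = vert τ c₁ d , vert τ c₂ d , vert τ c₃ d
                        τ′ , ag′ , lt = hit x τ d ag (off bd) (λ { c₁ → refl ; c₂ → refl ; c₃ → refl }) bd
                    in ab τ′ ag′ (≤-pred (≤-trans lt h))
        where
        off : ∀ {d q} → bad τ d ≡ true → q ∈ P′ → d ≢ q
        off bd q refl = true≢false (trans (sym bd) (trans (bad-cong {σ′} {τ} (ag q)) (good q)))

  rounds : (∀ τ → bc τ ≤ 0 → ⊥) → ∀ r → 6 * M * r + 18 ≤ w →
    ∃[ σ ] ∃[ P ] AllGood P σ × Absorbing r σ P × length P ≤ 6 * M * r
  rounds no-perfect zero _ = (λ _ → idₚ) , [] , (λ ()) , (λ τ _ → no-perfect τ) , z≤n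
  rounds no-perfect (suc r) l = continue (rounds no-perfect r (lin 3 (λ M r w → (6 · M :* (con 1 :+ r) :+ con 18 :≤ w) ⇒ ⊢ 6 · M :* r :+ con 18 :≤ w) M r w l))
    where
    continue : ∃[ σ ] ∃[ P ] AllGood P σ × Absorbing r σ P × length P ≤ 6 * M * r → ∃[ σ ] ∃[ P ] AllGood P σ × Absorbing (suc r) σ P × length P ≤ 6 * M * suc r
    continue (σ , P , g , ab , len) =
      let σ′ , P′ , g′ , ab′ , len′ = next-round g ab (lin 4 (λ M r w p → (6 · M :* (con 1 :+ r) :+ con 18 :≤ w) ⇒ (p :≤ 6 · M :* r) ⇒ ⊢ p :+ 6 · M :+ con 18 :≤ w) M r w (length P) l len)
      in σ′ , P′ , g′ , ab′ , lin 4 (λ M r p p′ → (p :≤ 6 · M :* r) ⇒ (p′ :≤ p :+ 6 · M) ⇒ ⊢ p′ :≤ 6 · M :* (con 1 :+ r)) M r (length P) (length P′) len len′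

-- Optimal tilings

distinct-elements : ∀ {N} (f : Fin N → Bool) k → k ≤ cnt f → ∃[ xs ] length xs ≡ k × AllPairs _≢_ xs × All (λ x → f x ≡ true) xs
distinct-elements f zero _ = [] , refl , [] , []
distinct-elements {N} f (suc k) h = grow (distinct-elements f k (<⇒≤ h))
  where
  fresh-all : ∀ (xs : List (Fin N)) {x} → fresh xs x ≡ true → All (x ≢_) xs
  fresh-all xs h = All.tabulate λ p → fresh-∈ h p
  grow : ∃[ xs ] length xs ≡ k × AllPairs _≢_ xs × All (λ x → f x ≡ true) xs → ∃[ xs ] length xs ≡ suc k × AllPairs _≢_ xs × All (λ x → f x ≡ true) xs
  grow (xs , len , ap , al) =
    let x , q = cnt-∃ (f ∩ fresh xs) (lin 4 (λ k l c c′ → (con 1 :+ k :≤ c) ⇒ (c :≤ c′ :+ l) ⇒ (l :≤ k) ⇒ ⊢ con 1 :≤ c′) k (length xs) (cnt f) _ h (cnt-fresh f xs) (≤-reflexive len))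
        q₁ , q₂ = ∩-elim q
    in x ∷ xs , cong suc len , fresh-all xs q₂ ∷ ap , q₁ ∷ al

lookup-injective : ∀ {N} {xs : List (Fin N)} → AllPairs _≢_ xs → ∀ i j → List.lookup xs i ≡ List.lookup xs j → i ≡ j
lookup-injective (_ ∷ _) zero zero _ = refl
lookup-injective (p ∷ _) zero (suc j) h = ⊥-elim (All.lookup p (∈-lookup j) h)
lookup-injective (p ∷ _) (suc i) zero h = ⊥-elim (All.lookup p (∈-lookup i) (sym h))
lookup-injective (_ ∷ ps) (suc i) (suc j) h = cong suc (lookup-injective ps i j h)

-- Exchange arguments name vertices by their positions in `σ`; counts and edge numbers are invariant
-- under this renaming.
relabel : ∀ {N m u} {a : Fin 3 → Fin 3 → Fin N → Fin N → Bool} → Nonextremal m u a → (σ : State N) →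
  Nonextremal m u (λ i j s t → a i j (vert σ i s) (vert σ j t))
relabel {N} {m} {u} {a} ne σ = record
  { N≡3m = N≡3m ; u-pos = u-pos ; u-small = u-small
  ; a-sym = λ i j s t → a-sym i j _ _
  ; degree = λ {i} {j} n x → subst (λ d → 2 * m ≤ d + u) (sym (cnt-perm (σ j) (a i j (vert σ i x)))) (degree n (vert σ i x))
  ; no-sparse = λ {i} {j} {k} t X Y Z x y z xy xz yz → no-sparse t (push i X) (push j Y) (push k Z)
      (subst (λ d → m ≤ d + 200 * u) (sym (push-cnt i X)) x) (subst (λ d → m ≤ d + 200 * u) (sym (push-cnt j Y)) y) (subst (λ d → m ≤ d + 200 * u) (sym (push-cnt k Z)) z)
      (subst (_≤ 200 * (u * N)) (sym (push-E i j X Y)) xy) (subst (_≤ 200 * (u * N)) (sym (push-E i k X Z)) xz) (subst (_≤ 200 * (u * N)) (sym (push-E j k Y Z)) yz) }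
  where
  open Nonextremal ne
  push : Fin 3 → (Fin N → Bool) → Fin N → Bool
  push i X v = X (σ i ⟨$⟩ˡ v)
  push-at : ∀ i X s → push i X (σ i ⟨$⟩ʳ s) ≡ X s
  push-at i X s = cong X (inverseˡ (σ i))
  push-cnt : ∀ i X → cnt (push i X) ≡ cnt X
  push-cnt i X = trans (sym (cnt-perm (σ i) (push i X))) (cnt-cong (push-at i X))
  push-E : ∀ i j X Y → E (a i j) (push i X) (push j Y) ≡ E (λ s t → a i j (vert σ i s) (vert σ j t)) X Y
  push-E i j X Y = trans (sym (E-perm (σ i) (σ j) (a i j) (push i X) (push j Y))) (E-cong₂ _ (push-at i X) (push-at j Y))

module _ {N m u : ℕ} {a : Fin 3 → Fin 3 → Fin N → Fin N → Bool} (ne : Nonextremal m u a) (N-small : 3 * N ≤ u * u)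
  (σ₀ : State N) (P : List (Fin N)) (P-short : length P + 224 ≤ u) where
  open Nonextremal ne using (a-sym)
  open Triangles a a-sym

  optimum-few-bad : (∀ {p} → p ∈ P → bad σ₀ p ≡ false) → ∀ σ → Agree P σ₀ σ → (∀ τ → Agree P σ₀ τ → bc σ ≤ bc τ) → bc σ < 24
  optimum-few-bad good σ ag opt with 24 ≤? bc σ
  ... | no h = ≰⇒> h
  ... | yes h = ⊥-elim (too-many (distinct-elements (bad σ) 24 h))
    where
    too-many : ∃[ xs ] length xs ≡ 24 × AllPairs _≢_ xs × All (λ x → bad σ x ≡ true) xs → ⊥
    too-many (xs , len , ap , al) = Moves.Optimal.not-optimal a a-sym σ P (xs ++ P) δ δ-injective
        (λ s → ∈-++⁺ˡ (∈-lookup {xs = xs} (ix s))) (∈-++⁺ʳ xs) δ∉P δ-bad (λ τ h → opt τ λ p c → trans (h _ p c) (ag p c))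
        m u (relabel ne σ)
        (lin 4 (λ z x p u → (z :≤ x :+ p) ⇒ (x :≤ con 24) ⇒ (p :+ con 224 :≤ u) ⇒ ⊢ z :+ con 200 :≤ u) (length (xs ++ P)) (length xs) (length P) u (≤-reflexive (length-++ xs)) (≤-reflexive len) P-short)
        N-small
      where
      ix : Slot → Fin (length xs)
      ix (β , r) = subst Fin (sym len) (Fin.combine β r)
      δ : Slot → Fin N
      δ s = List.lookup xs (ix s)
      δ-injective : ∀ {s s′} → δ s ≡ δ s′ → s ≡ s′
      δ-injective {β , r} {β′ , r′} h =
        let e , e′ = Fin.combine-injective β r β′ r′ (subst-injective (sym len) (lookup-injective ap _ _ h)) in cong₂ _,_ e e′
      δ-bad : ∀ s → bad σ (δ s) ≡ true
      δ-bad s = All.lookup al (∈-lookup (ix s))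
      δ∉P : ∀ s {p} → p ∈ P → p ≢ δ s
      δ∉P s p refl = true≢false (trans (sym (δ-bad s)) (trans (bad-cong {σ₀} {σ} (ag p)) (good p)))

  -- Descent on the number of bad positions. With a refutation as target no search through all
  -- states is required: any state that defeats minimality becomes the next candidate.
  optimum-exists : ∀ b σ → Agree P σ₀ σ → bc σ ≤ b → (∀ σ → Agree P σ₀ σ → (∀ τ → Agree P σ₀ τ → bc σ ≤ bc τ) → ⊥) → ⊥
  optimum-exists zero σ ag h k = k σ ag (λ τ _ → ≤-trans h z≤n)
  optimum-exists (suc b) σ ag h k = k σ ag λ τ ag′ → ≮⇒≥ λ lt → optimum-exists b τ ag′ (≤-pred (≤-trans lt h)) k

  absorbed : (∀ {p} → p ∈ P → bad σ₀ p ≡ false) → (∀ τ → Agree P σ₀ τ → bc τ ≤ 23 → ⊥) → ⊥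
  absorbed good absorbing = optimum-exists (bc σ₀) σ₀ (λ _ _ → refl) ≤-refl λ σ ag opt → absorbing σ ag (≤-pred (optimum-few-bad good σ ag opt))

-- Rational bounds

/-≃ : ∀ n d → toℚᵘ (n /ℚ suc d) ℚᵘ.≃ mkℚᵘ n d
/-≃ n d = ℚ.toℚᵘ-fromℚᵘ (mkℚᵘ n d)

unit-fraction-below : ∀ Δ → 0ℚ <ℚ Δ → ∃[ q ] (ℤ.+ 1 /ℚ suc q) ≤ℚ Δ
unit-fraction-below (mkℚ (ℤ.+ suc n) d c) _ = d , ℚ.toℚᵘ-cancel-≤ (ℚᵘ.≤-respˡ-≃ (ℚᵘ.≃-sym (/-≃ (ℤ.+ 1) d))
  (*≤* (ℤ.*-monoʳ-≤-nonNeg (ℤ.+ suc d) {ℤ.+ 1} {ℤ.+ suc n} (ℤ.+≤+ (s≤s z≤n)))))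
unit-fraction-below (mkℚ (ℤ.+ zero) d c) (*<* (ℤ.+<+ ()))
unit-fraction-below (mkℚ ℤ.-[1+ n ] d c) (*<* ())

unit-fraction-positive : ∀ q → 0ℚ <ℚ (ℤ.+ 1 /ℚ suc q)
unit-fraction-positive q = ℚ.toℚᵘ-cancel-< (ℚᵘ.<-respʳ-≃ (ℚᵘ.≃-sym (/-≃ (ℤ.+ 1) q)) (ℚᵘ.*<* (ℤ.+<+ (s≤s z≤n))))

frac-≤ : ∀ e k q {Δ} → (ℤ.+ 1 /ℚ suc q) ≤ℚ Δ → e * suc q ≤ k → frac e k ≤ℚ Δ
-- For denominator zero the convention makes `frac` equal to 0.
frac-≤ e zero q h _ = ℚ.≤-trans (ℚ.toℚᵘ-cancel-≤ (ℚᵘ.≤-respʳ-≃ (ℚᵘ.≃-sym (/-≃ (ℤ.+ 1) q)) (*≤* (ℤ.+≤+ z≤n)))) h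
frac-≤ e (suc k) q h l = ℚ.≤-trans (ℚ.toℚᵘ-cancel-≤ (ℚᵘ.≤-respˡ-≃ (ℚᵘ.≃-sym (/-≃ (ℤ.+ e) k)) (ℚᵘ.≤-respʳ-≃ (ℚᵘ.≃-sym (/-≃ (ℤ.+ 1) q))
  (*≤* (subst₂ ℤ._≤_ (ℤ.pos-* e (suc q)) (trans (cong ℤ.+_ (sym (+-identityʳ (suc k)))) (ℤ.pos-* 1 (suc k))) (ℤ.+≤+ l)))))) h

min-degree-ℕ : ∀ e N d → ((ℤ.+ 2 /ℚ 3) -ℚ (ℤ.+ 1 /ℚ suc e)) *ℚ ℕ→ℚ N ≤ℚ ℕ→ℚ d → 2 * suc e * N ≤ 3 * suc e * d + 3 * N
min-degree-ℕ e N d h = ℤ.drop‿+≤+ (subst₂ ℤ._≤_ left right (ℤ.+-monoˡ-≤ (ℤ.+ 3 ℤ.* ℤ.+ N) integral))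
  where
  ε : ℚ
  ε = ℤ.+ 1 /ℚ suc e
  lhs-≃ : toℚᵘ (((ℤ.+ 2 /ℚ 3) -ℚ ε) *ℚ ℕ→ℚ N) ℚᵘ.≃ (mkℚᵘ (ℤ.+ 2) 2 ℚᵘ.- mkℚᵘ (ℤ.+ 1) e) ℚᵘ.* mkℚᵘ (ℤ.+ N) 0
  lhs-≃ = ℚᵘ.≃-trans (ℚ.toℚᵘ-homo-* ((ℤ.+ 2 /ℚ 3) -ℚ ε) (ℕ→ℚ N)) (ℚᵘ.*-cong
    (ℚᵘ.≃-trans (ℚ.toℚᵘ-homo-+ (ℤ.+ 2 /ℚ 3) (-ℚ ε)) (ℚᵘ.+-cong (/-≃ (ℤ.+ 2) 2) (ℚᵘ.≃-trans (ℚ.toℚᵘ-homo‿- ε) (ℚᵘ.-‿cong (/-≃ (ℤ.+ 1) e))))) (/-≃ (ℤ.+ N) 0))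
  integral : (ℤ.+ 2 ℤ.* ℤ.+ suc e ℤ.+ ℤ.- (ℤ.+ 1) ℤ.* ℤ.+ 3) ℤ.* ℤ.+ N ℤ.* ℤ.+ 1 ℤ.≤ ℤ.+ d ℤ.* (ℤ.+ 3 ℤ.* ℤ.+ suc e ℤ.* ℤ.+ 1)
  integral = ℚᵘ.drop-*≤* (ℚᵘ.≤-respˡ-≃ lhs-≃ (ℚᵘ.≤-respʳ-≃ (/-≃ (ℤ.+ d) 0) (ℚ.toℚᵘ-mono-≤ h)))
  ring-left : ∀ E N → (ℤ.+ 2 ℤ.* E ℤ.+ ℤ.- (ℤ.+ 1) ℤ.* ℤ.+ 3) ℤ.* N ℤ.* ℤ.+ 1 ℤ.+ ℤ.+ 3 ℤ.* N ≡ ℤ.+ 2 ℤ.* E ℤ.* N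
  ring-left = ℤ.solve-∀
  left : (ℤ.+ 2 ℤ.* ℤ.+ suc e ℤ.+ ℤ.- (ℤ.+ 1) ℤ.* ℤ.+ 3) ℤ.* ℤ.+ N ℤ.* ℤ.+ 1 ℤ.+ ℤ.+ 3 ℤ.* ℤ.+ N ≡ ℤ.+ (2 * suc e * N)
  left = trans (ring-left (ℤ.+ suc e) (ℤ.+ N)) (sym (trans (ℤ.pos-* (2 * suc e) N) (cong (ℤ._* ℤ.+ N) (ℤ.pos-* 2 (suc e)))))
  ring-right : ∀ E d N → d ℤ.* (ℤ.+ 3 ℤ.* E ℤ.* ℤ.+ 1) ℤ.+ ℤ.+ 3 ℤ.* N ≡ ℤ.+ 3 ℤ.* E ℤ.* d ℤ.+ ℤ.+ 3 ℤ.* N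
  ring-right = ℤ.solve-∀
  right : ℤ.+ d ℤ.* (ℤ.+ 3 ℤ.* ℤ.+ suc e ℤ.* ℤ.+ 1) ℤ.+ ℤ.+ 3 ℤ.* ℤ.+ N ≡ ℤ.+ (3 * suc e * d + 3 * N)
  right = trans (ring-right (ℤ.+ suc e) (ℤ.+ d) (ℤ.+ N)) (sym (trans (ℤ.pos-+ (3 * suc e * d) (3 * N))
    (cong₂ ℤ._+_ (trans (ℤ.pos-* (3 * suc e) d) (cong (ℤ._* ℤ.+ d) (ℤ.pos-* 3 (suc e)))) (ℤ.pos-* 3 N))))

-- Decidability and the extremal alternative

cons : ∀ {n} {A : Set} → A → (Fin n → A) → Fin (suc n) → A
cons x f zero = x
cons x f (suc i) = f i

opaque
  unfolding cnt

  prune : ∀ {n} (f : Fin n → Bool) k → k ≤ cnt f → ∃[ g ] (∀ x → g x ≡ true → f x ≡ true) × cnt g ≡ k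
  prune {n} f zero _ = (λ _ → false) , (λ _ ()) , cnt-none {n} (λ _ → false) (λ _ ())
  prune {suc n} f (suc k) h with f zero in eq
  ... | true = let g , s , e = prune (f ∘ suc) k (≤-pred h) in cons true g , (λ { zero _ → eq ; (suc x) → s x }) , cong suc e
  ... | false = let g , s , e = prune (f ∘ suc) (suc k) h in cons false g , (λ { zero () ; (suc x) → s x }) , e

-- `SparseTriple` demands sets of exact size. A large set is pruned at no cost; a small one is
-- filled up, and only the added vertices can contribute new edges.
resize : ∀ {n} (X : Fin n → Bool) k c → k ≤ n → k ≤ cnt X + c → ∃[ Y ] cnt Y ≡ k × cnt (Y ∖ X) ≤ c
resize {n} X k c k≤n h with k ≤? cnt X
... | yes p = let Y , s , e = prune X k p in Y , e , subst (_≤ c) (sym (cnt-none (Y ∖ X) λ x q → let y , ny = ∖-elim q in ny (s x y))) z≤n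
... | no p = extend (prune (full ∖ X) (k ∸ cnt X) room)
  where
  X<k : cnt X ≤ k
  X<k = <⇒≤ (≰⇒> p)
  room : k ∸ cnt X ≤ cnt (full ∖ X)
  room = lin 6 (λ n k x d fx r → (d :+ x :≤ k) ⇒ (k :≤ n) ⇒ (n :≤ fx :+ r) ⇒ (fx :≤ x) ⇒ ⊢ d :≤ r)
    n k (cnt X) (k ∸ cnt X) (cnt (full ∩ X)) (cnt (full ∖ X)) (≤-reflexive (m∸n+n≡m X<k)) k≤n
    (≤-reflexive (trans (sym (cnt-all n)) (cnt-split full X))) (cnt-mono λ x q → proj₂ (∩-elim q))
  extend : ∃[ g ] (∀ x → g x ≡ true → (full ∖ X) x ≡ true) × cnt g ≡ k ∸ cnt X → ∃[ Y ] cnt Y ≡ k × cnt (Y ∖ X) ≤ c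
  extend (g , s , e) = X ∪ g , size , ≤-trans (cnt-mono λ x q → let y , ny = ∖-elim q in new ny (∪-elim y))
      (≤-trans (≤-reflexive e) (≤-trans (∸-monoˡ-≤ (cnt X) h) (≤-reflexive (m+n∸m≡n (cnt X) c))))
    where
    new : ∀ {x} → (X x ≡ true → ⊥) → X x ≡ true ⊎ g x ≡ true → g x ≡ true
    new n (inj₁ q) = ⊥-elim (n q)
    new n (inj₂ q) = q
    size : cnt (X ∪ g) ≡ k
    size = begin
      cnt (X ∪ g)                ≡⟨ +-identityʳ _ ⟨
      cnt (X ∪ g) + 0            ≡⟨ cong (λ z → cnt (X ∪ g) + z) (cnt-none (X ∩ g) λ x q → let y , z = ∩-elim q in proj₂ (∖-elim (s x z)) y) ⟨
      cnt (X ∪ g) + cnt (X ∩ g)  ≡⟨ cnt-∪∩ X g ⟨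
      cnt X + cnt g              ≡⟨ cong (cnt X +_) e ⟩
      cnt X + (k ∸ cnt X)        ≡⟨ m+[n∸m]≡n X<k ⟩
      k                          ∎
      where open ≡-Reasoning

E-resize : ∀ {n k} (r : Fin n → Fin k → Bool) X X′ Y Y′ → E r X′ Y′ ≤ E r X Y + k * cnt (X′ ∖ X) + n * cnt (Y′ ∖ Y)
E-resize {n} {k} r X X′ Y Y′ = lin 6 (λ e₁ e₂ e₃ e₄ kx ny → (e₁ :≤ e₂ :+ kx) ⇒ (e₂ :≤ e₃) ⇒ (e₃ :≤ e₄ :+ ny) ⇒ ⊢ e₁ :≤ e₄ :+ kx :+ ny)
    (E r X′ Y′) (E r X Y′) (E (λ y x → r x y) Y′ X) (E r X Y) (k * cnt (X′ ∖ X)) (n * cnt (Y′ ∖ Y))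
    (half r X X′ Y′) (≤-reflexive (E-flip r X Y′)) (subst (λ e → E (λ y x → r x y) Y′ X ≤ e + n * cnt (Y′ ∖ Y)) (sym (E-flip r X Y)) (half (λ y x → r x y) Y Y′ X))
  where
  half : ∀ {n k} (r : Fin n → Fin k → Bool) X X′ Y → E r X′ Y ≤ E r X Y + k * cnt (X′ ∖ X)
  half {n} {k} r X X′ Y = ≤-trans (E-cover r {X₂ = X′ ∖ X} cover) (+-monoʳ-≤ (E r X Y) (E-≤ r k λ _ _ → cnt≤n _))
    where
    cover : ∀ x → X′ x ≡ true → X x ≡ true ⊎ (X′ ∖ X) x ≡ true
    cover x h with bool? (X x)
    ... | inj₁ p = inj₁ p
    ... | inj₂ p = inj₂ (∖-intro h p)

opaque
  unfolding cnt E

  ∣tabulate∣ : ∀ {n} (f : Fin n → Bool) → ∣ tabulate f ∣ ≡ cnt f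
  ∣tabulate∣ {zero} f = refl
  ∣tabulate∣ {suc n} f with f zero
  ... | true = cong suc (∣tabulate∣ (f ∘ suc))
  ... | false = ∣tabulate∣ (f ∘ suc)

  edges-tabulate : ∀ {N} (G : TriGraph N) i j X Y → edges G i j (tabulate X) (tabulate Y) ≡ E (adj G i j) X Y
  edges-tabulate G i j X Y = sum-cong λ x → sum-cong λ y →
    cong₂ (λ p q → b2n (p ∧ q ∧ adj G i j x y)) (lookup∘tabulate X x) (lookup∘tabulate Y y)

  deg-cnt : ∀ {N} (G : TriGraph N) i j x → deg G i j x ≡ cnt (adj G i j x)
  deg-cnt G i j x = refl

family : ∀ {A : Set} → A → A → A → Fin 3 → A
family x y z c₁ = x
family x y z c₂ = y
family x y z c₃ = z

-- The search rebuilds a function from its values, so the predicate has to respect pointwise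
-- equality.
∃-fun? : ∀ n {m} {P : (Fin n → Fin m) → Set} → (∀ {f g} → (∀ x → f x ≡ g x) → P f → P g) → (∀ f → Dec (P f)) → Dec (∃[ f ] P f)
∃-fun? zero {P = P} resp P? = map′ (λ p → _ , p) (λ { (f , p) → resp {f} (λ ()) p }) (P? λ ())
∃-fun? (suc n) {P = P} resp P? = map′ (λ { (x , f , p) → cons x f , p }) (λ { (f , p) → f zero , f ∘ suc , resp (λ { zero → refl ; (suc x) → refl }) p })
  (Fin.any? λ x → ∃-fun? n {P = λ f → P (cons x f)} (λ h → resp (λ { zero → refl ; (suc y) → h y })) (λ f → P? (cons x f)))

injective? : ∀ {n m} (f : Fin n → Fin m) → Dec (Injective _≡_ _≡_ f)
injective? f = map′ (λ h {x} {y} → h x y) (λ h x y → h) (Fin.all? λ x → Fin.all? λ y → (f x Fin.≟ f y) →-dec (x Fin.≟ y))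

triangleFactor? : ∀ {N} (G : TriGraph N) → Dec (TriangleFactor G)
triangleFactor? {N} G =
  ∃-fun? N (λ { {f} {g} h (ρ , inj , inj′ , t) → ρ , (λ e → inj (trans (h _) (trans e (sym (h _))))) , inj′ ,
      λ k → subst (λ v → adj G c₁ c₂ k v ≡ true × adj G c₁ c₃ k (ρ k) ≡ true × adj G c₂ c₃ v (ρ k) ≡ true) (h k) (t k) })
    λ f → ∃-fun? N (λ { {ρ} {ρ′} h (inj , inj′ , t) → inj , (λ e → inj′ (trans (h _) (trans e (sym (h _))))) ,
      λ k → subst (λ v → adj G c₁ c₂ k (f k) ≡ true × adj G c₁ c₃ k v ≡ true × adj G c₂ c₃ (f k) v ≡ true) (h k) (t k) })
    λ ρ → injective? f ×-dec injective? ρ ×-dec Fin.all? λ k →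
      (adj G c₁ c₂ k (f k) Bool.≟ true) ×-dec (adj G c₁ c₃ k (ρ k) Bool.≟ true) ×-dec (adj G c₂ c₃ (f k) (ρ k) Bool.≟ true)

sparseTriple? : ∀ {N} (G : TriGraph N) Δ → Dec (SparseTriple G Δ)
sparseTriple? {N} G Δ = map′ (λ { (X , Y , Z , q) → family X Y Z , q })
    (λ { (X , s , d) → X c₁ , X c₂ , X c₃ , (λ i → trans (cong ∣_∣ (fam X i)) (s i)) ,
      λ i j n → subst₂ (λ A B → density G i j A B ≤ℚ Δ) (sym (fam X i)) (sym (fam X j)) (d i j n) })
    (anySubset? λ X → anySubset? λ Y → anySubset? λ Z →
      Fin.all? (λ i → ∣ family X Y Z i ∣ ≟ N / 3) ×-dec
      Fin.all? λ i → Fin.all? λ j → ¬? (i Fin.≟ j) →-dec (density G i j (family X Y Z i) (family X Y Z j) ℚ.≤? Δ))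
  where
  fam : ∀ (X : Fin 3 → Subset N) i → family (X c₁) (X c₂) (X c₃) i ≡ X i
  fam X c₁ = refl
  fam X c₂ = refl
  fam X c₃ = refl

perfect-factor : ∀ {N} (G : TriGraph N) (τ : State N) → (∀ p → Triangles.bad (adj G) (TriGraph.sym G) τ p ≡ false) → TriangleFactor G
perfect-factor {N} G τ good = to c₂ , to c₃ , injective c₂ , injective c₃ , λ k →
    subst (λ v → adj G c₁ c₂ v (to c₂ k) ≡ true) (inverseʳ (τ c₁)) (good-elim {τ} {back k} t₁₂₃ (good (back k)))
  , subst (λ v → adj G c₁ c₃ v (to c₃ k) ≡ true) (inverseʳ (τ c₁)) (good-elim {τ} {back k} t₁₃₂ (good (back k)))
  , good-elim {τ} {back k} t₂₃₁ (good (back k))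
  where
  open Triangles (adj G) (TriGraph.sym G)
  back : Fin N → Fin N
  back k = τ c₁ ⟨$⟩ˡ k
  to : Fin 3 → Fin N → Fin N
  to c k = τ c ⟨$⟩ʳ back k
  injective : ∀ c → Injective _≡_ _≡_ (to c)
  injective c {x} {y} e = trans (sym (inverseʳ (τ c₁))) (trans (cong (τ c₁ ⟨$⟩ʳ_) (trans (sym (inverseˡ (τ c))) (trans (cong (τ c ⟨$⟩ˡ_) e) (inverseˡ (τ c))))) (inverseʳ (τ c₁)))

module _ {N : ℕ} (G : TriGraph N) {m u q : ℕ} {Δ : ℚ} (N≡3m : N ≡ 3 * m) (small : 1800 * suc q * u ≤ m) (q≤Δ : (ℤ.+ 1 /ℚ suc q) ≤ℚ Δ) where

  private
    m≤N : m ≤ N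
    m≤N = subst (m ≤_) (sym N≡3m) (m≤m+n m (2 * m))

    N/3 : m ≡ N / 3
    N/3 = trans (sym (m*n/n≡m m 3)) (cong (_/ 3) (trans (*-comm m 3) (sym N≡3m)))

  -- Resizing both sides adds `200 u N` edges each to the given `200 u N`. As `N` is `3 m`, the
  -- total is at most `1800 u m`, which explains the factor in `small`.
  sparse₁₂₃ : ∀ X Y Z → m ≤ cnt X + 200 * u → m ≤ cnt Y + 200 * u → m ≤ cnt Z + 200 * u →
    E (adj G c₁ c₂) X Y ≤ 200 * (u * N) → E (adj G c₁ c₃) X Z ≤ 200 * (u * N) → E (adj G c₂ c₃) Y Z ≤ 200 * (u * N) → SparseTriple G Δ
  sparse₁₂₃ X Y Z x y z xy xz yz = build (resize X m (200 * u) m≤N x) (resize Y m (200 * u) m≤N y) (resize Z m (200 * u) m≤N z)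
    where
    Resized : (Fin N → Bool) → Set
    Resized X = ∃[ X′ ] cnt X′ ≡ m × cnt (X′ ∖ X) ≤ 200 * u
    build : Resized X → Resized Y → Resized Z → SparseTriple G Δ
    build (X′ , ex , dx) (Y′ , ey , dy) (Z′ , ez , dz) = (λ i → tabulate (Φ i)) , (λ i → trans (size i) N/3) , dens
      where
      Φ : Fin 3 → Fin N → Bool
      Φ = family X′ Y′ Z′
      size : ∀ i → ∣ tabulate (Φ i) ∣ ≡ m
      size c₁ = trans (∣tabulate∣ X′) ex
      size c₂ = trans (∣tabulate∣ Y′) ey
      size c₃ = trans (∣tabulate∣ Z′) ez
      bound : ∀ i j A A′ B B′ → cnt (A′ ∖ A) ≤ 200 * u → cnt (B′ ∖ B) ≤ 200 * u → E (adj G i j) A B ≤ 200 * (u * N) → E (adj G i j) A′ B′ ≤ 600 * (u * N)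
      bound i j A A′ B B′ p q r = lin 6 (λ e e′ n x y u → (e′ :≤ e :+ n :* x :+ n :* y) ⇒ (e :≤ 200 · (u :* n)) ⇒ (n :* x :≤ n :* (200 · u)) ⇒ (n :* y :≤ n :* (200 · u)) ⇒ ⊢ e′ :≤ 600 · (u :* n))
        (E (adj G i j) A B) (E (adj G i j) A′ B′) N (cnt (A′ ∖ A)) (cnt (B′ ∖ B)) u (E-resize (adj G i j) A A′ B B′) r (*-monoʳ-≤ N p) (*-monoʳ-≤ N q)
      turn : ∀ i j A B {e} → E (adj G i j) A B ≤ e → E (adj G j i) B A ≤ e
      turn i j A B h = ≤-trans (≤-reflexive (trans (E-flip (adj G j i) B A) (E-cong (λ x y → TriGraph.sym G j i y x) A B))) h
      few : ∀ i j → i ≢ j → E (adj G i j) (Φ i) (Φ j) ≤ 600 * (u * N)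
      few c₁ c₁ n = ⊥-elim (n refl)
      few c₁ c₂ _ = bound c₁ c₂ X X′ Y Y′ dx dy xy
      few c₁ c₃ _ = bound c₁ c₃ X X′ Z Z′ dx dz xz
      few c₂ c₁ _ = turn c₁ c₂ X′ Y′ (few c₁ c₂ (λ ()))
      few c₂ c₂ n = ⊥-elim (n refl)
      few c₂ c₃ _ = bound c₂ c₃ Y Y′ Z Z′ dy dz yz
      few c₃ c₁ _ = turn c₁ c₃ X′ Z′ (few c₁ c₃ (λ ()))
      few c₃ c₂ _ = turn c₂ c₃ Y′ Z′ (few c₂ c₃ (λ ()))
      few c₃ c₃ n = ⊥-elim (n refl)
      dens : ∀ i j → i ≢ j → density G i j (tabulate (Φ i)) (tabulate (Φ j)) ≤ℚ Δ
      dens i j n = frac-≤ _ _ q q≤Δ (subst₂ (λ e k → e * suc q ≤ k) (sym (edges-tabulate G i j (Φ i) (Φ j))) (sym (cong₂ _*_ (size i) (size j)))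
        (lin 5 (λ e q u N m → (e :* (con 1 :+ q) :≤ 600 · (u :* N) :* (con 1 :+ q)) ⇒ (600 · (u :* N) :* (con 1 :+ q) :≤ 600 · (u :* (3 · m)) :* (con 1 :+ q)) ⇒ ((con 1800 :* (con 1 :+ q) :* u) :* m :≤ m :* m) ⇒ ⊢ e :* (con 1 :+ q) :≤ m :* m)
          (E (adj G i j) (Φ i) (Φ j)) q u N m (*-monoˡ-≤ (suc q) (few i j n)) (≤-reflexive (cong (λ z → 600 * (u * z) * suc q) N≡3m)) (*-monoˡ-≤ m small)))

  sparse : ∀ {i j k} → Tri i j k → ∀ X Y Z → m ≤ cnt X + 200 * u → m ≤ cnt Y + 200 * u → m ≤ cnt Z + 200 * u →
    E (adj G i j) X Y ≤ 200 * (u * N) → E (adj G i k) X Z ≤ 200 * (u * N) → E (adj G j k) Y Z ≤ 200 * (u * N) → SparseTriple G Δ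
  sparse t X Y Z x y z xy xz yz = go t xy xz yz
    where
    turn : ∀ {i j A B e} → E (adj G i j) A B ≤ e → E (adj G j i) B A ≤ e
    turn {i} {j} {A} {B} h = ≤-trans (≤-reflexive (trans (E-flip (adj G j i) B A) (E-cong (λ x y → TriGraph.sym G j i y x) A B))) h
    go : ∀ {i j k} → Tri i j k → E (adj G i j) X Y ≤ 200 * (u * N) → E (adj G i k) X Z ≤ 200 * (u * N) → E (adj G j k) Y Z ≤ 200 * (u * N) → SparseTriple G Δ
    go t₁₂₃ xy xz yz = sparse₁₂₃ X Y Z x y z xy xz yz
    go t₁₃₂ xy xz yz = sparse₁₂₃ X Z Y x z y xz xy (turn yz)
    go t₂₁₃ xy xz yz = sparse₁₂₃ Y X Z y x z (turn xy) yz xz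
    go t₂₃₁ xy xz yz = sparse₁₂₃ Z X Y z x y (turn xz) (turn yz) xy
    go t₃₁₂ xy xz yz = sparse₁₂₃ Y Z X y z x yz (turn xy) (turn xz)
    go t₃₂₁ xy xz yz = sparse₁₂₃ Z Y X z y x (turn yz) (turn xz) (turn xy)

-- Choice of constants

-- Bernoulli's inequality for `(1 + 1 / κ) ^ n`, with denominators cleared.
bernoulli : ∀ κ n → κ ^ n * (κ + n) ≤ κ * suc κ ^ n
bernoulli κ zero = ≤-reflexive (trans (+-identityʳ (κ + 0)) (trans (+-identityʳ κ) (sym (*-identityʳ κ))))
bernoulli κ (suc n) = begin
  κ * κ ^ n * (κ + suc n)                        ≤⟨ lin 3 (λ κ n p → ⊢ κ :* p :* (κ :+ (con 1 :+ n)) :≤ (con 1 :+ κ) :* (p :* (κ :+ n))) κ n (κ ^ n) ⟩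
  suc κ * (κ ^ n * (κ + n))                      ≤⟨ *-monoʳ-≤ (suc κ) (bernoulli κ n) ⟩
  suc κ * (κ * suc κ ^ n)                        ≡⟨ move (suc κ) κ (suc κ ^ n) ⟩
  κ * (suc κ * suc κ ^ n)                        ∎
  where
  open ≤-Reasoning
  move : ∀ x y z → x * (y * z) ≡ y * (x * z)
  move = solve-∀

-- The fourth power of Bernoulli's bound gives growth of at least `(M / κ) ^ 4`, one degree more
-- than the number `N ^ 3` of triples. Hence `M * 4` units, linear in `N`, suffice.
exponential-wins : ∀ κ φ M N → 1 ≤ κ → N ≤ φ * M → φ * (φ * φ) * (κ * (κ * (κ * κ))) < M → κ ^ (M * 4) * (N * (N * N)) < suc κ ^ (M * 4)
exponential-wins κ φ M N κ-pos N≤ M-large = ≰⇒> λ h → <⇒≱ M-large (*-cancelˡ-≤ (b⁴ * (M * (M * M))) ⦃ >-nonZero pos ⦄ (begin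
    b⁴ * (M * (M * M)) * M                          ≡⟨ r₁ b M ⟩
    (b * M) * ((b * M) * ((b * M) * (b * M)))       ≤⟨ *-mono-≤ base (*-mono-≤ base (*-mono-≤ base base)) ⟩
    (κ * c) * ((κ * c) * ((κ * c) * (κ * c)))       ≡⟨ r₂ κ c ⟩
    κ⁴ * (c * (c * (c * c)))                        ≡⟨ cong (κ⁴ *_) (fourth (suc κ)) ⟨
    κ⁴ * suc κ ^ (M * 4)                            ≤⟨ *-monoʳ-≤ κ⁴ h ⟩
    κ⁴ * (κ ^ (M * 4) * (N * (N * N)))              ≤⟨ *-monoʳ-≤ κ⁴ (*-monoʳ-≤ (κ ^ (M * 4)) (*-mono-≤ N≤ (*-mono-≤ N≤ N≤))) ⟩
    κ⁴ * (κ ^ (M * 4) * (φ * M * (φ * M * (φ * M)))) ≡⟨ cong (λ z → κ⁴ * (z * (φ * M * (φ * M * (φ * M))))) (fourth κ) ⟩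
    κ⁴ * (b⁴ * (φ * M * (φ * M * (φ * M))))         ≡⟨ r₃ κ⁴ b⁴ φ M ⟩
    b⁴ * (M * (M * M)) * (φ * (φ * φ) * κ⁴)         ∎))
  where
  open ≤-Reasoning
  b c b⁴ κ⁴ : ℕ
  b = κ ^ M
  c = suc κ ^ M
  b⁴ = b * (b * (b * b))
  κ⁴ = κ * (κ * (κ * κ))
  fourth : ∀ x → x ^ (M * 4) ≡ x ^ M * (x ^ M * (x ^ M * x ^ M))
  fourth x = trans (sym (^-*-assoc x M 4)) (cong (λ z → x ^ M * (x ^ M * (x ^ M * z))) (*-identityʳ (x ^ M)))
  base : b * M ≤ κ * c
  base = ≤-trans (*-monoʳ-≤ b (m≤n+m M κ)) (bernoulli κ M)
  r₁ : ∀ b M → b * (b * (b * b)) * (M * (M * M)) * M ≡ (b * M) * ((b * M) * ((b * M) * (b * M)))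
  r₁ = solve-∀
  r₂ : ∀ κ c → (κ * c) * ((κ * c) * ((κ * c) * (κ * c))) ≡ κ * (κ * (κ * κ)) * (c * (c * (c * c)))
  r₂ = solve-∀
  r₃ : ∀ κ⁴ b⁴ φ M → κ⁴ * (b⁴ * (φ * M * (φ * M * (φ * M)))) ≡ b⁴ * (M * (M * M)) * (φ * (φ * φ) * κ⁴)
  r₃ = solve-∀
  b-pos : 1 ≤ b
  b-pos = m^n>0 κ ⦃ >-nonZero κ-pos ⦄ M
  M-pos : 1 ≤ M
  M-pos = ≤-trans (s≤s z≤n) M-large
  pos : 1 ≤ b⁴ * (M * (M * M))
  pos = *-mono-≤ (*-mono-≤ b-pos (*-mono-≤ b-pos (*-mono-≤ b-pos b-pos))) (*-mono-≤ M-pos (*-mono-≤ M-pos M-pos))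

div-≤ : ∀ m n .⦃ _ : NonZero n ⦄ → n * (m / n) ≤ m
div-≤ m n = ≤-trans (≤-reflexive (*-comm n (m / n))) (≤-trans (m≤n+m _ (m % n)) (≤-reflexive (sym (m≡m%n+[m/n]*n m n))))

div-< : ∀ m n .⦃ _ : NonZero n ⦄ → m < n * (m / n) + n
div-< m n = subst (_< n * (m / n) + n) (sym (m≡m%n+[m/n]*n m n))
  (subst₂ _<_ (+-comm _ (m % n)) refl (subst (λ z → z + m % n < n * (m / n) + n) (*-comm n (m / n)) (+-monoʳ-< (n * (m / n)) (m%n<n m n))))

div-large : ∀ m n k .⦃ _ : NonZero n ⦄ → n * k ≤ m → k ≤ m / n
div-large m n k h = ≮⇒≥ λ lt → <⇒≱ (div-< m n) (≤-trans (≤-trans (≤-reflexive (trans (+-comm _ n) (sym (*-suc n (m / n))))) (*-monoʳ-≤ n lt)) h)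

-- Rounding down loses at most a factor 2 at each stage, so `m ≤ 2 L u`, `u ≤ 40 L w` and
-- `w ≤ 1200 M`; this yields `θ = 240 L²` and `φ = 1200 θ`. The 20 exceeds the 13 = 12 + 1 needed in
-- `w-pairs`, and 600 exceeds 6 · 4 · 23 + 18 = 570 in `rounds-fit`.
module Sizes (m L u w M Y : ℕ) (L-large : 1000 ≤ L) (Y-pos : 1 ≤ Y)
  (u-≤ : L * u ≤ m) (u-< : m < L * u + L) (w-≤ : 20 * L * w ≤ u) (w-< : u < 20 * L * w + 20 * L)
  (M-≤ : 600 * M ≤ w) (M-< : w < 600 * M + 600) (Y≤M : Y ≤ M) where

  M-pos : 1 ≤ M
  M-pos = ≤-trans Y-pos Y≤M

  w-large : 600 ≤ w
  w-large = lin 2 (λ M w → (600 · M :≤ w) ⇒ (con 1 :≤ M) ⇒ ⊢ con 600 :≤ w) M w M-≤ M-pos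

  w-pos : 1 ≤ w
  w-pos = ≤-trans (s≤s z≤n) w-large

  w≤Lw : w ≤ L * w
  w≤Lw = ≤-trans (≤-reflexive (sym (*-identityˡ w))) (*-monoˡ-≤ w (≤-trans (s≤s z≤n) L-large))

  L≤Lw : L ≤ L * w
  L≤Lw = ≤-trans (≤-reflexive (sym (*-identityʳ L))) (*-monoʳ-≤ L w-pos)

  Lw≤u : 20 * (L * w) ≤ u
  Lw≤u = ≤-trans (≤-reflexive (sym (*-assoc 20 L w))) w-≤

  u-pos : 1 ≤ u
  u-pos = lin 3 (λ x w u → (w :≤ x) ⇒ (20 · x :≤ u) ⇒ (con 1 :≤ w) ⇒ ⊢ con 1 :≤ u) (L * w) w u w≤Lw Lw≤u w-pos

  L≤Lu : L ≤ L * u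
  L≤Lu = ≤-trans (≤-reflexive (sym (*-identityʳ L))) (*-monoʳ-≤ L u-pos)

  u-small : 1000 * u ≤ m
  u-small = ≤-trans (*-monoˡ-≤ u L-large) u-≤

  m≤2Lu : m ≤ 2 * (L * u)
  m≤2Lu = lin 3 (λ m L Lu → (m :< Lu :+ L) ⇒ (L :≤ Lu) ⇒ ⊢ m :≤ 2 · Lu) m L (L * u) u-< L≤Lu

  w-small : 2 * w ≤ u
  w-small = lin 3 (λ x w u → (w :≤ x) ⇒ (20 · x :≤ u) ⇒ ⊢ 2 · w :≤ u) (L * w) w u w≤Lw Lw≤u

  w-pairs : w * (3 * m) + w * (3 * m) + w * w ≤ u * u
  w-pairs = lin 4 (λ w m u L → (w :* m :≤ w :* (2 · (L :* u))) ⇒ ((20 · (L :* w)) :* u :≤ u :* u) ⇒ (w :* w :≤ (L :* w) :* u) ⇒ ⊢ w :* (3 · m) :+ w :* (3 · m) :+ w :* w :≤ u :* u)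
    w m u L (*-monoʳ-≤ w m≤2Lu) (*-monoˡ-≤ u Lw≤u) (*-mono-≤ w≤Lw (≤-trans (m≤m+n w (1 * w)) w-small))

  m≤θw : 3 * m ≤ 240 * (L * L) * w
  m≤θw = lin 4 (λ w m u L → (m :≤ 2 · (L :* u)) ⇒ (L :* u :≤ L :* (40 · (L :* w))) ⇒ ⊢ 3 · m :≤ 240 · (L :* L) :* w)
    w m u L m≤2Lu (*-monoʳ-≤ L (lin 4 (λ u L x y → (u :< y :+ 20 · L) ⇒ (y :≤ 20 · x) ⇒ (L :≤ x) ⇒ ⊢ u :≤ 40 · x) u L (L * w) (20 * L * w) w-< (≤-reflexive (*-assoc 20 L w)) L≤Lw))

  N-small : 3 * (3 * m) ≤ u * u
  N-small = lin 3 (λ m u L → (m :≤ 2 · (L :* u)) ⇒ (20 · L :* u :≤ u :* u) ⇒ ⊢ 3 · (3 · m) :≤ u :* u)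
    m u L m≤2Lu (*-monoˡ-≤ u (lin 3 (λ L x u → (L :≤ x) ⇒ (20 · x :≤ u) ⇒ ⊢ 20 · L :≤ u) L (L * w) u L≤Lw Lw≤u))

  rounds-fit : 6 * (M * 4) * 23 + 18 ≤ w
  rounds-fit = lin 2 (λ M w → (600 · M :≤ w) ⇒ (con 1 :≤ M) ⇒ ⊢ 6 · (M :* con 4) :* con 23 :+ con 18 :≤ w) M w M-≤ M-pos

  P-fits : ∀ p → p ≤ 6 * (M * 4) * 23 → p + 224 ≤ u
  P-fits p h = lin 5 (λ p M w x u → (p :≤ 6 · (M :* con 4) :* con 23) ⇒ (600 · M :≤ w) ⇒ (w :≤ x) ⇒ (20 · x :≤ u) ⇒ (con 600 :≤ w) ⇒ ⊢ p :+ con 224 :≤ u)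
    p M w (L * w) u h M-≤ w≤Lw Lw≤u w-large

  m≤φM : 3 * m ≤ 1200 * (240 * (L * L)) * M
  m≤φM = ≤-trans m≤θw (≤-trans (*-monoʳ-≤ (240 * (L * L)) (lin 2 (λ w M → (w :< 600 · M :+ con 600) ⇒ (con 1 :≤ M) ⇒ ⊢ w :≤ 1200 · M) w M M-< M-pos)) (≤-reflexive (regroup (240 * (L * L)) M)))
    where
    regroup : ∀ θ M → θ * (1200 * M) ≡ 1200 * θ * M
    regroup = solve-∀

  -- For `ε = 1 / (6 L)` the loss `ε N` is `m / (2 L)`, at most `u`.
  degree-from : ∀ d → 2 * (6 * L) * (3 * m) ≤ 3 * (6 * L) * d + 3 * (3 * m) → 2 * m ≤ d + u
  degree-from d h = *-cancelˡ-≤ (18 * L) ⦃ >-nonZero (*-mono-≤ {1} {18} {1} (s≤s z≤n) (≤-trans (s≤s z≤n) L-large)) ⦄ (lin 4 (λ m L d u → (2 · (6 · L) :* (3 · m) :≤ 3 · (6 · L) :* d :+ 3 · (3 · m)) ⇒ (m :≤ 2 · (L :* u)) ⇒ ⊢ 18 · L :* (2 · m) :≤ 18 · L :* (d :+ u))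
    m L d u h m≤2Lu)

module _ {q N m L e θ κ φ u w M Y : ℕ} {Δ : ℚ} (L≡ : 1800 * suc q ≡ L) (e≡ : suc e ≡ 6 * L)
  (θ≡ : 240 * (L * L) ≡ θ) (φ≡ : 1200 * θ ≡ φ) (κ≡ : suc κ ≡ eighteenth θ) (κ-pos : 1 ≤ κ)
  (Y-large : φ * (φ * φ) * (κ * (κ * (κ * κ))) < Y)
  (u-≤ : L * u ≤ m) (u-< : m < L * u + L) (w-≤ : 20 * L * w ≤ u) (w-< : u < 20 * L * w + 20 * L)
  (M-≤ : 600 * M ≤ w) (M-< : w < 600 * M + 600) (Y≤M : Y ≤ M)
  (q≤Δ : (ℤ.+ 1 /ℚ suc q) ≤ℚ Δ) (N≡3m : N ≡ 3 * m)
  (G : TriGraph N) (min-degree : MinDeg G (ℤ.+ 1 /ℚ suc e)) (no-factor : ¬ TriangleFactor G) (no-triple : ¬ SparseTriple G Δ) where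

  private
    L-large : 1000 ≤ L
    L-large = subst (1000 ≤_) L≡ (lin 1 (λ q → ⊢ con 1000 :≤ con 1800 :* (con 1 :+ q)) q)

    open Sizes m L u w M Y L-large (≤-trans (s≤s z≤n) Y-large) u-≤ u-< w-≤ w-< M-≤ M-< Y≤M

    nonextremal : Nonextremal m u (adj G)
    nonextremal = record
      { N≡3m = N≡3m ; u-pos = u-pos ; u-small = u-small ; a-sym = TriGraph.sym G
      ; degree = λ {i} {j} n x → subst (λ d → 2 * m ≤ d + u) (deg-cnt G i j x) (degree-from (deg G i j x)
          (subst₂ (λ s k → 2 * s * k ≤ 3 * s * deg G i j x + 3 * k) e≡ N≡3m (min-degree-ℕ e N (deg G i j x) (min-degree i j n x))))
      ; no-sparse = λ t X Y Z x y z xy xz yz → no-triple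
          (sparse G {m} {u} {q} N≡3m (subst (λ z → z * u ≤ m) (sym L≡) u-≤) q≤Δ t X Y Z x y z xy xz yz) }

    open Triangles (adj G) (TriGraph.sym G)

    no-perfect : ∀ τ → bc τ ≤ 0 → ⊥
    no-perfect τ h = no-factor (perfect-factor G τ good)
      where
      good : ∀ p → bad τ p ≡ false
      good p with bad τ p in eq
      ... | false = refl
      ... | true = ⊥-elim (<⇒≱ (cnt-< {f = λ _ → false} {bad τ} (λ _ ()) p refl eq) (≤-trans h z≤n))

    at-N : (F : ℕ → Set) → F (3 * m) → F N
    at-N F = subst F (sym N≡3m)

    N-pos : 1 ≤ N
    N-pos = at-N (1 ≤_) (lin 2 (λ m u → (con 1 :≤ u) ⇒ (1000 · u :≤ m) ⇒ ⊢ con 1 :≤ 3 · m) m u u-pos u-small)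

  impossible : ⊥
  impossible =
    let σ , P , good , absorbing , len = Rounding.rounds nonextremal w (at-N (λ k → w * k + w * k + w * w ≤ u * u) w-pairs) w-small N-pos
          θ (at-N (λ k → k ≤ θ * w) (subst (λ z → 3 * m ≤ z * w) θ≡ m≤θw)) w-pos κ κ≡ (M * 4)
          (exponential-wins κ φ M N κ-pos (at-N (λ k → k ≤ φ * M) (subst (λ z → 3 * m ≤ z * M) (trans (cong (1200 *_) θ≡) φ≡) m≤φM)) (≤-trans Y-large Y≤M)) no-perfect 23 rounds-fit
    in absorbed nonextremal (at-N (λ k → 3 * k ≤ u * u) N-small) σ P (P-fits (length P) len) good absorbing

eighteenth-large : ∀ l → 2 ≤ eighteenth (240 * (suc l * suc l))
eighteenth-large l = large (240 * (suc l * suc l)) (*-mono-≤ {2} {240} (s≤s (s≤s z≤n)) (s≤s z≤n))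
  where
  large : ∀ θ → 2 ≤ θ → 2 ≤ eighteenth θ
  large θ h = *-mono-≤ h (*-mono-≤ one (*-mono-≤ one (*-mono-≤ five (*-mono-≤ five five))))
    where
    one : 1 ≤ θ
    one = <⇒≤ h
    five : 1 ≤ fifth θ
    five = *-mono-≤ one (*-mono-≤ one (*-mono-≤ one (*-mono-≤ one one)))

by-contradiction : ∀ {A B : Set} → Dec A → Dec B → (¬ A → ¬ B → ⊥) → A ⊎ B
by-contradiction (yes a) _ _ = inj₁ a
by-contradiction (no _) (yes b) _ = inj₂ b
by-contradiction (no a) (no b) h = ⊥-elim (h a b)

-- The constants are variables bound by equations, which keeps the arithmetic symbolic. The
-- threshold for `N` is what makes the three successive divisions end with `M` at least `Y`.
fuzzy : ∀ q l θ φ κ Y → 1800 * suc q ≡ suc l → 240 * (suc l * suc l) ≡ θ → 1200 * θ ≡ φ → suc κ ≡ eighteenth θ → 1 ≤ κ →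
  φ * (φ * φ) * (κ * (κ * (κ * κ))) < Y →
  ∀ {Δ} → (ℤ.+ 1 /ℚ suc q) ≤ℚ Δ → ∀ N → 3 * (suc l * (20 * suc l * (600 * Y))) ≤ N → 3 ∣ N →
  (G : TriGraph N) → MinDeg G (ℤ.+ 1 /ℚ suc (l + 5 * suc l)) → TriangleFactor G ⊎ SparseTriple G Δ
fuzzy q l θ φ κ Y L≡ θ≡ φ≡ κ≡ κ-pos Y-large {Δ} q≤Δ N N-large (divides m N≡m3) G min-degree = by-contradiction (triangleFactor? G) (sparseTriple? G Δ)
  (impossible {q} {N} {m} {L} {l + 5 * suc l} {θ} {κ} {φ} {u} {w} {w / 600} {Y} {Δ} L≡ refl θ≡ φ≡ κ≡ κ-pos Y-large
    (div-≤ m L) (div-< m L) (div-≤ u (20 * L)) (div-< u (20 * L)) (div-≤ w 600) (div-< w 600)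
    (div-large w 600 Y (div-large u (20 * L) (600 * Y) (div-large m L (20 * L * (600 * Y)) (*-cancelˡ-≤ 3 (subst (_ ≤_) N≡3m N-large)))))
    q≤Δ N≡3m G min-degree)
  where
  N≡3m : N ≡ 3 * m
  N≡3m = trans N≡m3 (*-comm m 3)
  L u w : ℕ
  L = suc l
  u = m / L
  w = u / (20 * L)

theorem3 : ∃[ Δ₀ ] (0ℚ <ℚ Δ₀ × (∀ (Δ : ℚ) → 0ℚ <ℚ Δ → Δ ≤ℚ Δ₀ →
    ∃[ ε ] (0ℚ <ℚ ε × ∃[ N₀ ] (∀ (N : ℕ) → N₀ ≤ N → 3 ∣ N →
    (G : TriGraph N) → MinDeg G ε → TriangleFactor G ⊎ SparseTriple G Δ))))
theorem3 = 1ℚ , unit-fraction-positive 0 , λ Δ Δ-pos _ →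
  let q , q≤Δ = unit-fraction-below Δ Δ-pos
      -- Chosen so that `suc l` is `1800 * suc q` by computation; likewise the denominator
      -- `suc (l + 5 * suc l)` of `ε` is `6 * suc l`.
      l = q + 1799 * suc q
      θ = 240 * (suc l * suc l)
      κ = pred (eighteenth θ)
      Y = suc (1200 * θ * (1200 * θ * (1200 * θ)) * (κ * (κ * (κ * κ))))
  in ℤ.+ 1 /ℚ suc (l + 5 * suc l) , unit-fraction-positive (l + 5 * suc l) , 3 * (suc l * (20 * suc l * (600 * Y))) ,
    fuzzy q l θ (1200 * θ) κ Y refl refl refl (suc-pred (eighteenth θ) ⦃ >-nonZero (<⇒≤ (eighteenth-large l)) ⦄) (pred-mono-≤ (eighteenth-large l)) ≤-refl q≤Δ
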